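{- An equivalence structure $\mathfrak A$ is poly-growth automatic if, and only if, it can be written (up to isomorphism) as a finite disjoint union of structures each of which is either of the form $\mathfrak E(p)$ for a polynomial $p\in\mathbb N[\bar x]$ (in some finite tuple $\bar x$ of variables), or a countable equivalence structure in which every class is infinite.
   Context: An equivalence structure is a structure $\langle A,\sim\rangle$ where $\sim$ is an equivalence relation on $A$. For $g : \mathbb N^n \to \mathbb N\cup\{\infty\}$, $\mathfrak E(g)$ denotes the equivalence structure (unique up to isomorphism) that has, for each $k \in (\mathbb N\setminus\{0\})\cup\{\infty\}$, exactly $|g^{ -1}(k)|$ classes of size $k$ (and no other classes), where size $\infty$ means countably infinite; arguments mapped to $0$ contribute no class. A polynomial $p\in\mathbb N[x_0,\dots,x_{n-1}]$ (natural-number coefficients) is identified with the function $\mathbb N^n\to\mathbb N$ it induces. Let $\Sigma$ be a finite alphabet and $\Box\notin\Sigma$. The convolution $w_0\otimes\cdots\otimes w_{n-1}$ of words $w_i\in\Sigma^*$ is the word over $(\Sigma\cup\{\Box\})^n$ of length $\max_i|w_i|$ whose $j$-th letter is the tuple of the $j$-th letters of the $w_i$, with $\Box$ in component $i$ if $w_i$ is too short. A relation $R\subseteq(\Sigma^*)^n$ is regular if $\{w_0\otimes\cdots\otimes w_{n-1} : \langle w_0,\dots,w_{n-1}\rangle\in R\}$ is a regular language. An automatic presentation of a relational structure $\mathfrak A$ is a structure isomorphic to $\mathfrak A$ whose universe is a regular language $L\subseteq\Sigma^*$, for some finite alphabet $\Sigma$, and all of whose relations are regular. $\mathfrak A$ is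 poly-growth automatic (an automatic structure of polynomial growth) if it has an automatic presentation with universe $L$ for which there is a polynomial $p$ with $|\{w\in L : |w|\le n\}|\le p(n)$ for all $n<\omega$. -}

module Defs where

open import Data.Empty using (⊥)
open import Data.Fin using (Fin)
open import Data.Fin.Subset using (Subset; _∈_)
open import Data.List as List using (List; length; drop; applyUpTo; foldl; foldr)
import Data.List.Membership.Propositional as List∈
open import Data.Maybe using (Maybe)
open import Data.Nat using (ℕ; _*_; _^_; _⊔_; _≤_)
open import Data.Nat.ListAction using (sum)
open import Data.Product using (Σ-syntax; ∃; ∃₂; ∃-syntax; _×_; _,_; proj₁)
open import Data.Sum.Relation.Binary.Pointwise using (_⊎ₛ_)
open import Data.Vec as Vec using (Vec; []; _∷_)
open import Data.Vec.Properties.WithK using ([]=-irrelevant)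
open import Function using (_∘_; _↔_; _↣_; _⇔_; Inverse)
open import Level using (0ℓ)
open import Relation.Binary using (Rel; Setoid; IsEquivalence)
import Relation.Binary.Construct.On as On
open import Relation.Binary.PropositionalEquality using (_≡_; setoid)
open import Relation.Nullary using (¬_)
open import Relation.Nullary.Construct.Add.Supremum using (_⁺; [_]; ⊤⁺)
open import Relation.Unary using (Pred; Irrelevant; _≐_)

------------------------------------------------------------------------
-- Equivalence structures

-- A `Setoid` serves here only as the bundle ⟨A,∼⟩: `_≈_` is the relation ∼
-- of the structure, while equality of elements is `_≡_`.  In particular
-- isomorphisms are bijections with respect to `_≡_`.

EquivalenceStructure : Set₁
EquivalenceStructure = Setoid 0ℓ 0ℓ

infix 4 _≅_

_≅_ : EquivalenceStructure → EquivalenceStructure → Set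
A ≅ B = Σ[ f ∈ A.Carrier ↔ B.Carrier ]
          (∀ x y → (x A.≈ y) ⇔ (Inverse.to f x B.≈ Inverse.to f y))
  where
  module A = Setoid A
  module B = Setoid B

-- `_⊎ₛ_` never relates elements of different summands.

⨆ : List EquivalenceStructure → EquivalenceStructure
⨆ = foldr _⊎ₛ_ (setoid ⊥)

Countable : Set → Set
Countable X = X ↣ ℕ

Finite Infinite : {X : Set} → Pred X 0ℓ → Set
Finite   {X} P = ∃[ xs ] (∀ (x : X) → P x → x List∈.∈ xs)
Infinite {X} P = ¬ Finite P

EveryClassInfinite : EquivalenceStructure → Set
EveryClassInfinite A = ∀ x → Infinite (x ≈_)
  where open Setoid A

------------------------------------------------------------------------
-- The structures 𝔈(g)

-- ℕ ∪ {∞} is `ℕ ⁺`, with ∞ written `⊤⁺`.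

Block : ℕ ⁺ → Set
Block [ k ] = Fin k
Block ⊤⁺    = ℕ

-- A concrete representative of the isomorphism type: each argument x̄
-- contributes {x̄} × Block (g x̄), which is a single class of size g x̄
-- unless g x̄ = 0, when it is empty.

𝔈 : ∀ {n} → (Vec ℕ n → ℕ ⁺) → EquivalenceStructure
𝔈 {n} g = On.setoid {B = ∃ (Block ∘ g)} (setoid (Vec ℕ n)) proj₁

-- A polynomial is a finite sum of terms c · x₀^e₀ ⋯ xₙ₋₁^eₙ₋₁, each given
-- as (c , e).  The list is not normalised: only the function matters.

Polynomial : ℕ → Set
Polynomial n = List (ℕ × Vec ℕ n)

⟦_⟧ : ∀ {n} → Polynomial n → Vec ℕ n → ℕ
⟦ p ⟧ x = sum (List.map term p)
  where
  term : ℕ × Vec ℕ _ → ℕ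
  term (c , e) = c * Vec.foldr′ _*_ 1 (Vec.zipWith _^_ x e)

IsPolynomial𝔈 : EquivalenceStructure → Set
IsPolynomial𝔈 B = ∃₂ λ n (p : Polynomial n) → B ≅ 𝔈 ([_] ∘ ⟦ p ⟧)

------------------------------------------------------------------------
-- Regular languages and relations

record DFA (A : Set) : Set where
  field
    states : ℕ
    start  : Fin states
    δ      : Fin states → A → Fin states
    final  : Subset states

Accepts : {A : Set} → DFA A → Pred (List A) 0ℓ
Accepts M w = foldl δ start w ∈ final
  where open DFA M

-- Hence `∃ (Accepts M)` is a genuine subset of the set of words.

Accepts-irrelevant : {A : Set} (M : DFA A) → Irrelevant (Accepts M)
Accepts-irrelevant M = []=-irrelevant

Regular : {A : Set} → Pred (List A) 0ℓ → Set
Regular L = ∃[ M ] L ≐ Accepts M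

-- The padding symbol □ is `nothing`.

letter : {A : Set} → ℕ → List A → Maybe A
letter j w = List.head (drop j w)

convolution : ∀ {A : Set} {n} → Vec (List A) n → List (Vec (Maybe A) n)
convolution ws =
  applyUpTo (λ j → Vec.map (letter j) ws) (Vec.foldr′ _⊔_ 0 (Vec.map length ws))

RegularRelation : ∀ {A : Set} {n} → Pred (Vec (List A) n) 0ℓ → Set
RegularRelation R = Regular (λ u → ∃[ ws ] R ws × u ≡ convolution ws)

------------------------------------------------------------------------
-- Automatic presentations

-- The alphabet is `Fin k`; every finite alphabet is of this form up to
-- renaming of letters.

record AutomaticPresentation (A : EquivalenceStructure) : Set₁ where
  field
    k        : ℕ
    universe : DFA (Fin k)

  Universe : Pred (List (Fin k)) 0ℓ
  Universe = Accepts universe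

  field
    _∼_           : Rel (∃ Universe) 0ℓ
    isEquivalence : IsEquivalence _∼_

  structure : EquivalenceStructure
  structure = record { isEquivalence = isEquivalence }

  field
    isomorphic : structure ≅ A
    ∼-regular  : RegularRelation λ ws →
      ∃₂ λ u v → u ∼ v × ws ≡ proj₁ u ∷ proj₁ v ∷ []

-- |X| ≤ m is expressed by an injection of X into Fin m.

PolynomialGrowth : ∀ {k} → Pred (List (Fin k)) 0ℓ → Set
PolynomialGrowth L = Σ[ p ∈ Polynomial 1 ]
  (∀ n → (∃[ w ] L w × length w ≤ n) ↣ Fin (⟦ p ⟧ (n ∷ [])))

PolyGrowthAutomatic : EquivalenceStructure → Set₁
PolyGrowthAutomatic A =
  Σ[ P ∈ AutomaticPresentation A ] PolynomialGrowth (AutomaticPresentation.Universe P)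

{-# OPTIONS --safe #-}

-- Let L be the universe of an automatic presentation.  If the automaton of ∼ reads x ∈ L in
-- its first component while the second one is guessed, the number of its runs is an entry of
-- a product of natural matrices indexed by the letters of x.  In this way one obtains the size
-- of the class of x and the number of its lexicographically smaller elements, if the class is
-- finite, and a number that is positive iff the class is infinite.  If L has polynomial growth,
-- two facts hold: L is a finite unambiguous union of languages w₀ u₁* w₁ ⋯ uₘ* wₘ, and, after
-- useless states are deleted, the powers of the matrix of a loop have diagonal entries at most
-- 1, so that the entries of the k-th power are eventually quasi-polynomial in k, with natural
-- coefficients.  Hence L splits into finitely many copies of ℕⁿ along which the three numbers
-- are polynomials that vanish everywhere or nowhere.  The least elements of the finite classes
-- therefore fill whole pieces, each of which contributes one 𝔈(p); the infinite classes form
-- one more summand.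
--
-- Conversely, an element of 𝔈(p) with index x is coded by an accepting run on the word
-- 0^x₀ 1^x₁ ⋯ n of a nondeterministic automaton with exactly p(x) such runs, and two elements
-- are equivalent iff their runs read the same word.

module Submission where

open import Defs
import Algebra.Properties.Semiring.Sum
open import Axiom.ExcludedMiddle using (ExcludedMiddle)
import Data.Bool.Properties as Bool
open import Data.Bool using (Bool; true; false; T; if_then_else_; _∧_)
open import Data.Empty using (⊥; ⊥-elim)
open import Data.Fin as Fin using (Fin; zero; suc; toℕ; fromℕ<)
open import Data.Fin.Induction using (spo-wellFounded; spo-noetherian)
import Data.Fin.Properties as Fin
open import Data.Fin.Subset using () renaming (_∈_ to _∈ˢ_)
open import Data.List as List using (List; []; _∷_; _++_; length; map; replicate)
open import Data.List.Membership.Propositional using () renaming (_∈_ to _∈ᴸ_)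
import Data.List.Membership.Propositional.Properties as ∈ᴸ
import Data.List.Properties as List
import Data.List.Relation.Binary.Lex.Strict as Lex
open Lex using (halt; this; next)
import Data.List.Relation.Binary.Pointwise as Pointwise
open import Data.List.Relation.Unary.All using (All; []; _∷_)
open import Data.List.Relation.Unary.Any using (here; there)
open import Data.Maybe as Maybe using (Maybe; just; nothing; maybe′)
import Data.Maybe.Properties as Maybe
open import Data.Nat as ℕ
  using (ℕ; zero; suc; _+_; _*_; _^_; _⊔_; _≤_; _<_; z≤n; s≤s; NonZero; _!)
open import Data.Nat.DivMod using (_/_; _%_; m%n<n; m≡m%n+[m/n]*n; [m+kn]%n≡m%n; m<n⇒m%n≡m)
open import Data.Nat.Divisibility using (_∣_; m≤n⇒m!∣n!; m∣m*n; ∣-trans)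
import Data.Nat.Induction as ℕ
import Data.Nat.Properties as ℕ
open import Data.Nat.Tactic.RingSolver using (solve-∀)
open import Data.Product as Product
  using (Σ; Σ-syntax; ∃; ∃₂; _×_; _,_; proj₁; proj₂)
open import Data.Product.Function.NonDependent.Propositional using (_×-↔_)
open import Data.Product.Properties using (,-injective)
open import Data.Sum as Sum using (_⊎_; inj₁; inj₂; [_,_]′)
open import Data.Sum.Function.Propositional using (_⊎-↔_)
open import Data.Sum.Relation.Binary.Pointwise as Pointwise⊎ using (_⊎ₛ_)
open import Data.Unit using (⊤; tt)
open import Data.Vec as Vec using (Vec; []; _∷_; lookup)
import Data.Vec.Properties as Vec
open import Function
  using (_∘_; id; flip; _⇔_; _↔_; _↣_; mk⇔; mk↣; mk↔ₛ′; Inverse; Equivalence; Injection; case_of_)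
open import Function.Definitions using (Injective)
open import Function.Properties.Inverse using (↔-trans)
open import Induction.WellFounded using (Acc; acc)
open import Level using (0ℓ)
import Relation.Binary.Construct.On as On
open import Relation.Binary using (Rel; Setoid; IsStrictPartialOrder; tri<; tri≈; tri>)
open import Relation.Binary.PropositionalEquality
open import Relation.Nullary using (¬_; Dec; yes; no; does; contradiction)
open import Relation.Nullary.Construct.Add.Supremum using ([_])
open import Relation.Unary using (Pred; _≐_; _⊆_)

open Algebra.Properties.Semiring.Sum ℕ.+-*-semiring
  using (sum; sum-cong-≗; ∑-comm; *-distribˡ-sum; *-distribʳ-sum)

-- Polynomial functions

-- The class of x may contain words longer than x, and infinitely many of them. Therefore only
-- members of length at most |x| + C are counted, where C is such that a longer member forces the
-- class to be infinite; what y has beyond the end of x is accounted for by a final column vector.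
-- This truncation also bounds the counts by the growth of L, which is what rules out loop entries
-- of 2 or more. The second obstacle is that the polynomials must have natural coefficients, while
-- quasi-polynomials have rational ones of either sign in general. Sequences are therefore expanded
-- in the numbers C(k + j, j). Summation and shifts of k preserve natural coefficients in this
-- basis, and on multiples of n! a basis function with j ≤ n is a product of factors 1 + c x. Such a
-- product is positive everywhere, so a natural combination vanishes everywhere or nowhere. Without
-- this dichotomy the conditions "the class of x is finite" and "x is least in its class" would cut
-- through pieces.

IsPoly : ∀ {n} → (Vec ℕ n → ℕ) → Set
IsPoly {n} f = Σ[ p ∈ Polynomial n ] (∀ x → ⟦ p ⟧ x ≡ f x)

poly-cong : ∀ {n} {f g : Vec ℕ n → ℕ} → f ≗ g → IsPoly f → IsPoly g
poly-cong f≗g (p , eq) = p , λ x → trans (eq x) (f≗g x)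

monomial : ∀ {n} → Vec ℕ n → Vec ℕ n → ℕ
monomial e x = Vec.foldr′ _*_ 1 (Vec.zipWith _^_ x e)

monomial-0 : ∀ {n} (x : Vec ℕ n) → monomial (Vec.replicate n 0) x ≡ 1
monomial-0 []      = refl
monomial-0 (a ∷ x) = trans (ℕ.+-identityʳ _) (monomial-0 x)

monomial-+ : ∀ {n} (e e′ x : Vec ℕ n) →
  monomial (Vec.zipWith _+_ e e′) x ≡ monomial e x * monomial e′ x
monomial-+ []      []       []      = refl
monomial-+ (i ∷ e) (j ∷ e′) (a ∷ x) = begin
  a ^ (i + j) * monomial (Vec.zipWith _+_ e e′) x
    ≡⟨ cong₂ _*_ (ℕ.^-distribˡ-+-* a i j) (monomial-+ e e′ x) ⟩
  a ^ i * a ^ j * (monomial e x * monomial e′ x)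
    ≡⟨ interchange (a ^ i) (a ^ j) (monomial e x) (monomial e′ x) ⟩
  a ^ i * monomial e x * (a ^ j * monomial e′ x) ∎
  where
  open ≡-Reasoning
  interchange : ∀ u v s t → u * v * (s * t) ≡ u * s * (v * t)
  interchange = solve-∀

unit : ∀ {n} → Fin n → Vec ℕ n
unit {suc n} zero    = 1 ∷ Vec.replicate n 0
unit         (suc i) = 0 ∷ unit i

monomial-unit : ∀ {n} (i : Fin n) x → monomial (unit i) x ≡ lookup x i
monomial-unit zero    (a ∷ x) =
  trans (cong₂ _*_ (ℕ.*-identityʳ a) (monomial-0 x)) (ℕ.*-identityʳ a)
monomial-unit (suc i) (a ∷ x) = trans (ℕ.+-identityʳ _) (monomial-unit i x)

poly-const : ∀ {n} c → IsPoly {n} (λ _ → c)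
poly-const {n} c = (c , Vec.replicate n 0) ∷ [] , λ x →
  trans (ℕ.+-identityʳ _) (trans (cong (c *_) (monomial-0 x)) (ℕ.*-identityʳ c))

poly-var : ∀ {n} (i : Fin n) → IsPoly (λ x → lookup x i)
poly-var i = (1 , unit i) ∷ [] , λ x →
  trans (ℕ.+-identityʳ _) (trans (ℕ.+-identityʳ _) (monomial-unit i x))

⟦++⟧ : ∀ {n} (p q : Polynomial n) x → ⟦ p ++ q ⟧ x ≡ ⟦ p ⟧ x + ⟦ q ⟧ x
⟦++⟧ []            q x = refl
⟦++⟧ ((c , e) ∷ p) q x =
  trans (cong (c * monomial e x +_) (⟦++⟧ p q x)) (sym (ℕ.+-assoc (c * monomial e x) _ _))

poly-+ : ∀ {n} {f g : Vec ℕ n → ℕ} → IsPoly f → IsPoly g → IsPoly (λ x → f x + g x)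
poly-+ (p , eqp) (q , eqq) = p ++ q , λ x →
  trans (⟦++⟧ p q x) (cong₂ _+_ (eqp x) (eqq x))

infixr 7 _·ᵗ_

_·ᵗ_ : ∀ {n} → ℕ × Vec ℕ n → Polynomial n → Polynomial n
(c , e) ·ᵗ p = map (λ (c′ , e′) → c * c′ , Vec.zipWith _+_ e e′) p

⟦·ᵗ⟧ : ∀ {n} c (e : Vec ℕ n) p x → ⟦ (c , e) ·ᵗ p ⟧ x ≡ c * monomial e x * ⟦ p ⟧ x
⟦·ᵗ⟧ c e []              x = sym (ℕ.*-zeroʳ (c * monomial e x))
⟦·ᵗ⟧ c e ((c′ , e′) ∷ p) x = begin
  c * c′ * monomial (Vec.zipWith _+_ e e′) x + ⟦ (c , e) ·ᵗ p ⟧ x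
    ≡⟨ cong₂ _+_ (cong (c * c′ *_) (monomial-+ e e′ x)) (⟦·ᵗ⟧ c e p x) ⟩
  c * c′ * (monomial e x * monomial e′ x) + c * monomial e x * ⟦ p ⟧ x
    ≡⟨ rearrange c c′ (monomial e x) (monomial e′ x) (⟦ p ⟧ x) ⟩
  c * monomial e x * (c′ * monomial e′ x + ⟦ p ⟧ x) ∎
  where
  open ≡-Reasoning
  rearrange : ∀ u v s t r → u * v * (s * t) + u * s * r ≡ u * s * (v * t + r)
  rearrange = solve-∀

_·ᵖ_ : ∀ {n} → Polynomial n → Polynomial n → Polynomial n
[]      ·ᵖ q = []
(t ∷ p) ·ᵖ q = t ·ᵗ q ++ p ·ᵖ q

⟦·ᵖ⟧ : ∀ {n} (p q : Polynomial n) x → ⟦ p ·ᵖ q ⟧ x ≡ ⟦ p ⟧ x * ⟦ q ⟧ x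
⟦·ᵖ⟧ []            q x = refl
⟦·ᵖ⟧ ((c , e) ∷ p) q x = begin
  ⟦ (c , e) ·ᵗ q ++ p ·ᵖ q ⟧ x                     ≡⟨ ⟦++⟧ ((c , e) ·ᵗ q) (p ·ᵖ q) x ⟩
  ⟦ (c , e) ·ᵗ q ⟧ x + ⟦ p ·ᵖ q ⟧ x                ≡⟨ cong₂ _+_ (⟦·ᵗ⟧ c e q x) (⟦·ᵖ⟧ p q x) ⟩
  c * monomial e x * ⟦ q ⟧ x + ⟦ p ⟧ x * ⟦ q ⟧ x   ≡⟨ ℕ.*-distribʳ-+ (⟦ q ⟧ x) (c * monomial e x) _ ⟨
  (c * monomial e x + ⟦ p ⟧ x) * ⟦ q ⟧ x           ∎
  where open ≡-Reasoning

poly-* : ∀ {n} {f g : Vec ℕ n → ℕ} → IsPoly f → IsPoly g → IsPoly (λ x → f x * g x)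
poly-* (p , eqp) (q , eqq) = p ·ᵖ q , λ x →
  trans (⟦·ᵖ⟧ p q x) (cong₂ _*_ (eqp x) (eqq x))

poly-^ : ∀ {n} {f : Vec ℕ n → ℕ} → IsPoly f → ∀ k → IsPoly (λ x → f x ^ k)
poly-^ f zero    = poly-const 1
poly-^ f (suc k) = poly-* f (poly-^ f k)

poly-monomial-∘ : ∀ {m n} (ρ : Vec ℕ m → Vec ℕ n) →
  (∀ i → IsPoly (λ x → lookup (ρ x) i)) → ∀ e → IsPoly (monomial e ∘ ρ)
poly-monomial-∘ ρ hρ []      = poly-cong (λ x → nil (ρ x)) (poly-const 1)
  where
  nil : ∀ y → 1 ≡ monomial [] y
  nil [] = refl
poly-monomial-∘ ρ hρ (k ∷ e) = poly-cong (λ x → cons (ρ x))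
  (poly-* (poly-^ (hρ zero) k)
          (poly-monomial-∘ (Vec.tail ∘ ρ)
            (λ i → poly-cong (λ x → sym (lookup-tail (ρ x) i)) (hρ (suc i))) e))
  where
  cons : ∀ y → lookup y zero ^ k * monomial e (Vec.tail y) ≡ monomial (k ∷ e) y
  cons (a ∷ y) = refl
  lookup-tail : ∀ {n} (y : Vec ℕ (suc n)) i → lookup (Vec.tail y) i ≡ lookup y (suc i)
  lookup-tail (a ∷ y) i = refl

-- A substitution is any function with polynomial components rather than a tuple of polynomials, so
-- that `Vec.take`, `Vec.drop` and `Vec.replicate` can be substituted as they are.
poly-∘ : ∀ {m n} {f : Vec ℕ n → ℕ} (ρ : Vec ℕ m → Vec ℕ n) →
  (∀ i → IsPoly (λ x → lookup (ρ x) i)) → IsPoly f → IsPoly (f ∘ ρ)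
poly-∘ {m} {n} ρ hρ (p , eq) = poly-cong (eq ∘ ρ) (go p)
  where
  go : ∀ (q : Polynomial n) → IsPoly (⟦ q ⟧ ∘ ρ)
  go []            = poly-const 0
  go ((c , e) ∷ q) = poly-+ (poly-* (poly-const c) (poly-monomial-∘ ρ hρ e)) (go q)

-- A polynomial that is identically zero or nowhere zero: on a piece carrying such
-- functions, membership conditions of the form f x ≡ 0 are all or nothing.

PosPoly : ∀ {n} → (Vec ℕ n → ℕ) → Set
PosPoly f = IsPoly f × ((∀ x → f x ≡ 0) ⊎ (∀ x → 0 < f x))

pos-cong : ∀ {n} {f g : Vec ℕ n → ℕ} → f ≗ g → PosPoly f → PosPoly g
pos-cong f≗g (p , inj₁ z) = poly-cong f≗g p , inj₁ (λ x → trans (sym (f≗g x)) (z x))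
pos-cong f≗g (p , inj₂ h) = poly-cong f≗g p , inj₂ (λ x → subst (0 <_) (f≗g x) (h x))

pos-const : ∀ {n} c → PosPoly {n} (λ _ → c)
pos-const zero    = poly-const 0 , inj₁ (λ _ → refl)
pos-const (suc c) = poly-const (suc c) , inj₂ (λ _ → s≤s z≤n)

pos-+ : ∀ {n} {f g : Vec ℕ n → ℕ} → PosPoly f → PosPoly g → PosPoly (λ x → f x + g x)
pos-+ (p , s) (q , t) = poly-+ p q , sign s t
  where
  sign : _ → _ → _
  sign (inj₁ a) (inj₁ b) = inj₁ (λ x → cong₂ _+_ (a x) (b x))
  sign (inj₂ a) _        = inj₂ (λ x → ℕ.<-≤-trans (a x) (ℕ.m≤m+n _ _))
  sign _        (inj₂ b) = inj₂ (λ x → ℕ.<-≤-trans (b x) (ℕ.m≤n+m _ _))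

pos-* : ∀ {n} {f g : Vec ℕ n → ℕ} → PosPoly f → PosPoly g → PosPoly (λ x → f x * g x)
pos-* {f = f} (p , s) (q , t) = poly-* p q , sign s t
  where
  sign : _ → _ → _
  sign (inj₁ a) _        = inj₁ (λ x → cong (_* _) (a x))
  sign _        (inj₁ b) = inj₁ (λ x → trans (cong (f x *_) (b x)) (ℕ.*-zeroʳ (f x)))
  sign (inj₂ a) (inj₂ b) = inj₂ (λ x → ℕ.*-mono-< (a x) (b x))

pos-∘ : ∀ {m n} {f : Vec ℕ n → ℕ} (ρ : Vec ℕ m → Vec ℕ n) →
  (∀ i → IsPoly (λ x → lookup (ρ x) i)) → PosPoly f → PosPoly (f ∘ ρ)
pos-∘ ρ hρ (p , s) = poly-∘ ρ hρ p , Sum.map (_∘ ρ) (_∘ ρ) s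

pos-sum : ∀ {m n} (f : Fin m → Vec ℕ n → ℕ) → (∀ i → PosPoly (f i)) →
  PosPoly (λ x → sum (λ i → f i x))
pos-sum {zero}  f h = pos-const 0
pos-sum {suc m} f h = pos-+ (h zero) (pos-sum (f ∘ suc) (h ∘ suc))

-- Piecewise polynomial families of functions

-- P is a finite disjoint union of pieces, each parametrised by some ℕⁿ along which all the
-- functions F j are simultaneously PosPoly.
data Good {X J : Set} (F : J → X → ℕ) : Pred X 0ℓ → Set₁ where
  piece : ∀ {P} n (e : Vec ℕ n → X) → Injective _≡_ _≡_ e →
          P ≐ (λ x → ∃ λ v → e v ≡ x) → (∀ j → PosPoly (F j ∘ e)) → Good F P
  empty : ∀ {P} → (∀ x → ¬ P x) → Good F P
  union : ∀ {P P₁ P₂} → P ≐ (λ x → P₁ x ⊎ P₂ x) → (∀ {x} → P₁ x → ¬ P₂ x) →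
          Good F P₁ → Good F P₂ → Good F P

module _ {X J : Set} where

  good-≐ : {F : J → X → ℕ} {P Q : Pred X 0ℓ} → P ≐ Q → Good F P → Good F Q
  good-≐ (f , g) (piece n e inj (h , k) F-pos) = piece n e inj (h ∘ g , f ∘ k) F-pos
  good-≐ (f , g) (empty ¬P)                    = empty (λ x → ¬P x ∘ g)
  good-≐ (f , g) (union (h , k) dis G₁ G₂)     = union (h ∘ g , f ∘ k) dis G₁ G₂

  -- The partition is kept and only the functions change. In this way matrix entries are replaced by
  -- whatever is built from them with sums and products.
  good-map : {J′ : Set} {F : J → X → ℕ} {F′ : J′ → X → ℕ} {P : Pred X 0ℓ} →
    (∀ {n} (e : Vec ℕ n → X) → (∀ j → PosPoly (F j ∘ e)) → ∀ j → PosPoly (F′ j ∘ e)) →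
    Good F P → Good F′ P
  good-map m (piece n e inj P≐ F-pos) = piece n e inj P≐ (m e F-pos)
  good-map m (empty ¬P)               = empty ¬P
  good-map m (union P≐ dis G₁ G₂)     = union P≐ dis (good-map m G₁) (good-map m G₂)

  good-point : {F : J → X → ℕ} (x : X) → Good F (_≡ x)
  good-point {F} x = piece 0 (λ _ → x) (λ { {[]} {[]} _ → refl })
    ((λ p → [] , sym p) , (λ (_ , p) → sym p)) (λ j → pos-const (F j x))

  good-⋃ : ∀ {n} {F : J → X → ℕ} {P : Fin n → Pred X 0ℓ} →
    (∀ {i j x} → P i x → P j x → i ≡ j) → (∀ i → Good F (P i)) →
    Good F (λ x → ∃ λ i → P i x)
  good-⋃ {zero}  dis G = empty (λ _ ())
  good-⋃ {suc n} dis G = union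
    ((λ { (zero , p) → inj₁ p ; (suc i , p) → inj₂ (i , p) })
    , [ (λ p → zero , p) , (λ (i , p) → suc i , p) ]′)
    (λ { p (i , q) → case dis p q of λ () })
    (G zero) (good-⋃ (λ p q → Fin.suc-injective (dis p q)) (G ∘ suc))

module _ {X X′ J : Set} where

  -- Injectivity is asked on P alone because the concatenation of a power of a loop with a remaining
  -- word is injective only where the remaining word does not begin with the loop.
  good-image : {F : J → X′ → ℕ} {P : Pred X 0ℓ} (φ : X → X′) →
    (∀ {x y} → P x → P y → φ x ≡ φ y → x ≡ y) →
    Good (λ j → F j ∘ φ) P → Good F (λ x′ → ∃ λ x → P x × φ x ≡ x′)
  good-image φ φ-inj (piece n e inj (f , g) F-pos) = piece n (φ ∘ e)
    (λ {u} {v} eq → inj (φ-inj (g (u , refl)) (g (v , refl)) eq))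
    ((λ { (x , p , refl) → let (v , eq) = f p in v , cong φ eq })
    , (λ { (v , refl) → e v , g (v , refl) , refl }))
    F-pos
  good-image φ φ-inj (empty ¬P) = empty (λ _ (x , p , _) → ¬P x p)
  good-image φ φ-inj (union (f , g) dis G₁ G₂) = union
    ((λ (x , p , eq) → Sum.map (λ q → x , q , eq) (λ q → x , q , eq) (f p))
    , [ (λ (x , p , eq) → x , g (inj₁ p) , eq) , (λ (x , p , eq) → x , g (inj₂ p) , eq) ]′)
    (λ (x , p , eq) (y , q , eq′) →
      dis p (subst _ (sym (φ-inj (g (inj₁ p)) (g (inj₂ q)) (trans eq (sym eq′)))) q))
    (good-image φ (λ p q → φ-inj (g (inj₁ p)) (g (inj₁ q))) G₁)
    (good-image φ (λ p q → φ-inj (g (inj₂ p)) (g (inj₂ q))) G₂)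

module _ {X Y I J : Set} where

  private
    _⊗_ : (I → X → ℕ) → (J → Y → ℕ) → I × J → X × Y → ℕ
    (F ⊗ G) (i , j) (x , y) = F i x * G j y

    _⟨×⟩_ : Pred X 0ℓ → Pred Y 0ℓ → Pred (X × Y) 0ℓ
    (P ⟨×⟩ Q) (x , y) = P x × Q y

  -- Products are the right functions on pairs, since an entry of the matrix of a concatenation is a
  -- sum of products of entries. Unions are distributed first; two pieces then combine into one with
  -- m + n parameters.
  good-× : {F : I → X → ℕ} {G : J → Y → ℕ} {P : Pred X 0ℓ} {Q : Pred Y 0ℓ} →
    Good F P → Good G Q → Good (F ⊗ G) (P ⟨×⟩ Q)
  good-× (empty ¬P) H = empty (λ (x , _) (p , _) → ¬P x p)
  good-× (union (f , g) dis G₁ G₂) H = union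
    ((λ (p , q) → Sum.map (_, q) (_, q) (f p))
    , [ (λ (p , q) → g (inj₁ p) , q) , (λ (p , q) → g (inj₂ p) , q) ]′)
    (λ (p , _) (p′ , _) → dis p p′) (good-× G₁ H) (good-× G₂ H)
  good-× (piece _ _ _ _ _) (empty ¬Q) = empty (λ (_ , y) (_ , q) → ¬Q y q)
  good-× G@(piece _ _ _ _ _) (union (f , g) dis H₁ H₂) = union
    ((λ (p , q) → Sum.map (p ,_) (p ,_) (f q))
    , [ (λ (p , q) → p , g (inj₁ q)) , (λ (p , q) → p , g (inj₂ q)) ]′)
    (λ (_ , q) (_ , q′) → dis q q′) (good-× G H₁) (good-× G H₂)
  good-× (piece m d d-inj (f , g) F-pos) (piece n e e-inj (h , k) G-pos) = piece (m + n)
    (λ v → d (Vec.take m v) , e (Vec.drop m v))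
    (λ {u} {v} eq → let (eq₁ , eq₂) = ,-injective eq in
      trans (sym (Vec.take++drop≡id m u))
        (trans (cong₂ Vec._++_ (d-inj eq₁) (e-inj eq₂)) (Vec.take++drop≡id m v)))
    ((λ (p , q) →
      let (u , eq₁) = f p
          (v , eq₂) = h q
          (eq₃ , eq₄) = Vec.++-injective _ u (Vec.take++drop≡id m (u Vec.++ v)) in
      u Vec.++ v , cong₂ _,_ (trans (cong d eq₃) eq₁) (trans (cong e eq₄) eq₂))
    , (λ { (v , refl) → g (Vec.take m v , refl) , k (Vec.drop m v , refl) }))
    (λ (i , j) → pos-*
      (pos-∘ (Vec.take m) (λ l → poly-cong (λ v → sym (lookup-take m v l)) (poly-var _)) (F-pos i))
      (pos-∘ (Vec.drop m) (λ l → poly-cong (λ v → sym (lookup-drop m v l)) (poly-var _)) (G-pos j)))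
    where
    lookup-take : ∀ a {b} (v : Vec ℕ (a + b)) i → lookup (Vec.take a v) i ≡ lookup v (i Fin.↑ˡ b)
    lookup-take (suc a) (x ∷ v) zero    = refl
    lookup-take (suc a) (x ∷ v) (suc i) = lookup-take a v i
    lookup-drop : ∀ a {b} (v : Vec ℕ (a + b)) i → lookup (Vec.drop a v) i ≡ lookup v (a Fin.↑ʳ i)
    lookup-drop zero    v       i = refl
    lookup-drop (suc a) (x ∷ v) i = lookup-drop a v i

-- Sequences that eventually are natural combinations of multichoose numbers

-- Finitely many choices are merged by an operation that preserves the property from either side:
-- the maximum for bounds, multiplication of successors for exponents.
common : ∀ {m} {Q : Fin m → ℕ → Set} (_∙_ : ℕ → ℕ → ℕ) →
  (∀ {i a b} → Q i a → Q i (a ∙ b)) → (∀ {i a b} → Q i b → Q i (a ∙ b)) →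
  (∀ i → ∃ (Q i)) → ∃ λ n → ∀ i → Q i n
common {zero}  _∙_ l r h = 0 , λ ()
common {suc m} _∙_ l r h =
  let (a , p) = h zero
      (b , q) = common _∙_ l r (h ∘ suc)
  in (a ∙ b) , λ { zero → l p ; (suc i) → r (q i) }

-- multichoose j k is the binomial coefficient C(k + j, j).
multichoose : ℕ → ℕ → ℕ
multichoose zero    k       = 1
multichoose (suc j) zero    = 1
multichoose (suc j) (suc k) = multichoose (suc j) k + multichoose j (suc k)

multichoose-0 : ∀ j → multichoose j 0 ≡ 1
multichoose-0 zero    = refl
multichoose-0 (suc j) = refl

mutual

  -- The two absorption identities of binomial coefficients. They are proved together because
  -- Pascal's rule reduces either of them to both at smaller arguments.
  multichoose-sucˡ : ∀ j k → suc j * multichoose (suc j) k ≡ (k + suc j) * multichoose j k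
  multichoose-sucˡ j zero    = cong (suc j *_) (sym (multichoose-0 j))
  multichoose-sucˡ j (suc k) = begin
    suc j * (multichoose (suc j) k + multichoose j (suc k))
      ≡⟨ ℕ.*-distribˡ-+ (suc j) (multichoose (suc j) k) _ ⟩
    suc j * multichoose (suc j) k + suc j * multichoose j (suc k)
      ≡⟨ cong (_+ suc j * multichoose j (suc k))
           (trans (multichoose-sucˡ j k) (sym (multichoose-sucʳ j k))) ⟩
    suc k * multichoose j (suc k) + suc j * multichoose j (suc k)
      ≡⟨ ℕ.*-distribʳ-+ (multichoose j (suc k)) (suc k) (suc j) ⟨
    (suc k + suc j) * multichoose j (suc k) ∎
    where open ≡-Reasoning

  multichoose-sucʳ : ∀ j k → suc k * multichoose j (suc k) ≡ (k + suc j) * multichoose j k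
  multichoose-sucʳ zero    k = cong (_* 1) (ℕ.+-comm 1 k)
  multichoose-sucʳ (suc j) k = begin
    suc k * (multichoose (suc j) k + multichoose j (suc k))
      ≡⟨ ℕ.*-distribˡ-+ (suc k) (multichoose (suc j) k) _ ⟩
    suc k * multichoose (suc j) k + suc k * multichoose j (suc k)
      ≡⟨ cong (suc k * multichoose (suc j) k +_)
           (trans (multichoose-sucʳ j k) (sym (multichoose-sucˡ j k))) ⟩
    suc k * multichoose (suc j) k + suc j * multichoose (suc j) k
      ≡⟨ ℕ.*-distribʳ-+ (multichoose (suc j) k) (suc k) (suc j) ⟨
    (suc k + suc j) * multichoose (suc j) k
      ≡⟨ cong (_* multichoose (suc j) k) (ℕ.+-suc k (suc j)) ⟨
    (k + suc (suc j)) * multichoose (suc j) k ∎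
    where open ≡-Reasoning

combination : ℕ → List ℕ → ℕ → ℕ
combination j []       k = 0
combination j (c ∷ cs) k = c * multichoose j k + combination (suc j) cs k

combination-0 : ∀ i j cs → combination i cs 0 ≡ combination j cs 0
combination-0 i j []       = refl
combination-0 i j (c ∷ cs) = cong₂ _+_
  (cong (c *_) (trans (multichoose-0 i) (sym (multichoose-0 j))))
  (combination-0 (suc i) (suc j) cs)

+-interchange : ∀ a b c d → a + b + (c + d) ≡ a + c + (b + d)
+-interchange = solve-∀

-- Pascal's rule, extended linearly: raising the start index by one means taking partial sums.
-- Iterated summation thus only moves coefficients.
combination-suc : ∀ j cs k →
  combination (suc j) cs (suc k) ≡ combination (suc j) cs k + combination j cs (suc k)
combination-suc j []       k = refl
combination-suc j (c ∷ cs) k = trans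
  (cong₂ _+_ (ℕ.*-distribˡ-+ c (multichoose (suc j) k) _) (combination-suc (suc j) cs k))
  (+-interchange (c * multichoose (suc j) k) (c * multichoose j (suc k))
    (combination (suc (suc j)) cs k) (combination (suc j) cs (suc k)))

_⊕_ : List ℕ → List ℕ → List ℕ
[]       ⊕ ds       = ds
(c ∷ cs) ⊕ []       = c ∷ cs
(c ∷ cs) ⊕ (d ∷ ds) = c + d ∷ cs ⊕ ds

combination-⊕ : ∀ j cs ds k →
  combination j (cs ⊕ ds) k ≡ combination j cs k + combination j ds k
combination-⊕ j []       ds       k = refl
combination-⊕ j (c ∷ cs) []       k = sym (ℕ.+-identityʳ _)
combination-⊕ j (c ∷ cs) (d ∷ ds) k = trans
  (cong₂ _+_ (ℕ.*-distribʳ-+ (multichoose j k) c d) (combination-⊕ (suc j) cs ds k))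
  (+-interchange (c * multichoose j k) (d * multichoose j k)
    (combination (suc j) cs k) (combination (suc j) ds k))

length-⊕ : ∀ {n} cs ds → length cs ≤ n → length ds ≤ n → length (cs ⊕ ds) ≤ n
length-⊕ []       ds       _       q       = q
length-⊕ (c ∷ cs) []       p       _       = p
length-⊕ (c ∷ cs) (d ∷ ds) (s≤s p) (s≤s q) = s≤s (length-⊕ cs ds p q)

-- By the hockey-stick identity, C(k + 1 + j, j) is the sum of C(k + i, i) over i ≤ j. Hence the
-- coefficients of the shifted sequence are the suffix sums of the old ones; they remain natural and
-- do not increase in number.
shift : List ℕ → List ℕ
shift []       = []
shift (c ∷ cs) = (c ∷ cs) ⊕ shift cs

combination-shift : ∀ cs k → combination 0 (shift cs) k ≡ combination 0 cs (suc k)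
combination-shift []       k = refl
combination-shift (c ∷ cs) k = begin
  combination 0 ((c ∷ cs) ⊕ shift cs) k
    ≡⟨ combination-⊕ 0 (c ∷ cs) (shift cs) k ⟩
  c * 1 + combination 1 cs k + combination 0 (shift cs) k
    ≡⟨ cong (c * 1 + combination 1 cs k +_) (combination-shift cs k) ⟩
  c * 1 + combination 1 cs k + combination 0 cs (suc k)
    ≡⟨ ℕ.+-assoc (c * 1) (combination 1 cs k) _ ⟩
  c * 1 + (combination 1 cs k + combination 0 cs (suc k))
    ≡⟨ cong (c * 1 +_) (combination-suc 0 cs k) ⟨
  c * 1 + combination 1 cs (suc k) ∎
  where open ≡-Reasoning

length-shift : ∀ {n} cs → length cs ≤ n → length (shift cs) ≤ n
length-shift []       p = p
length-shift (c ∷ cs) p =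
  length-⊕ (c ∷ cs) (shift cs) p (length-shift cs (ℕ.≤-trans (ℕ.n≤1+n _) p))

-- One bound n serves both as offset and as bound on the number of coefficients.
record Eventually (n : ℕ) (t : ℕ → ℕ) : Set where
  constructor eventually
  field
    coefficients : List ℕ
    bound        : length coefficients ≤ n
    equation     : ∀ k → t (n + k) ≡ combination 0 coefficients k

eventually-suc : ∀ {n t} → Eventually n t → Eventually (suc n) t
eventually-suc {n} {t} (eventually cs l eq) = eventually (shift cs)
  (ℕ.≤-trans (length-shift cs l) (ℕ.n≤1+n n))
  λ k → trans (cong t (sym (ℕ.+-suc n k))) (trans (eq (suc k)) (sym (combination-shift cs k)))

eventually-≤ : ∀ {m n t} → m ≤ n → Eventually m t → Eventually n t
eventually-≤ m≤n = go (ℕ.≤⇒≤′ m≤n)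
  where
  go : ∀ {m n t} → m ℕ.≤′ n → Eventually m t → Eventually n t
  go (ℕ.≤′-reflexive refl) h = h
  go (ℕ.≤′-step p)         h = eventually-suc (go p h)

Combinatorial : (ℕ → ℕ) → Set
Combinatorial t = ∃ λ n → Eventually n t

comb-0 : Combinatorial (λ _ → 0)
comb-0 = 0 , eventually [] z≤n (λ _ → refl)

comb-+ : ∀ {s t} → Combinatorial s → Combinatorial t → Combinatorial (λ k → s k + t k)
comb-+ (m , hs) (n , ht) =
  let eventually cs l eq   = eventually-≤ (ℕ.m≤m⊔n m n) hs
      eventually ds l′ eq′ = eventually-≤ (ℕ.m≤n⊔m m n) ht
  in m ⊔ n , eventually (cs ⊕ ds) (length-⊕ cs ds l l′)
     λ k → trans (cong₂ _+_ (eq k) (eq′ k)) (sym (combination-⊕ 0 cs ds k))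

comb-* : ∀ {t} c → Combinatorial t → Combinatorial (λ k → c * t k)
comb-* zero    h = comb-0
comb-* (suc c) h = comb-+ h (comb-* c h)

comb-sum : ∀ {m} (t : Fin m → ℕ → ℕ) → (∀ i → Combinatorial (t i)) →
  Combinatorial (λ k → sum (λ i → t i k))
comb-sum {zero}  t h = comb-0
comb-sum {suc m} t h = comb-+ (h zero) (comb-sum (t ∘ suc) (h ∘ suc))

-- The recurrence of a matrix row with diagonal entry 0. Nothing is known about `t 0`, hence the
-- offset grows by one.
comb-shifted : ∀ {s t} → (∀ k → t (suc k) ≡ s k) → Combinatorial s → Combinatorial t
comb-shifted rec (n , eventually cs l eq) =
  suc n , eventually cs (ℕ.≤-trans l (ℕ.n≤1+n n)) λ k → trans (rec (n + k)) (eq k)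

-- The recurrence of a matrix row with diagonal entry 1. Beyond n, the sequence t is the constant
-- `t n` plus partial sums of s, so the coefficients of s move up one place and `t n` becomes the
-- lowest one.
comb-summed : ∀ {s t} → (∀ k → t (suc k) ≡ t k + s k) → Combinatorial s → Combinatorial t
comb-summed {s} {t} rec (n , eventually cs l eq) = suc n , eventually (t n ∷ cs) (s≤s l) go
  where
  open ≡-Reasoning
  go : ∀ k → t (suc (n + k)) ≡ t n * 1 + combination 1 cs k
  go zero    = begin
    t (suc (n + 0))                ≡⟨ rec (n + 0) ⟩
    t (n + 0) + s (n + 0)          ≡⟨ cong₂ _+_ (cong t (ℕ.+-identityʳ n)) (eq 0) ⟩
    t n + combination 0 cs 0       ≡⟨ cong₂ _+_ (sym (ℕ.*-identityʳ _)) (combination-0 0 1 cs) ⟩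
    t n * 1 + combination 1 cs 0   ∎
  go (suc k) = begin
    t (suc (n + suc k))                                        ≡⟨ rec (n + suc k) ⟩
    t (n + suc k) + s (n + suc k)
      ≡⟨ cong₂ _+_ (trans (cong t (ℕ.+-suc n k)) (go k)) (eq (suc k)) ⟩
    t n * 1 + combination 1 cs k + combination 0 cs (suc k)    ≡⟨ ℕ.+-assoc (t n * 1) _ _ ⟩
    t n * 1 + (combination 1 cs k + combination 0 cs (suc k))
      ≡⟨ cong (t n * 1 +_) (combination-suc 0 cs k) ⟨
    t n * 1 + combination 1 cs (suc k)                         ∎

-- C(N x + j, j) is the product of the factors 1 + (N / i) x over 1 ≤ i ≤ j. Divisibility makes the
-- coefficients natural, and the constant terms 1 make the product positive.
pos-multichoose : ∀ N j → (∀ i → i < j → suc i ∣ N) →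
  PosPoly {1} (λ v → multichoose j (N * lookup v zero))
pos-multichoose N zero    div = pos-const 1
pos-multichoose N (suc j) div = pos-cong (λ v → eq (lookup v zero))
  (pos-* {f = λ v → 1 + q * lookup v zero}
    (poly-+ (poly-const 1) (poly-* (poly-const q) (poly-var zero)) , inj₂ (λ _ → s≤s z≤n))
    (pos-multichoose N j (λ i i<j → div i (ℕ.m<n⇒m<1+n i<j))))
  where
  open _∣_ (div j (ℕ.n<1+n j)) renaming (quotient to q; equality to N≡)
  factor : ∀ j q x m → suc j * ((1 + q * x) * m) ≡ (q * suc j * x + suc j) * m
  factor = solve-∀
  eq : ∀ x → (1 + q * x) * multichoose j (N * x) ≡ multichoose (suc j) (N * x)
  eq x = ℕ.*-cancelˡ-≡ _ _ (suc j) (begin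
    suc j * ((1 + q * x) * multichoose j (N * x))     ≡⟨ factor j q x _ ⟩
    (q * suc j * x + suc j) * multichoose j (N * x)
      ≡⟨ cong (λ n → (n * x + suc j) * multichoose j (N * x)) N≡ ⟨
    (N * x + suc j) * multichoose j (N * x)           ≡⟨ multichoose-sucˡ j (N * x) ⟨
    suc j * multichoose (suc j) (N * x)               ∎)
    where open ≡-Reasoning

pos-combination : ∀ N j cs → (∀ i → i < j + length cs → suc i ∣ N) →
  PosPoly {1} (λ v → combination j cs (N * lookup v zero))
pos-combination N j []       div = pos-const 0
pos-combination N j (c ∷ cs) div = pos-+
  (pos-* (pos-const c) (pos-multichoose N j (λ i i<j → div i (ℕ.<-≤-trans i<j (ℕ.m≤m+n j _)))))
  (pos-combination N (suc j) cs
    (λ i i<j → div i (subst (i <_) (sym (ℕ.+-suc j (length cs))) i<j)))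

-- Splitting ℕ into points and residue classes

digit-injective : ∀ {N} (i j : Fin N) {m n} → toℕ i + m * N ≡ toℕ j + n * N → i ≡ j × m ≡ n
digit-injective {suc N} i j {m} {n} eq =
  i≡j , ℕ.*-cancelʳ-≡ m n (suc N)
    (ℕ.+-cancelˡ-≡ (toℕ i) _ _ (trans eq (cong (λ j → toℕ j + n * suc N) (sym i≡j))))
  where
  open ≡-Reasoning
  residue : ∀ (i : Fin (suc N)) k → (toℕ i + k * suc N) % suc N ≡ toℕ i
  residue i k = trans ([m+kn]%n≡m%n (toℕ i) k (suc N)) (m<n⇒m%n≡m (Fin.toℕ<n i))
  i≡j : i ≡ j
  i≡j = Fin.toℕ-injective (begin
    toℕ i                         ≡⟨ residue i m ⟨
    (toℕ i + m * suc N) % suc N   ≡⟨ cong (_% suc N) eq ⟩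
    (toℕ j + n * suc N) % suc N   ≡⟨ residue j n ⟩
    toℕ j                         ∎)

ℕ-all : Pred ℕ 0ℓ
ℕ-all _ = ⊤

module _ {J : Set} where

  good-drop : ∀ {F : J → ℕ → ℕ} n → Good (λ j k → F j (n + k)) ℕ-all → Good F ℕ-all
  good-drop     zero    G = G
  good-drop {F} (suc n) G = union
    ((λ { {zero} _ → inj₁ refl ; {suc x} _ → inj₂ (x , tt , refl) }) , _)
    (λ { refl () })
    (good-point 0)
    (good-image suc (λ _ _ → ℕ.suc-injective) (good-drop {λ j k → F j (suc k)} n G))

  good-residues : ∀ {F : J → ℕ → ℕ} N .{{_ : NonZero N}} →
    (∀ r → Good (λ j k → F j (r + k * N)) ℕ-all) → Good F ℕ-all
  good-residues {F} N h = good-≐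
    (_ , λ {x} _ → fromℕ< (m%n<n x N) , x / N , tt ,
      trans (cong (_+ x / N * N) (Fin.toℕ-fromℕ< (m%n<n x N))) (sym (m≡m%n+[m/n]*n x N)))
    (good-⋃ {n = N}
      (λ { {i} {j} (k , _ , refl) (l , _ , eq) → proj₁ (digit-injective i j {k} {l} (sym eq)) })
      (λ r → good-image (λ k → toℕ r + k * N) (λ {m} {n} _ _ eq → proj₂ (digit-injective r r {m} {n} eq))
        (h (toℕ r))))

  good-whole : ∀ {F : J → ℕ → ℕ} →
    (∀ j → PosPoly {1} (λ v → F j (lookup v zero))) → Good F ℕ-all
  good-whole h = piece 1 (λ v → lookup v zero) (λ { {_ ∷ []} {_ ∷ []} refl → refl })
    ((λ {x} _ → x ∷ [] , refl) , _) h

  -- All j share n as offset and as bound on the number of coefficients, so n! is divisible by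
  -- everything that occurs as a denominator. A residue r is absorbed by shifting the coefficients r
  -- times.
  good-combinatorial : ∀ {F : J → ℕ → ℕ} n → (∀ j → Eventually n (F j)) → Good F ℕ-all
  good-combinatorial {F} n h = good-drop n (good-residues (n !) {{ℕ._!≢0 n}} step)
    where
    shifts : ℕ → List ℕ → List ℕ
    shifts zero    cs = cs
    shifts (suc r) cs = shift (shifts r cs)
    combination-shifts : ∀ r cs k → combination 0 (shifts r cs) k ≡ combination 0 cs (r + k)
    combination-shifts zero    cs k = refl
    combination-shifts (suc r) cs k = trans (combination-shift (shifts r cs) k)
      (trans (combination-shifts r cs (suc k)) (cong (combination 0 cs) (ℕ.+-suc r k)))
    length-shifts : ∀ r cs → length cs ≤ n → length (shifts r cs) ≤ n
    length-shifts zero    cs l = l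
    length-shifts (suc r) cs l = length-shift (shifts r cs) (length-shifts r cs l)
    suc-∣-! : ∀ {i} → i < n → suc i ∣ n !
    suc-∣-! {i} i<n = ∣-trans (m∣m*n (i !)) (m≤n⇒m!∣n! i<n)
    step : ∀ r → Good (λ j k → F j (n + (r + k * n !))) ℕ-all
    step r = good-whole λ j → let eventually cs l eq = h j in
      pos-cong
        (λ v → trans (combination-shifts r cs _)
          (trans (sym (eq _)) (cong (λ m → F j (n + (r + m))) (ℕ.*-comm (n !) (lookup v zero)))))
        (pos-combination (n !) 0 (shifts r cs)
          (λ i i< → suc-∣-! (ℕ.<-≤-trans i< (length-shifts r cs l))))

-- Single terms of finite sums

term≤sum : ∀ {n} (f : Fin n → ℕ) i → f i ≤ sum f
term≤sum f zero    = ℕ.m≤m+n _ _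
term≤sum f (suc i) = ℕ.≤-trans (term≤sum (f ∘ suc) i) (ℕ.m≤n+m _ _)

two-terms≤sum : ∀ {n} (f : Fin n → ℕ) {i j} → i ≢ j → f i + f j ≤ sum f
two-terms≤sum f {zero}  {zero}  i≢j = contradiction refl i≢j
two-terms≤sum f {zero}  {suc j} i≢j = ℕ.+-monoʳ-≤ (f zero) (term≤sum (f ∘ suc) j)
two-terms≤sum f {suc i} {zero}  i≢j = subst (_≤ sum f) (ℕ.+-comm (f zero) _)
  (ℕ.+-monoʳ-≤ (f zero) (term≤sum (f ∘ suc) i))
two-terms≤sum f {suc i} {suc j} i≢j =
  ℕ.≤-trans (two-terms≤sum (f ∘ suc) (i≢j ∘ cong suc)) (ℕ.m≤n+m _ _)

others : ∀ {n} → Fin n → (Fin n → ℕ) → Fin n → ℕ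
others i f l = if does (i Fin.≟ l) then 0 else f l

sum-others : ∀ {n} (f : Fin n → ℕ) i → sum f ≡ f i + sum (others i f)
sum-others f zero    = refl
sum-others f (suc i) = trans (cong (f zero +_) (sum-others (f ∘ suc) i))
  (left-comm (f zero) (f (suc i)) (sum (others i (f ∘ suc))))
  where
  left-comm : ∀ a b c → a + (b + c) ≡ b + (a + c)
  left-comm = solve-∀

-- Powers of a natural matrix all of whose powers have diagonal entries at most 1: some
-- power is triangular with diagonal entries 0 or 1, so its powers are computed row by
-- row by iterated summation.
module Powers (em : ExcludedMiddle 0ℓ) {d} (P : ℕ → Fin d → Fin d → ℕ)
  (P-+ : ∀ a b i j → P (a + b) i j ≡ sum (λ l → P a i l * P b l j))
  (diagonal≤1 : ∀ k i → P k i i ≤ 1) where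

  P-step : ∀ {a b i l j} → 0 < P a i l → 0 < P b l j → 0 < P (a + b) i j
  P-step {a} {b} {i} {l} {j} p q = subst (0 <_) (sym (P-+ a b i j))
    (ℕ.<-≤-trans (ℕ.*-mono-< p q) (term≤sum (λ l → P a i l * P b l j) l))

  Stable : Fin d → ℕ → Set
  Stable i n = 0 < P (suc n) i i ⊎ (∀ k → P (suc k) i i ≡ 0)

  -- Chosen so that `suc (a ∙ b)` is `suc a * suc b`: a loop of length `suc a` can be repeated
  -- `suc b` times, and vice versa.
  _∙_ : ℕ → ℕ → ℕ
  a ∙ b = b + a * suc b

  loops : ∀ {i a} b → 0 < P (suc a) i i → 0 < P (suc b * suc a) i i
  loops {i} {a} zero    p = subst (λ n → 0 < P n i i) (sym (ℕ.*-identityˡ (suc a))) p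
  loops {a = a} (suc b) p = P-step {suc a} {suc b * suc a} p (loops b p)

  stable-exponent : ∃ λ n → ∀ i → Stable i n
  stable-exponent = common {Q = Stable} _∙_
    (λ {i} {a} {b} →
      Sum.map₁ (subst (λ n → 0 < P n i i) (ℕ.*-comm (suc b) (suc a)) ∘ loops b))
    (λ {_} {a} → Sum.map₁ (loops a))
    single
    where
    single : ∀ i → ∃ (Stable i)
    single i with em {∃ λ k → 0 < P (suc k) i i}
    ... | yes (k , p) = k , inj₁ p
    ... | no  ¬p      = 0 , inj₂ (λ k → ℕ.n≤0⇒n≡0 (ℕ.≮⇒≥ (λ p → ¬p (k , p))))

  N : ℕ
  N = suc (proj₁ stable-exponent)

  one-or-none : ∀ i → P N i i ≡ 1 ⊎ (∀ k → P (suc k) i i ≡ 0)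
  one-or-none i = Sum.map₁ (ℕ.≤-antisym (diagonal≤1 N i)) (proj₂ stable-exponent i)

  _≺_ : Rel (Fin d) 0ℓ
  i ≺ j = i ≢ j × ∃ λ k → 0 < P (suc k * N) i j

  -- A way from i to j and back is a loop at i, so the diagonal entry of i is positive at all
  -- positive multiples of N. Staying at i halfway and being at j halfway then are two contributions
  -- to one diagonal entry, which is at most 1.
  no-return : ∀ {i j k l} → i ≢ j → 0 < P (suc k * N) i j → ¬ 0 < P (suc l * N) j i
  no-return {i} {j} {k} {l} i≢j p q = ℕ.<⇒≱ two (diagonal≤1 (suc k * N + suc l * N) i)
    where
    loop : 0 < P (suc k * N + suc l * N) i i
    loop = P-step {suc k * N} p q
    diagonal : ∀ m → 0 < P (suc m * N) i i
    diagonal m with one-or-none i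
    ... | inj₁ one  = loops m (ℕ.≤-reflexive (sym one))
    ... | inj₂ none = contradiction (subst (0 <_) (none _) loop) λ ()
    two : 2 ≤ P (suc k * N + suc l * N) i i
    two = begin
      2 ≤⟨ ℕ.+-mono-≤ (ℕ.*-mono-≤ (diagonal k) (diagonal l)) (ℕ.*-mono-≤ p q) ⟩
      P (suc k * N) i i * P (suc l * N) i i + P (suc k * N) i j * P (suc l * N) j i
        ≤⟨ two-terms≤sum (λ m → P (suc k * N) i m * P (suc l * N) m i) i≢j ⟩
      sum (λ m → P (suc k * N) i m * P (suc l * N) m i)  ≡⟨ P-+ (suc k * N) (suc l * N) i i ⟨
      P (suc k * N + suc l * N) i i                      ∎
      where open ℕ.≤-Reasoning

  ≺-isStrictPartialOrder : IsStrictPartialOrder _≡_ _≺_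
  ≺-isStrictPartialOrder = record
    { isEquivalence = isEquivalence
    ; irrefl        = λ { refl (i≢i , _) → i≢i refl }
    ; trans         = λ { {i} {j} {l} (i≢j , k , p) (j≢l , m , q) →
        (λ { refl → no-return {k = k} {m} i≢j p q })
        , k + suc m , subst (λ n → 0 < P n i l) (sym (ℕ.*-distribʳ-+ N (suc k) (suc m)))
            (P-step {suc k * N} p q) }
    ; <-resp-≈      = (λ { refl → id }) , (λ { refl → id })
    }

  -- Row i of the next power is `P N i i` times row i of the current one plus contributions of rows
  -- l with i ≺ l. By `no-return` there are no cycles, so induction along the order solves these
  -- recurrences; the diagonal entry, 1 or 0, selects the rule.
  powers : ∀ j i → Combinatorial (λ k → P (k * N) i j)
  powers j i = go i (spo-noetherian ≺-isStrictPartialOrder i)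
    where
    other : Fin d → Fin d → ℕ → ℕ
    other i l k = others i (λ l → P N i l * P (k * N) l j) l

    rest : Fin d → ℕ → ℕ
    rest i k = sum (λ l → other i l k)

    expand : ∀ i k → P (suc k * N) i j ≡ P N i i * P (k * N) i j + rest i k
    expand i k = trans (P-+ N (k * N) i j) (sum-others (λ l → P N i l * P (k * N) l j) i)

    go : ∀ i → Acc (flip _≺_) i → Combinatorial (λ k → P (k * N) i j)
    go i (acc rs) = Sum.[ diagonal-1 , diagonal-0 ]′ (one-or-none i)
      where
      term : ∀ l → Combinatorial (other i l)
      term l with i Fin.≟ l
      ... | yes _  = comb-0
      ... | no i≢l with P N i l in eq
      ...   | zero  = comb-0
      ...   | suc c = comb-* (suc c) (go l (rs (i≢l , 0 ,
                        subst (0 <_) (trans (sym eq) (cong (λ n → P n i l) (sym (ℕ.*-identityˡ N))))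
                          (s≤s z≤n))))

      diagonal-1 : P N i i ≡ 1 → Combinatorial (λ k → P (k * N) i j)
      diagonal-1 one = comb-summed {s = rest i}
        (λ k → trans (expand i k)
          (cong (_+ rest i k) (trans (cong (_* P (k * N) i j) one) (ℕ.*-identityˡ _))))
        (comb-sum (other i) term)

      diagonal-0 : (∀ k → P (suc k) i i ≡ 0) → Combinatorial (λ k → P (k * N) i j)
      diagonal-0 none = comb-shifted {s = rest i}
        (λ k → trans (expand i k) (cong (λ c → c * P (k * N) i j + rest i k) (none _)))
        (comb-sum (other i) term)

  entry : (ℕ → ℕ) → Fin d × Fin d → ℕ → ℕ
  entry ρ (i , j) k = P (ρ k) i j

  good-powers : Good (entry id) ℕ-all
  good-powers = good-residues {F = entry id} N λ r → good-map
    {F = entry (_* N)} {F′ = entry (λ k → r + k * N)}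
    (λ e h (i , j) → pos-cong (λ v → sym (P-+ r (e v * N) i j))
      (pos-sum _ (λ l → pos-* (pos-const (P r i l)) (h (l , j)))))
    base
    where
    base : Good (entry (_* N)) ℕ-all
    base =
      let (n , h) = common {Q = λ j n → ∀ i → Eventually n (λ k → P (k * N) i j)} _⊔_
            (λ h i → eventually-≤ (ℕ.m≤m⊔n _ _) (h i)) (λ h i → eventually-≤ (ℕ.m≤n⊔m _ _) (h i))
            (λ j → common {Q = λ i n → Eventually n (λ k → P (k * N) i j)} _⊔_
              (eventually-≤ (ℕ.m≤m⊔n _ _)) (eventually-≤ (ℕ.m≤n⊔m _ _)) (powers j))
      in good-combinatorial n (λ (i , j) → h j i)

-- Matrices indexed by words

infixr 8 _^^_

_^^_ : ∀ {A : Set} → List A → ℕ → List A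
u ^^ zero  = []
u ^^ suc n = u ++ u ^^ n

^^-+ : ∀ {A : Set} (u : List A) m n → u ^^ (m + n) ≡ u ^^ m ++ u ^^ n
^^-+ u zero    n = refl
^^-+ u (suc m) n = trans (cong (u ++_) (^^-+ u m n)) (sym (List.++-assoc u _ _))

length-^^ : ∀ {A : Set} (u : List A) n → length (u ^^ n) ≡ n * length u
length-^^ u zero    = refl
length-^^ u (suc n) = trans (List.length-++ u) (cong (length u +_) (length-^^ u n))

sum-mono : ∀ {n} {f g : Fin n → ℕ} → (∀ i → f i ≤ g i) → sum f ≤ sum g
sum-mono {zero}  h = z≤n
sum-mono {suc n} h = ℕ.+-mono-≤ (h zero) (sum-mono (h ∘ suc))

sum-positive : ∀ {n} (f : Fin n → ℕ) → 0 < sum f → ∃ λ i → 0 < f i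
sum-positive {suc n} f h with f zero in eq
... | suc _ = zero , subst (0 <_) (sym eq) (s≤s z≤n)
... | zero  = let (i , p) = sum-positive (f ∘ suc) h in suc i , p

sum-zero : ∀ {n} (f : Fin n → ℕ) → (∀ i → f i ≡ 0) → sum f ≡ 0
sum-zero {zero}  f h = refl
sum-zero {suc n} f h = cong₂ _+_ (h zero) (sum-zero (f ∘ suc) (h ∘ suc))

positive-* : ∀ {m n} → 0 < m * n → 0 < m × 0 < n
positive-* {suc m} {suc n} _ = s≤s z≤n , s≤s z≤n
positive-* {suc m} {zero}  p = contradiction (subst (0 <_) (ℕ.*-zeroʳ m) p) λ ()

unit-sum : ∀ {n} (i : Fin n) (c : Fin n → ℕ) → c i ≡ sum (λ j → (if does (i Fin.≟ j) then 1 else 0) * c j)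
unit-sum {suc n} zero c = sym (trans
  (cong₂ _+_ (ℕ.*-identityˡ (c zero)) (sum-zero {n} (λ _ → 0) (λ _ → refl)))
  (ℕ.+-identityʳ (c zero)))
unit-sum (suc i) c = unit-sum i (c ∘ suc)

sum-assoc : ∀ {m n} (a : Fin m → ℕ) (B : Fin m → Fin n → ℕ) (c : Fin n → ℕ) →
  sum (λ l → a l * sum (λ j → B l j * c j)) ≡ sum (λ j → sum (λ l → a l * B l j) * c j)
sum-assoc a B c = begin
  sum (λ l → a l * sum (λ j → B l j * c j))
    ≡⟨ sum-cong-≗ (λ l → trans (*-distribˡ-sum (a l) (λ j → B l j * c j))
         (sum-cong-≗ (λ j → sym (ℕ.*-assoc (a l) (B l j) (c j))))) ⟩
  sum (λ l → sum (λ j → a l * B l j * c j))   ≡⟨ ∑-comm (λ l j → a l * B l j * c j) ⟩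
  sum (λ j → sum (λ l → a l * B l j * c j))
    ≡⟨ sum-cong-≗ (λ j → *-distribʳ-sum (c j) (λ l → a l * B l j)) ⟨
  sum (λ j → sum (λ l → a l * B l j) * c j)   ∎
  where open ≡-Reasoning

module Matrices {A : Set} {d} (M : A → Fin d → Fin d → ℕ) where

  -- For each initial state, the number of runs on the word, weighted by c at the end. The matrix
  -- itself is recovered from unit columns, and multiplicativity reduces to linearity.
  act : List A → (Fin d → ℕ) → Fin d → ℕ
  act []      c = c
  act (a ∷ w) c i = sum (λ j → M a i j * act w c j)

  mat : List A → Fin d → Fin d → ℕ
  mat w i j = act w (λ l → if does (l Fin.≟ j) then 1 else 0) i

  act-++ : ∀ u w c i → act (u ++ w) c i ≡ act u (act w c) i
  act-++ []      w c i = refl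
  act-++ (a ∷ u) w c i = sum-cong-≗ (λ j → cong (M a i j *_) (act-++ u w c j))

  act-mono : ∀ w {c c′} → (∀ i → c i ≤ c′ i) → ∀ i → act w c i ≤ act w c′ i
  act-mono []      h = h
  act-mono (a ∷ w) h i = sum-mono (λ j → ℕ.*-monoʳ-≤ (M a i j) (act-mono w h j))

  act-mat : ∀ w c i → act w c i ≡ sum (λ j → mat w i j * c j)
  act-mat []      c i = unit-sum i c
  act-mat (a ∷ w) c i = trans
    (sum-cong-≗ (λ l → cong (M a i l *_) (act-mat w c l)))
    (sum-assoc (M a i) (mat w) c)

  mat-++ : ∀ u w i j → mat (u ++ w) i j ≡ sum (λ l → mat u i l * mat w l j)
  mat-++ u w i j = trans (act-++ u w _ i) (act-mat u (λ l → mat w l j) i)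

-- Deleting the transitions into useless states makes all loop counts at most 1 as soon as
-- the relevant runs are counted by a function that grows subexponentially along pumped words.
module Trim (em : ExcludedMiddle 0ℓ) {A : Set} {d} (M : A → Fin d → Fin d → ℕ)
  (c* : Fin d → ℕ) where

  open Matrices M

  -- A single n for each pumped triple is enough, because a loop entry of 2 or more at a state that
  -- is alive yields a count of at least 2 ^ n for every n.
  Tame Alive Useful : Pred (Fin d) 0ℓ
  Tame i   = ∀ w u w′ → ∃ λ n → act (w ++ u ^^ n ++ w′) c* i < 2 ^ n
  Alive i  = ∃ λ w → 0 < act w c* i
  Useful i = Tame i × Alive i

  M′ : A → Fin d → Fin d → ℕ
  M′ a i j = if does (em {Useful j}) then M a i j else 0

  module ′ = Matrices M′

  M′-useful : ∀ {a i j} → 0 < M′ a i j → Useful j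
  M′-useful {j = j} p with em {Useful j}
  ... | yes h = h
  ... | no  _ = contradiction p λ ()

  M′≤M : ∀ a i j → M′ a i j ≤ M a i j
  M′≤M a i j with em {Useful j}
  ... | yes _ = ℕ.≤-refl
  ... | no  _ = z≤n

  act′≤act : ∀ w c i → ′.act w c i ≤ act w c i
  act′≤act []      c i = ℕ.≤-refl
  act′≤act (a ∷ w) c i = sum-mono (λ j → ℕ.*-mono-≤ (M′≤M a i j) (act′≤act w c j))

  -- The prefix w in `Tame` is arbitrary, so the letter of the transition can be put in front of it.
  tame-step : ∀ {a i j} → Tame i → 0 < M a i j → Tame j
  tame-step {a} {i} {j} t p w u w′ =
    let (n , h) = t (a ∷ w) u w′
        v       = w ++ u ^^ n ++ w′
    in n , (begin-strict
      act v c* j               ≡⟨ ℕ.*-identityˡ _ ⟨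
      1 * act v c* j           ≤⟨ ℕ.*-monoˡ-≤ (act v c* j) p ⟩
      M a i j * act v c* j     ≤⟨ term≤sum (λ j → M a i j * act v c* j) j ⟩
      act (a ∷ v) c* i         <⟨ h ⟩
      2 ^ n                    ∎)
    where open ℕ.≤-Reasoning

  -- Tameness passes along the run, so a deleted transition leads into a state that is not alive and
  -- contributes 0. Aliveness refers to `c*`; thus one trimmed family serves every column below
  -- `c*`.
  act-trim : ∀ {c} → (∀ i → c i ≤ c* i) → ∀ w {i} → Tame i → act w c i ≡ ′.act w c i
  act-trim c≤ []      t = refl
  act-trim {c} c≤ (a ∷ w) {i} t = sum-cong-≗ term
    where
    term : ∀ j → M a i j * act w c j ≡ M′ a i j * ′.act w c j
    term j with M a i j in eq | em {Useful j}
    ... | zero  | yes _ = refl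
    ... | zero  | no _  = refl
    ... | suc m | yes (t′ , _) = cong (suc m *_) (act-trim c≤ w t′)
    ... | suc m | no ¬u = trans (cong (suc m *_) (ℕ.n≤0⇒n≡0 (ℕ.≮⇒≥ (λ p → ¬u
            (tame-step t (subst (0 <_) (sym eq) (s≤s z≤n))
            , w , ℕ.<-≤-trans p (act-mono w c≤ j)))))) (ℕ.*-zeroʳ (suc m))

  -- Only transitions into useful states survive, and a run on a nonempty word ends with a
  -- transition into j. The empty word gives the identity matrix and is treated apart in
  -- `mat′-loop`.
  mat′-useful : ∀ a w {i j} → 0 < ′.mat (a ∷ w) i j → Useful j
  mat′-useful a w {i} {j} p with sum-positive _ p
  ... | l , q with positive-* {M′ a i l} q
  mat′-useful a []      {i} {j} p | l , q | r , s with l Fin.≟ j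
  ... | yes refl = M′-useful r
  ... | no _     = contradiction s λ ()
  mat′-useful a (b ∷ w) p | l , q | r , s = mat′-useful b w s

  mat-loop : ∀ u i n → mat u i i ^ n ≤ mat (u ^^ n) i i
  mat-loop u i zero    with i Fin.≟ i
  ... | yes _  = ℕ.≤-refl
  ... | no i≢i = contradiction refl i≢i
  mat-loop u i (suc n) = begin
    mat u i i * mat u i i ^ n                     ≤⟨ ℕ.*-monoʳ-≤ (mat u i i) (mat-loop u i n) ⟩
    mat u i i * mat (u ^^ n) i i                  ≤⟨ term≤sum (λ l → mat u i l * mat (u ^^ n) l i) i ⟩
    sum (λ l → mat u i l * mat (u ^^ n) l i)      ≡⟨ mat-++ u (u ^^ n) i i ⟨
    mat (u ++ u ^^ n) i i                         ∎
    where open ℕ.≤-Reasoning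

  -- With an entry of 2 or more, u ^^ n has at least 2 ^ n runs from i to i. A word witnessing that
  -- i is alive completes them with positive weight, against tameness.
  useful-loop : ∀ u {i} → Useful i → mat u i i ≤ 1
  useful-loop u {i} (tame , w , p) with ℕ.<-cmp 1 (mat u i i)
  ... | tri≈ _ eq _ = ℕ.≤-reflexive (sym eq)
  ... | tri> _ _ lt = ℕ.<⇒≤ lt
  ... | tri< 2≤ _ _ = let (n , h) = tame [] u w in contradiction (begin
    2 ^ n                                     ≤⟨ ℕ.^-monoˡ-≤ n 2≤ ⟩
    mat u i i ^ n                             ≤⟨ mat-loop u i n ⟩
    mat (u ^^ n) i i                          ≡⟨ ℕ.*-identityʳ _ ⟨
    mat (u ^^ n) i i * 1                      ≤⟨ ℕ.*-monoʳ-≤ (mat (u ^^ n) i i) p ⟩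
    mat (u ^^ n) i i * act w c* i             ≤⟨ term≤sum (λ j → mat (u ^^ n) i j * act w c* j) i ⟩
    sum (λ j → mat (u ^^ n) i j * act w c* j) ≡⟨ act-mat (u ^^ n) (act w c*) i ⟨
    act (u ^^ n) (act w c*) i                 ≡⟨ act-++ (u ^^ n) w c* i ⟨
    act (u ^^ n ++ w) c* i                    ∎) (ℕ.<⇒≱ h)
    where open ℕ.≤-Reasoning

  mat′-loop : ∀ u i → ′.mat u i i ≤ 1
  mat′-loop []      i with i Fin.≟ i
  ... | yes _ = ℕ.≤-refl
  ... | no  _ = z≤n
  mat′-loop (a ∷ u) i with ′.mat (a ∷ u) i i in eq
  ... | zero  = z≤n
  ... | suc m = subst (_≤ 1) eq (ℕ.≤-trans (act′≤act (a ∷ u) _ i)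
                  (useful-loop (a ∷ u) (mat′-useful a u (subst (0 <_) (sym eq) (s≤s z≤n)))))

-- Polynomials against powers of two

n<2^n : ∀ n → n < 2 ^ n
n<2^n zero    = s≤s z≤n
n<2^n (suc n) = begin-strict
  suc n              <⟨ s≤s (n<2^n n) ⟩
  1 + 2 ^ n          ≤⟨ ℕ.+-monoˡ-≤ (2 ^ n) (ℕ.m^n>0 2 n) ⟩
  2 ^ n + 2 ^ n      ≡⟨ cong (2 ^ n +_) (ℕ.+-identityʳ (2 ^ n)) ⟨
  2 ^ suc n          ∎
  where open ℕ.≤-Reasoning

-- With t = K + 2 D and m = 2 t, the linear expression stays below the square of t + 1, and t + 1 is
-- at most 2 ^ t.
linear<2^ : ∀ K D → ∃ λ m → K + suc m * D < 2 ^ m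
linear<2^ K D = t + t , (begin-strict
  K + suc (t + t) * D                            ≤⟨ ℕ.m≤m+n _ _ ⟩
  K + suc (t + t) * D + (t * K + D + t)          <⟨ ℕ.n<1+n _ ⟩
  suc (K + suc (t + t) * D + (t * K + D + t))    ≡⟨ square K D ⟩
  suc t * suc t                                  ≤⟨ ℕ.*-mono-≤ (n<2^n t) (n<2^n t) ⟩
  2 ^ t * 2 ^ t                                  ≡⟨ ℕ.^-distribˡ-+-* 2 t t ⟨
  2 ^ (t + t)                                    ∎)
  where
  open ℕ.≤-Reasoning
  t = K + (D + D)
  square : ∀ K D →
    suc (K + suc (K + (D + D) + (K + (D + D))) * D + ((K + (D + D)) * K + D + (K + (D + D))))
      ≡ suc (K + (D + D)) * suc (K + (D + D))
  square = solve-∀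

^-distribʳ-* : ∀ m n o → (m * n) ^ o ≡ m ^ o * n ^ o
^-distribʳ-* m n zero    = refl
^-distribʳ-* m n (suc o) = trans (cong (m * n *_) (^-distribʳ-* m n o))
  (ℕ.[m*n]*[o*p]≡[m*o]*[n*p] m n (m ^ o) (n ^ o))

poly-bound : ∀ (p : Polynomial 1) → ∃₂ λ K D → ∀ n → ⟦ p ⟧ (n ∷ []) ≤ K * suc n ^ D
poly-bound []                   = 0 , 0 , λ _ → z≤n
poly-bound ((c , e ∷ []) ∷ p) =
  let (K , D , h) = poly-bound p in c + K , e + D , λ n → begin
    c * (n ^ e * 1) + ⟦ p ⟧ (n ∷ [])
      ≡⟨ cong (λ m → c * m + ⟦ p ⟧ (n ∷ [])) (ℕ.*-identityʳ (n ^ e)) ⟩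
    c * n ^ e + ⟦ p ⟧ (n ∷ [])
      ≤⟨ ℕ.+-mono-≤ (ℕ.*-monoʳ-≤ c (ℕ.^-monoˡ-≤ e (ℕ.n≤1+n n))) (h n) ⟩
    c * suc n ^ e + K * suc n ^ D
      ≤⟨ ℕ.+-mono-≤ (ℕ.*-monoʳ-≤ c (ℕ.^-monoʳ-≤ (suc n) (ℕ.m≤m+n e D)))
                    (ℕ.*-monoʳ-≤ K (ℕ.^-monoʳ-≤ (suc n) (ℕ.m≤n+m D e))) ⟩
    c * suc n ^ (e + D) + K * suc n ^ (e + D)
      ≡⟨ ℕ.*-distribʳ-+ (suc n ^ (e + D)) c K ⟨
    (c + K) * suc n ^ (e + D) ∎
  where open ℕ.≤-Reasoning

poly<2^ : ∀ (p : Polynomial 1) c e → ∃ λ n → ⟦ p ⟧ (n * c + e ∷ []) < 2 ^ n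
poly<2^ p c e =
  let (K , D , bound) = poly-bound p
      s               = suc (c + e)
      L               = K * s ^ D
      (m , h)         = linear<2^ L D
      -- A power of two turns (n + 1) ^ D into at most 2 ^ ((m + 1) * D), so that only a linear
      -- exponent has to be compared with 2 ^ m.
      n               = 2 ^ m
      suc-n≤ : suc n ≤ 2 ^ suc m
      suc-n≤ = ℕ.≤-trans (ℕ.+-monoˡ-≤ n (ℕ.m^n>0 2 m))
                 (ℕ.≤-reflexive (cong (n +_) (sym (ℕ.+-identityʳ n))))
  in n , (begin-strict
    ⟦ p ⟧ (n * c + e ∷ [])           ≤⟨ bound (n * c + e) ⟩
    K * suc (n * c + e) ^ D          ≤⟨ ℕ.*-monoʳ-≤ K (ℕ.^-monoˡ-≤ D (linear n c e)) ⟩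
    K * (s * suc n) ^ D              ≡⟨ cong (K *_) (^-distribʳ-* s (suc n) D) ⟩
    K * (s ^ D * suc n ^ D)          ≡⟨ ℕ.*-assoc K (s ^ D) _ ⟨
    L * suc n ^ D                    ≤⟨ ℕ.*-mono-≤ (ℕ.<⇒≤ (n<2^n L)) (ℕ.^-monoˡ-≤ D suc-n≤) ⟩
    2 ^ L * (2 ^ suc m) ^ D          ≡⟨ cong (2 ^ L *_) (ℕ.^-*-assoc 2 (suc m) D) ⟩
    2 ^ L * 2 ^ (suc m * D)          ≡⟨ ℕ.^-distribˡ-+-* 2 L (suc m * D) ⟨
    2 ^ (L + suc m * D)              <⟨ ℕ.^-monoʳ-< 2 (s≤s (s≤s z≤n)) h ⟩
    2 ^ n                            ∎)
  where
  open ℕ.≤-Reasoning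
  linear : ∀ n c e → suc (n * c + e) ≤ suc (c + e) * suc n
  linear n c e = subst (suc (n * c + e) ≤_) (expand n c e) (ℕ.m≤m+n _ _)
    where
    expand : ∀ n c e → suc (n * c + e) + (n + c + e * n) ≡ suc (c + e) * suc n
    expand = solve-∀

-- Two loops at a useful state that start with different letters yield exponentially many words.
module Ambiguity {k} (A : DFA (Fin k)) (growth : PolynomialGrowth (Accepts A)) where

  open DFA A

  run : Fin states → List (Fin k) → Fin states
  run = List.foldl δ

  run-++ : ∀ q u v → run q (u ++ v) ≡ run (run q u) v
  run-++ q u v = List.foldl-++ δ q u v

  module _ {q a b u v} (a≢b : a ≢ b) (loop-a : run q (a ∷ u) ≡ q) (loop-b : run q (b ∷ v) ≡ q) where

    block : Fin 2 → List (Fin k)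
    block zero       = a ∷ u
    block (suc zero) = b ∷ v

    -- The n binary digits of the index, leading digit first, choose between the two loops.
    code : ∀ n → Fin (2 ^ n) → List (Fin k)
    code zero    _ = []
    code (suc n) i = let (j , i′) = Fin.remQuot {2} (2 ^ n) i in block j ++ code n i′

    run-block : ∀ j → run q (block j) ≡ q
    run-block zero       = loop-a
    run-block (suc zero) = loop-b

    run-code : ∀ n i → run q (code n i) ≡ q
    run-code zero    i = refl
    run-code (suc n) i = let (j , i′) = Fin.remQuot {2} (2 ^ n) i in
      trans (run-++ q (block j) _) (trans (cong (λ q → run q (code n i′)) (run-block j)) (run-code n i′))

    c : ℕ
    c = length (a ∷ u) + length (b ∷ v)

    length-block : ∀ j → length (block j) ≤ c
    length-block zero       = ℕ.m≤m+n _ _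
    length-block (suc zero) = ℕ.m≤n+m _ (length (a ∷ u))

    length-code : ∀ n i → length (code n i) ≤ n * c
    length-code zero    i = z≤n
    length-code (suc n) i = let (j , i′) = Fin.remQuot {2} (2 ^ n) i in
      subst (_≤ c + n * c) (sym (List.length-++ (block j)))
        (ℕ.+-mono-≤ (length-block j) (length-code n i′))

    -- The first letters a and b differ, so the two blocks form a prefix code.
    block-injective : ∀ i j {w w′} → block i ++ w ≡ block j ++ w′ → i ≡ j × w ≡ w′
    block-injective zero       zero       eq = refl , List.++-cancelˡ (a ∷ u) _ _ eq
    block-injective zero       (suc zero) eq = contradiction (List.∷-injectiveˡ eq) a≢b
    block-injective (suc zero) zero       eq = contradiction (sym (List.∷-injectiveˡ eq)) a≢b
    block-injective (suc zero) (suc zero) eq = refl , List.++-cancelˡ (b ∷ v) _ _ eq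

    code-injective : ∀ n {i i′ w} → code n i ++ w ≡ code n i′ ++ w → i ≡ i′
    code-injective zero    {zero} {zero} eq = refl
    code-injective (suc n) {i} {i′} {w} eq =
      let (j , l)   = Fin.remQuot {2} (2 ^ n) i
          (j′ , l′) = Fin.remQuot {2} (2 ^ n) i′
          (eq₁ , eq₂) = block-injective j j′
            (trans (sym (List.++-assoc (block j) _ w)) (trans eq (List.++-assoc (block j′) _ w)))
      in begin
        i                  ≡⟨ Fin.combine-remQuot {2} (2 ^ n) i ⟨
        Fin.combine j l    ≡⟨ cong₂ Fin.combine eq₁ (code-injective n eq₂) ⟩
        Fin.combine j′ l′  ≡⟨ Fin.combine-remQuot {2} (2 ^ n) i′ ⟩
        i′                 ∎
      where open ≡-Reasoning

    -- The 2 ^ n codes, placed between w and w′, are distinct accepted words of length at most n * c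
    -- + e. For a suitable n they outnumber what the growth polynomial allows at that length.
    ambiguous : ∀ {w w′} → run start w ≡ q → ¬ run q w′ ∈ˢ final
    ambiguous {w} {w′} reach accept =
      let (p , inj) = growth
          e         = length w + length w′
          (n , h)   = poly<2^ p c e
          word : Fin (2 ^ n) → ∃ λ x → Accepts A x × length x ≤ n * c + e
          word i = w ++ code n i ++ w′
            , subst (_∈ˢ final) (sym (begin
                run start (w ++ code n i ++ w′)   ≡⟨ run-++ start w _ ⟩
                run (run start w) (code n i ++ w′) ≡⟨ cong (λ q → run q (code n i ++ w′)) reach ⟩
                run q (code n i ++ w′)            ≡⟨ run-++ q (code n i) w′ ⟩
                run (run q (code n i)) w′         ≡⟨ cong (λ q → run q w′) (run-code n i) ⟩
                run q w′                          ∎)) accept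
            , ℕ.≤-trans (ℕ.≤-reflexive (trans (List.length-++ w)
                  (trans (cong (length w +_) (List.length-++ (code n i)))
                    (left-comm (length w) (length (code n i)) (length w′)))))
                (ℕ.+-monoˡ-≤ e (length-code n i))
      in ℕ.<⇒≱ h (Fin.injective⇒≤ {f = λ i → Injection.to (inj _) (word i)}
           (λ eq → code-injective n (List.++-cancelˡ w _ _
             (cong proj₁ (Injection.injective (inj _) eq)))))
      where
      open ≡-Reasoning
      left-comm : ∀ x y z → x + (y + z) ≡ y + (x + z)
      left-comm = solve-∀

-- The language of a polynomial-growth automaton is a finite union of languages obtained by
-- alternating fixed letters and powers u ^^ n of loops, in an unambiguous way.
module Decomposition (em : ExcludedMiddle 0ℓ)
  {k} (A : DFA (Fin k)) (growth : PolynomialGrowth (Accepts A))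
  {d} (M : Fin k → Fin d → Fin d → ℕ)
  (loop≤1 : ∀ u i → Matrices.mat M u i i ≤ 1) where

  open DFA A
  open Ambiguity A growth
  open Matrices M

  Language : Fin states → Pred (List (Fin k)) 0ℓ
  Language q w = run q w ∈ˢ final

  entries : Fin d × Fin d → List (Fin k) → ℕ
  entries (i , j) w = mat w i j

  -- `q′ ◃ q` means that a run from q to q′ has left the strongly connected component of q for good.
  _⟶_ _◃_ : Rel (Fin states) 0ℓ
  q ⟶ q′ = ∃ λ w → run q w ≡ q′
  q′ ◃ q = q ⟶ q′ × ¬ q′ ⟶ q

  ⟶-trans : ∀ {p q r} → p ⟶ q → q ⟶ r → p ⟶ r
  ⟶-trans {p} (u , refl) (v , refl) = u ++ v , run-++ p u v

  ◃-isStrictPartialOrder : IsStrictPartialOrder _≡_ _◃_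
  ◃-isStrictPartialOrder = record
    { isEquivalence = isEquivalence
    ; irrefl        = λ { refl (p , ¬p) → ¬p p }
    ; trans         = λ (p , ¬p) (q , ¬q) → ⟶-trans q p , λ r → ¬p (⟶-trans r q)
    ; <-resp-≈      = (λ { refl → id }) , (λ { refl → id })
    }

  Step : Fin k → Pred (List (Fin k)) 0ℓ → Pred (List (Fin k)) 0ℓ
  Step a P w′ = ∃ λ w → P w × a ∷ w ≡ w′

  good-step : ∀ {P} a → Good entries P → Good entries (Step a P)
  good-step a G = good-image (a ∷_) (λ _ _ → List.∷-injectiveʳ)
    (good-map (λ e h (i , j) → pos-sum _ (λ l → pos-* (pos-const (M a i l)) (h (l , j)))) G)

  End : Fin states → Pred (List (Fin k)) 0ℓ
  End q w = w ≡ [] × q ∈ˢ final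

  good-end : ∀ q → Good entries (End q)
  good-end q with em {q ∈ˢ final}
  ... | yes f = good-≐ ((_, f) , proj₁) (good-point [])
  ... | no ¬f = empty (λ _ → ¬f ∘ proj₂)

  good-branch : ∀ {P : Pred (List (Fin k)) 0ℓ} q (Q : Fin k → Pred (List (Fin k)) 0ℓ) →
    P ≐ (λ w → End q w ⊎ ∃ λ a → Step a (Q a) w) → (∀ a → Good entries (Q a)) → Good entries P
  good-branch q Q P≐ G = union P≐ (λ { (refl , _) (_ , _ , _ , ()) }) (good-end q)
    (good-⋃ (λ { (_ , _ , refl) (_ , _ , refl) → refl }) (λ a → good-step a (G a)))

  -- Once a loop u is split off as often as possible, the words that remain are those of
  -- which u is not a prefix.
  Rest : Fin states → List (Fin k) → Pred (List (Fin k)) 0ℓ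
  Rest q u w = Language q w × ¬ ∃ λ v → u ++ v ≡ w

  module Loop {q} (start⟶q : start ⟶ q) (alive : ∃ (Language q))
    (below : ∀ {q′} → q′ ◃ q → Good entries (Language q′)) where

    -- Here u is the unread part of the loop. A letter b other than the expected one leaves the
    -- component of q, since a way back would give two loops at q′ with different first letters;
    -- after b the hypothesis `below` applies.
    good-rest : ∀ u {q′} → q ⟶ q′ → run q′ u ≡ q → Good entries (Rest q′ u)
    -- Every word begins with the empty word, so nothing remains once the whole loop has been read.
    good-rest []      _      _    = empty (λ w (_ , ¬p) → ¬p (w , refl))
    good-rest (a ∷ u) {q′} q⟶q′ loop = good-branch q′ Q
      ((λ { {[]}    (f , _)  → inj₁ (refl , f)
          ; {b ∷ w} (f , ¬p) → inj₂ (b , w , toQ b w f ¬p , refl) })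
      , λ { (inj₁ (refl , f)) → f , λ ()
          ; (inj₂ (b , w , h , refl)) → fromQ b w h })
      good-Q
      where
      Q : Fin k → Pred (List (Fin k)) 0ℓ
      Q b with a Fin.≟ b
      ... | yes _ = Rest (δ q′ a) u
      ... | no  _ = Language (δ q′ b)

      toQ : ∀ b w → Language q′ (b ∷ w) → ¬ (∃ λ v → a ∷ u ++ v ≡ b ∷ w) → Q b w
      toQ b w f ¬p with a Fin.≟ b
      ... | yes refl = f , λ (v , eq) → ¬p (v , cong (a ∷_) eq)
      ... | no _     = f

      fromQ : ∀ b w → Q b w → Rest q′ (a ∷ u) (b ∷ w)
      fromQ b w h with a Fin.≟ b
      fromQ b w (f , ¬p) | yes refl = f , λ (v , eq) → ¬p (v , List.∷-injectiveʳ eq)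
      fromQ b w f        | no a≢b   = f , λ (v , eq) → a≢b (List.∷-injectiveˡ eq)

      good-Q : ∀ b → Good entries (Q b)
      good-Q b with a Fin.≟ b
      ... | yes refl = good-rest u (⟶-trans q⟶q′ (a ∷ [] , refl)) loop
      ... | no a≢b   = below (⟶-trans q⟶q′ (b ∷ [] , refl) , λ (v , back) →
        let (w , forth)  = q⟶q′
            (x , accept) = alive
            (y , reach)  = ⟶-trans start⟶q q⟶q′
        in ambiguous {q′} {a} {b} {u ++ w} {v ++ w} a≢b
             (trans (run-++ q′ (a ∷ u) w) (trans (cong (λ q → run q w) loop) forth))
             (trans (run-++ q′ (b ∷ v) w) (trans (cong (λ q → run q w) back) forth))
             {y} {a ∷ u ++ x} reach
             (subst (_∈ˢ final)
               (sym (trans (run-++ q′ (a ∷ u) x) (cong (λ q → run q x) loop))) accept))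

    module _ {a u} (loop : run q (a ∷ u) ≡ q) where

      v : List (Fin k)
      v = a ∷ u

      open Powers em (λ n → mat (v ^^ n))
        (λ m n i j → trans (cong (λ w → mat w i j) (^^-+ v m n)) (mat-++ (v ^^ m) (v ^^ n) i j))
        (λ n → loop≤1 (v ^^ n)) using (good-powers)

      unloop : ∀ w → Language q (v ++ w) → Language q w
      unloop w = subst (_∈ˢ final) (trans (run-++ q v w) (cong (λ q → run q w) loop))

      reloop : ∀ n {w} → Language q w → Language q (v ^^ n ++ w)
      reloop zero        f = f
      reloop (suc n) {w} f = subst (_∈ˢ final)
        (sym (trans (cong (run q) (List.++-assoc v (v ^^ n) w))
          (trans (run-++ q v (v ^^ n ++ w)) (cong (λ q → run q (v ^^ n ++ w)) loop))))
        (reloop n f)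

      -- The number m is fuel: v is nonempty, so each copy of it that is removed shortens the word.
      split : ∀ m w → length w ≤ m → Language q w →
        ∃ λ ((n , y) : ℕ × List (Fin k)) → (⊤ × Rest q v y) × v ^^ n ++ y ≡ w
      split m w l f with em {∃ λ x → v ++ x ≡ w}
      split m       w       l       f | no ¬p = (0 , w) , (tt , f , ¬p) , refl
      split (suc m) .(_)    (s≤s l) f | yes (x , refl) =
        let ((n , y) , h , eq) = split m x
              (ℕ.≤-trans (subst (length x ≤_) (sym (List.length-++ u)) (ℕ.m≤n+m _ (length u))) l)
              (unloop x f)
        in (suc n , y) , h , trans (List.++-assoc v (v ^^ n) y) (cong (v ++_) eq)

      unique : ∀ m n {x y} → Rest q v x → Rest q v y → v ^^ m ++ x ≡ v ^^ n ++ y →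
        (m , x) ≡ (n , y)
      unique zero    zero    _        _        eq = cong (0 ,_) eq
      unique zero    (suc n) {x} {y} (_ , ¬p) _        eq =
        contradiction (v ^^ n ++ y , trans (sym (List.++-assoc v (v ^^ n) y)) (sym eq)) ¬p
      unique (suc m) zero    {x} {y} _        (_ , ¬p) eq =
        contradiction (v ^^ m ++ x , trans (sym (List.++-assoc v (v ^^ m) x)) eq) ¬p
      unique (suc m) (suc n) {x} {y} h        h′       eq =
        cong (Product.map₁ suc) (unique m n h h′ (List.++-cancelˡ v _ _
          (trans (sym (List.++-assoc v (v ^^ m) x)) (trans eq (List.++-assoc v (v ^^ n) y)))))

      -- Each word of the language is, in one way only, a power of v followed by a word of
      -- `Rest q v`. Its matrix is the product of the two matrices, so the pieces for the powers and
      -- for the rest combine.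
      good-loop : Good entries (Language q)
      good-loop = good-≐
        ((λ { ((n , y) , (_ , f , _) , refl) → reloop n f })
        , λ {w} f → split (length w) w ℕ.≤-refl f)
        (good-image (λ (n , y) → v ^^ n ++ y) (λ (_ , h) (_ , h′) → unique _ _ h h′)
          (good-map
            (λ e h (i , j) → pos-cong
              (λ x → sym (mat-++ (v ^^ proj₁ (e x)) (proj₂ (e x)) i j))
              (pos-sum _ (λ l → h ((i , l) , (l , j)))))
            (good-× good-powers (good-rest v ([] , refl) loop))))

  -- Induction along `_◃_`. If no loop passes through q, every successor lies strictly below q.
  -- Otherwise any loop at q will do, for leaving it means leaving the component.
  good-language : ∀ q → start ⟶ q → Acc _◃_ q → Good entries (Language q)
  good-language q start⟶q (acc rs) with em {∃ (Language q)}
  ... | no ¬alive = empty (λ w f → ¬alive (w , f))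
  ... | yes alive with em {∃₂ λ a u → run q (a ∷ u) ≡ q}
  ...   | yes (a , u , loop) = Loop.good-loop {q} start⟶q alive
          (λ {q′} q′◃q → good-language q′ (⟶-trans start⟶q (proj₁ q′◃q)) (rs q′◃q)) {a} {u} loop
  ...   | no ¬loop = good-branch q (λ a → Language (δ q a))
          ((λ { {[]} f → inj₁ (refl , f) ; {a ∷ w} f → inj₂ (a , w , f , refl) })
          , λ { (inj₁ (refl , f)) → f ; (inj₂ (a , w , f , refl)) → f })
          (λ a → good-language (δ q a) (⟶-trans start⟶q (a ∷ [] , refl))
            (rs ((a ∷ [] , refl) , λ (u , back) → ¬loop (a , u , back))))

  good-accepts : Good entries (Accepts A)
  good-accepts =
    good-language start ([] , refl) (spo-wellFounded ◃-isStrictPartialOrder start)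

-- Finite enumerations of predicates

record Enum {X : Set} (n : ℕ) (P : Pred X 0ℓ) : Set where
  constructor enum
  field
    at        : Fin n → X
    injective : Injective _≡_ _≡_ at
    image     : P ≐ (λ x → ∃ λ i → at i ≡ x)

  at-∈ : ∀ i → P (at i)
  at-∈ i = proj₂ image (i , refl)

module _ {X : Set} where

  enum-≐ : ∀ {n} {P Q : Pred X 0ℓ} → P ≐ Q → Enum n P → Enum n Q
  enum-≐ (f , g) (enum e inj (h , k)) = enum e inj (h ∘ g , f ∘ k)

  enum-empty : {P : Pred X 0ℓ} → (∀ x → ¬ P x) → Enum 0 P
  enum-empty ¬P = enum (λ ()) (λ { {()} }) ((λ p → contradiction p (¬P _)) , λ ())

  enum-point : (x : X) → Enum 1 (_≡ x)
  enum-point x = enum (λ _ → x) (λ { {zero} {zero} _ → refl })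
    ((λ { refl → zero , refl }) , λ { (_ , refl) → refl })

  enum-∪ : ∀ {m n} {P Q : Pred X 0ℓ} → (∀ {x} → P x → ¬ Q x) →
    Enum m P → Enum n Q → Enum (m + n) (λ x → P x ⊎ Q x)
  enum-∪ {m} {n} {P} {Q} dis E₁ E₂ = enum (at ∘ Fin.splitAt m)
    (λ {i} {j} eq → trans (sym (Fin.join-splitAt m n i))
      (trans (cong (Fin.join m n) (at-injective (Fin.splitAt m i) (Fin.splitAt m j) eq))
        (Fin.join-splitAt m n j)))
    ((λ { (inj₁ p) → let (i , eq) = proj₁ E₁.image p in
            i Fin.↑ˡ n , trans (cong at (Fin.splitAt-↑ˡ m i n)) eq
        ; (inj₂ q) → let (j , eq) = proj₁ E₂.image q in
            m Fin.↑ʳ j , trans (cong at (Fin.splitAt-↑ʳ m n j)) eq })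
    , λ { (i , refl) → at-∈ (Fin.splitAt m i) })
    where
    module E₁ = Enum E₁
    module E₂ = Enum E₂
    at : Fin m ⊎ Fin n → X
    at = [ E₁.at , E₂.at ]′
    at-∈ : ∀ s → P (at s) ⊎ Q (at s)
    at-∈ (inj₁ i) = inj₁ (E₁.at-∈ i)
    at-∈ (inj₂ j) = inj₂ (E₂.at-∈ j)
    at-injective : ∀ s t → at s ≡ at t → s ≡ t
    at-injective (inj₁ i) (inj₁ j) eq = cong inj₁ (E₁.injective eq)
    at-injective (inj₁ i) (inj₂ j) eq = contradiction (subst Q (sym eq) (E₂.at-∈ j)) (dis (E₁.at-∈ i))
    at-injective (inj₂ i) (inj₁ j) eq = contradiction (subst Q eq (E₂.at-∈ i)) (dis (E₁.at-∈ j))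
    at-injective (inj₂ i) (inj₂ j) eq = cong inj₂ (E₂.injective eq)

  enum-⋃ : ∀ {m} (n : Fin m → ℕ) {P : Fin m → Pred X 0ℓ} →
    (∀ {i j x} → P i x → P j x → i ≡ j) → (∀ i → Enum (n i) (P i)) →
    Enum (sum n) (λ x → ∃ λ i → P i x)
  enum-⋃ {zero}  n dis E = enum-empty (λ _ ())
  enum-⋃ {suc m} n dis E = enum-≐
    ([ (λ p → zero , p) , (λ (i , p) → suc i , p) ]′
    , λ { (zero , p) → inj₁ p ; (suc i , p) → inj₂ (i , p) })
    (enum-∪ (λ { p (i , q) → case dis p q of λ () })
      (E zero) (enum-⋃ (n ∘ suc) (λ p q → Fin.suc-injective (dis p q)) (E ∘ suc)))

  enum-⊆ : ExcludedMiddle 0ℓ → ∀ n {P Q : Pred X 0ℓ} → Q ⊆ P → Enum n P → ∃ λ m → Enum m Q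
  enum-⊆ em zero    Q⊆P (enum _ _ (f , _)) =
    0 , enum-empty (λ x q → case f (Q⊆P q) of λ ())
  enum-⊆ em (suc n) {P} {Q} Q⊆P (enum e inj (f , _))
    with enum-⊆ em n {λ x → ∃ λ i → e (suc i) ≡ x} {λ x → Q x × ∃ λ i → e (suc i) ≡ x} proj₂
           (enum (e ∘ suc) (Fin.suc-injective ∘ inj) (id , id))
       | em {Q (e zero)}
  ... | m , E | yes q = suc m , enum-≐
          ([ (λ { refl → q }) , proj₁ ]′
          , λ q → case f (Q⊆P q) of λ
              { (zero , eq) → inj₁ (sym eq) ; (suc i , eq) → inj₂ (q , i , eq) })
          (enum-∪ (λ { refl (_ , i , eq) → case inj eq of λ () }) (enum-point (e zero)) E)
  ... | m , E | no ¬q = m , enum-≐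
          (proj₁
          , λ q → case f (Q⊆P q) of λ
              { (zero , eq) → contradiction (subst Q (sym eq) q) ¬q ; (suc i , eq) → q , i , eq })
          E

  enum-finite : ∀ {n} {P : Pred X 0ℓ} → Enum n P → Finite P
  enum-finite (enum e _ (f , _)) = List.tabulate e , λ x p →
    let (i , eq) = f p in subst (_∈ᴸ List.tabulate e) eq (∈ᴸ.∈-tabulate⁺ i)

  enum-≤ : ∀ {m n} {P : Pred X 0ℓ} {Y : Pred X 0ℓ} → Enum m P → P ⊆ Y → (∃ Y ↣ Fin n) → m ≤ n
  enum-≤ E P⊆Y inj = Fin.injective⇒≤ {f = λ i → Injection.to inj (at i , P⊆Y (at-∈ i))}
    (λ eq → injective (cong proj₁ (Injection.injective inj eq)))
    where open Enum E

enum-image : ∀ {X Y : Set} {n} {P : Pred X 0ℓ} (φ : X → Y) →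
  Injective _≡_ _≡_ φ → Enum n P → Enum n (λ y → ∃ λ x → P x × φ x ≡ y)
enum-image φ φ-inj (enum e inj (f , g)) = enum (φ ∘ e) (inj ∘ φ-inj)
  ((λ { (x , p , refl) → let (i , eq) = f p in i , cong φ eq })
  , λ { (i , refl) → e i , g (i , refl) , refl })

enum-words : ∀ k m → ∃ λ n → Enum n (λ (w : List (Fin k)) → length w ≤ m)
enum-words k zero    = 1 , enum-≐ ((λ { refl → z≤n }) , λ { {[]} _ → refl }) (enum-point [])
enum-words k (suc m) = let (n , E) = enum-words k m in 1 + sum {k} (λ _ → n) , enum-≐
  ((λ { (inj₁ refl) → z≤n ; (inj₂ (a , w , l , refl)) → s≤s l })
  , λ { {[]} _ → inj₁ refl ; {a ∷ w} (s≤s l) → inj₂ (a , w , l , refl) })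
  (enum-∪ (λ { refl (_ , _ , _ , ()) }) (enum-point [])
    (enum-⋃ (λ _ → n) (λ { (_ , _ , refl) (_ , _ , refl) → refl })
      (λ a → enum-image (a ∷_) List.∷-injectiveʳ E)))

-- Convolutions of two words

Pair : Set → Set
Pair A = Vec (Maybe A) 2

conv : ∀ {A : Set} → List A → List A → List (Pair A)
conv []      []      = []
conv []      (b ∷ v) = (nothing ∷ just b ∷ []) ∷ conv [] v
conv (a ∷ u) []      = (just a ∷ nothing ∷ []) ∷ conv u []
conv (a ∷ u) (b ∷ v) = (just a ∷ just b ∷ []) ∷ conv u v

applyUpTo-cong : ∀ {A : Set} {f g : ℕ → A} → f ≗ g → ∀ n → List.applyUpTo f n ≡ List.applyUpTo g n
applyUpTo-cong eq zero    = refl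
applyUpTo-cong eq (suc n) = cong₂ _∷_ (eq 0) (applyUpTo-cong (eq ∘ suc) n)

letter-[] : ∀ {A : Set} j → letter {A} j [] ≡ nothing
letter-[] zero    = refl
letter-[] (suc j) = refl

convolution-conv : ∀ {A : Set} (u v : List A) → convolution (u ∷ v ∷ []) ≡ conv u v
convolution-conv []      []      = refl
convolution-conv []      (b ∷ v) = cong (_ ∷_) (trans
  (applyUpTo-cong (λ j → cong (λ l → l ∷ letter j v ∷ []) (sym (letter-[] j))) (length v))
  (trans (cong (List.applyUpTo _) (sym (ℕ.⊔-identityʳ (length v)))) (convolution-conv [] v)))
convolution-conv (a ∷ u) []      = cong (_ ∷_) (trans
  (applyUpTo-cong (λ j → cong (λ l → letter j u ∷ l ∷ []) (sym (letter-[] j))) (length u))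
  (trans (cong (List.applyUpTo _) (sym (ℕ.⊔-identityʳ (length u)))) (convolution-conv u [])))
convolution-conv (a ∷ u) (b ∷ v) = cong (_ ∷_) (trans
  (cong (λ n → List.applyUpTo (λ j → letter j u ∷ letter j v ∷ []) (length u ⊔ n))
    (sym (ℕ.⊔-identityʳ (length v))))
  (convolution-conv u v))

conv-injective : ∀ {A : Set} (u v u′ v′ : List A) → conv u v ≡ conv u′ v′ → u ≡ u′ × v ≡ v′
conv-injective []      []      []       []       _  = refl , refl
conv-injective []      (b ∷ v) []       (c ∷ v′) eq
  with List.∷-injective eq
... | refl , eq′ = Product.map₂ (cong (b ∷_)) (conv-injective [] v [] v′ eq′)
conv-injective (a ∷ u) []      (c ∷ u′) []       eq
  with List.∷-injective eq
... | refl , eq′ = Product.map₁ (cong (a ∷_)) (conv-injective u [] u′ [] eq′)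
conv-injective (a ∷ u) (b ∷ v) (c ∷ u′) (d ∷ v′) eq
  with List.∷-injective eq
... | refl , eq′ = Product.map (cong (a ∷_)) (cong (b ∷_)) (conv-injective u v u′ v′ eq′)
conv-injective []      []      []       (_ ∷ _)  ()
conv-injective []      []      (_ ∷ _)  []       ()
conv-injective []      []      (_ ∷ _)  (_ ∷ _)  ()
conv-injective []      (_ ∷ _) []       []       ()
conv-injective []      (_ ∷ _) (_ ∷ _)  []       ()
conv-injective []      (_ ∷ _) (_ ∷ _)  (_ ∷ _)  ()
conv-injective (_ ∷ _) []      []       []       ()
conv-injective (_ ∷ _) []      []       (_ ∷ _)  ()
conv-injective (_ ∷ _) []      (_ ∷ _)  (_ ∷ _)  ()
conv-injective (_ ∷ _) (_ ∷ _) []       []       ()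
conv-injective (_ ∷ _) (_ ∷ _) []       (_ ∷ _)  ()
conv-injective (_ ∷ _) (_ ∷ _) (_ ∷ _)  []       ()

-- Counting the words related to a given word

-- This order is not well-founded, but only minima of finite sets are taken.
_<ˡ_ : ∀ {k} → Rel (List (Fin k)) 0ℓ
_<ˡ_ = Lex.Lex-< _≡_ Fin._<_

module Counting (em : ExcludedMiddle 0ℓ) {k} (B : DFA (Pair (Fin k))) where

  open DFA B

  Word : Set
  Word = List (Fin k)

  run : Fin states → List (Pair (Fin k)) → Fin states
  run = List.foldl δ

  State : Set
  State = Fin 3 × Fin states

  pattern less     = zero
  pattern free     = suc zero
  pattern finished = suc (suc zero)

  -- The constraint on the unread part of y: in `less` the words have agreed so far and the order is
  -- still open, in `free` the order is settled or irrelevant, in `finished` y has ended.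
  Mode : Fin 3 → Word → Pred Word 0ℓ
  Mode less     x y = y <ˡ x
  Mode free     x y = ⊤
  Mode finished x y = y ≡ []

  Related : State → Word → Pred Word 0ℓ
  Related (κ , q) x y = Mode κ x y × run q (conv x y) ∈ˢ final

  -- The label zero stands for □, suc b for the letter b.
  extend : Fin (suc k) → Word → Word
  extend zero    y = y
  extend (suc b) y = b ∷ y

  -- The first difference settles the order: a smaller letter of y frees the rest, a larger one ends
  -- the run.
  compare : ∀ {q : Fin states} {a b : Fin k} → Maybe State
  compare {q} {a} {b} with Fin.<-cmp b a
  ... | tri< _ _ _ = just (free , q)
  ... | tri≈ _ _ _ = just (less , q)
  ... | tri> _ _ _ = nothing

  step : State → Fin k → Fin (suc k) → Maybe State
  step (κ        , q) a zero    = just (finished , δ q (just a ∷ nothing ∷ []))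
  step (less     , q) a (suc b) = compare {δ q (just a ∷ just b ∷ [])} {a} {b}
  step (free     , q) a (suc b) = just (free , δ q (just a ∷ just b ∷ []))
  step (finished , q) a (suc b) = nothing

  related-step : ∀ i a x y → Related i (a ∷ x) y →
    ∃₂ λ σ j → step i a σ ≡ just j × ∃ λ y′ → Related j x y′ × extend σ y′ ≡ y
  related-step (less , q) a x [] (halt , f) = zero , _ , refl , [] , (refl , f) , refl
  related-step (less , q) a x (b ∷ y) (this b<a , f) =
    suc b , (free , δ q _) , eq , y , (tt , f) , refl
    where
    eq : compare {δ q (just a ∷ just b ∷ [])} {a} {b} ≡ just (free , _)
    eq with Fin.<-cmp b a
    ... | tri< _ _ _    = refl
    ... | tri≈ b≮a _ _  = contradiction b<a b≮a
    ... | tri> b≮a _ _  = contradiction b<a b≮a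
  related-step (less , q) a x (b ∷ y) (next b≡a y<x , f) =
    suc b , (less , δ q _) , eq , y , (y<x , f) , refl
    where
    eq : compare {δ q (just a ∷ just b ∷ [])} {a} {b} ≡ just (less , _)
    eq with Fin.<-cmp b a
    ... | tri< _ b≢a _  = contradiction b≡a b≢a
    ... | tri≈ _ _ _    = refl
    ... | tri> _ b≢a _  = contradiction b≡a b≢a
  related-step (free , q) a x [] (_ , f) = zero , _ , refl , [] , (refl , f) , refl
  related-step (free , q) a x (b ∷ y) (_ , f) = suc b , _ , refl , y , (tt , f) , refl
  related-step (finished , q) a x .[] (refl , f) = zero , _ , refl , [] , (refl , f) , refl

  step-related : ∀ i a x σ {j} → step i a σ ≡ just j → ∀ y → Related j x y →
    Related i (a ∷ x) (extend σ y)
  step-related (less     , q) a x zero refl y (refl , f) = halt , f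
  step-related (free     , q) a x zero refl y (refl , f) = tt , f
  step-related (finished , q) a x zero refl y (refl , f) = refl , f
  step-related (less , q) a x (suc b) eq y h with Fin.<-cmp b a
  step-related (less , q) a x (suc b) refl y (_   , f) | tri< b<a _ _ = this b<a , f
  step-related (less , q) a x (suc b) refl y (y<x , f) | tri≈ _ b≡a _ = next b≡a y<x , f
  step-related (free , q) a x (suc b) refl y (_ , f) = tt , f

  step-zero : ∀ i a {j x y} → step i a zero ≡ just j → Related j x y → y ≡ []
  step-zero (less     , q) a refl (p , _) = p
  step-zero (free     , q) a refl (p , _) = p
  step-zero (finished , q) a refl (p , _) = p

  -- The label can be read off from y, so every y is guessed by one run only, and counting runs
  -- amounts to counting words.
  extend-injective : ∀ i a {σ σ′ j j′ x y y′} → step i a σ ≡ just j → step i a σ′ ≡ just j′ →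
    Related j x y → Related j′ x y′ → extend σ y ≡ extend σ′ y′ → σ ≡ σ′
  extend-injective i a {zero}  {zero}  _ _  _ _  _    = refl
  extend-injective i a {suc _} {suc _} _ _  _ _  refl = refl
  extend-injective i a {zero}  {suc _} s _  h _  eq   with trans (sym (step-zero i a s h)) eq
  ... | ()
  extend-injective i a {suc _} {zero}  _ s′ _ h′ eq   with trans eq (step-zero i a s′ h′)
  ... | ()

  -- Words y that exceed x by more than some constant length can be pumped.

  Long Short : ℕ → State → Word → Pred Word 0ℓ
  Long  C i x y = Related i x y × length x + C < length y
  Short C i x y = Related i x y × length y ≤ length x + C

  -- The short member is demanded for the sake of `c∞≤c`, which lets both columns share one trimmed
  -- matrix.
  Separates : State → ℕ → Set
  Separates i C = ∃ (Long C i []) → Infinite (Related i []) × ∃ (Short C i [])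

  list-bound : (ws : List Word) → ∃ λ n → ∀ w → w ∈ᴸ ws → length w ≤ n
  list-bound []       = 0 , λ _ ()
  list-bound (v ∷ ws) = let (n , h) = list-bound ws in length v ⊔ n , λ
    { w (here refl) → ℕ.m≤m⊔n (length v) n
    ; w (there w∈)  → ℕ.≤-trans (h w w∈) (ℕ.m≤n⊔m (length v) n) }

  separates-≤ : ∀ {i C C′} → C ≤ C′ → Separates i C → Separates i C′
  separates-≤ C≤C′ sep (y , h , l) =
    let (inf , z , h′ , l′) = sep (y , h , ℕ.≤-<-trans C≤C′ l)
    in inf , z , h′ , ℕ.≤-trans l′ C≤C′

  -- If the set is finite, C is a bound on the lengths and there is no long member; if it is
  -- infinite, C is the length of some member, which then is short.
  separating : ∀ i → ∃ (Separates i)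
  separating i with em {Finite (Related i [])}
  ... | yes (ws , all) = let (n , h) = list-bound ws in
          n , λ (y , r , l) → contradiction (h y (all y r)) (ℕ.<⇒≱ l)
  ... | no inf with em {∃ (Related i [])}
  ...   | yes (y , r) = length y , λ _ → inf , y , r , ℕ.≤-refl
  ...   | no ¬r       = 0 , λ (y , r , _) → contradiction (y , r) ¬r

  index : Fin (3 * states) → State
  index = Fin.remQuot {3} states

  code : State → Fin (3 * states)
  code (κ , q) = Fin.combine κ q

  index-code : ∀ i → index (code i) ≡ i
  index-code (κ , q) = Fin.remQuot-combine κ q

  constant : ∃ λ C → ∀ i → Separates (index i) C
  constant = common _⊔_ (separates-≤ (ℕ.m≤m⊔n _ _)) (separates-≤ (ℕ.m≤n⊔m _ _))
    (λ i → separating (index i))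

  C : ℕ
  C = proj₁ constant

  separates : ∀ i → Separates i C
  separates i = subst (λ i → Separates i C) (index-code i) (proj₂ constant (code i))

  -- A word longer than x has a genuine first letter, so x can be stripped off letter by letter
  -- until the state alone decides. A finite list of the related words would yield one for the words
  -- that remain after each step.
  long-infinite : ∀ x i → ∃ (Long C i x) → Infinite (Related i x)
  long-infinite []      i h = proj₁ (separates i h)
  long-infinite (a ∷ x) i (y , h , l) (ws , all) with related-step i a x y h
  ... | zero , j , s , y′ , h′ , refl with step-zero i a s h′
  ...   | refl = contradiction l λ ()
  long-infinite (a ∷ x) i (y , h , s≤s l) (ws , all) | suc b , j , s , y′ , h′ , refl =
    long-infinite x j (y′ , h′ , l)
      (map (List.drop 1) ws , λ z r →
        ∈ᴸ.∈-map⁺ (List.drop 1) (all (b ∷ z) (step-related i a x (suc b) s z r)))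

  -- Entries can exceed 1, since several guessed letters may lead to the same state.
  M : Fin k → Fin (3 * states) → Fin (3 * states) → ℕ
  M a i j = sum (λ σ → maybe′ (λ l → if does (code l Fin.≟ j) then 1 else 0) 0 (step (index i) a σ))

  M-act : ∀ a i (c : Fin (3 * states) → ℕ) →
    sum (λ j → M a i j * c j) ≡ sum (λ σ → maybe′ (c ∘ code) 0 (step (index i) a σ))
  M-act a i c = begin
    sum (λ j → M a i j * c j)
      ≡⟨ sum-cong-≗ (λ j → *-distribʳ-sum (c j) (λ σ → δ′ j (step (index i) a σ))) ⟩
    sum (λ j → sum (λ σ → δ′ j (step (index i) a σ) * c j))
      ≡⟨ ∑-comm (λ j σ → δ′ j (step (index i) a σ) * c j) ⟩
    sum (λ σ → sum (λ j → δ′ j (step (index i) a σ) * c j))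
      ≡⟨ sum-cong-≗ (λ σ → pick (step (index i) a σ)) ⟩
    sum (λ σ → maybe′ (c ∘ code) 0 (step (index i) a σ))  ∎
    where
    open ≡-Reasoning
    δ′ : Fin (3 * states) → Maybe State → ℕ
    δ′ j = maybe′ (λ l → if does (code l Fin.≟ j) then 1 else 0) 0
    pick : ∀ m → sum (λ j → δ′ j m * c j) ≡ maybe′ (c ∘ code) 0 m
    pick (just l) = sym (unit-sum (code l) c)
    pick nothing  = sum-zero {3 * states} (λ _ → 0) (λ _ → refl)

  open Matrices M

  short-base : ∀ i → ∃ λ n → Enum n (Short C i [])
  short-base i = let (n , E) = enum-words k C in enum-⊆ em n proj₂ E

  -- The columns account for the part of y beyond the end of x. The words counted by `c` have
  -- bounded length, whereas `c∞` is a mere indicator, because long words come with infinitely many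
  -- related ones.
  c c∞ : Fin (3 * states) → ℕ
  c i  = proj₁ (short-base (index i))
  c∞ i = if does (em {∃ (Long C (index i) [])}) then 1 else 0

  c∞≤c : ∀ i → c∞ i ≤ c i
  c∞≤c i with em {∃ (Long C (index i) [])}
  ... | no _  = z≤n
  ... | yes h with proj₂ (separates (index i) h) | short-base (index i)
  ...   | z , r , l | zero  , enum _ _ (f , _) = case f (r , l) of λ ()
  ...   | _         | suc n , _                = s≤s z≤n

  -- A letter as label shortens x and y by one each, which preserves the bound |x| + C. The label □
  -- forces the rest of y to be empty, where the bound is trivial.
  enum-short : ∀ x i → Enum (act x c i) (Short C (index i) x)
  enum-short []      i = proj₂ (short-base (index i))
  enum-short (a ∷ x) i = subst (λ n → Enum n (Short C (index i) (a ∷ x)))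
    (sym (M-act a i (act x c)))
    (enum-≐
      ((λ { {y} (σ , j , s , y′ , (h , l) , refl) →
            step-related (index i) a x σ s y′ h , longer σ s h l })
      , λ { {y} (h , l) → let (σ , j , s , y′ , h′ , eq) = related-step (index i) a x y h in
            σ , j , s , y′
            , (h′ , shorter σ s h′ (subst (λ y → length y ≤ suc (length x + C)) (sym eq) l)) , eq })
      (enum-⋃ _
        (λ (_ , s , _ , h , eq) (_ , s′ , _ , h′ , eq′) →
          extend-injective (index i) a s s′ (proj₁ h) (proj₁ h′) (trans eq (sym eq′)))
        (λ σ → enum-label σ)))
    where
    longer : ∀ σ {j y} → step (index i) a σ ≡ just j → Related j x y →
      length y ≤ length x + C → length (extend σ y) ≤ suc (length x + C)
    longer zero    _ _ l = ℕ.m≤n⇒m≤1+n l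
    longer (suc b) _ _ l = s≤s l
    shorter : ∀ σ {j y} → step (index i) a σ ≡ just j → Related j x y →
      length (extend σ y) ≤ suc (length x + C) → length y ≤ length x + C
    shorter zero    s h l with step-zero (index i) a s h
    ... | refl = z≤n
    shorter (suc b) _ _ (s≤s l) = l
    Labelled : Fin (suc k) → Pred Word 0ℓ
    Labelled σ y = ∃ λ j → step (index i) a σ ≡ just j × ∃ λ y′ → Short C j x y′ × extend σ y′ ≡ y
    extend-inj : ∀ σ → Injective _≡_ _≡_ (extend σ)
    extend-inj zero    = id
    extend-inj (suc b) = List.∷-injectiveʳ
    enum-label : ∀ σ → Enum (maybe′ (act x c ∘ code) 0 (step (index i) a σ)) (Labelled σ)
    enum-label σ with step (index i) a σ
    ... | nothing = enum-empty (λ { _ (_ , () , _) })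
    ... | just j  = enum-≐
      ((λ (y′ , h , eq) → j , refl , y′ , subst (λ j → Short C j x y′) (index-code j) h , eq)
      , λ { (.j , refl , y′ , h , eq) → y′ , subst (λ j → Short C j x y′) (sym (index-code j)) h , eq })
      (enum-image (extend σ) (extend-inj σ) (enum-short x (code j)))

  positive-long : ∀ x i → 0 < act x c∞ i → ∃ (Long C (index i) x)
  positive-long []      i p with em {∃ (Long C (index i) [])}
  ... | yes h = h
  ... | no _  = contradiction p λ ()
  positive-long (a ∷ x) i p
    with sum-positive (λ σ → maybe′ (act x c∞ ∘ code) 0 (step (index i) a σ))
           (subst (0 <_) (M-act a i (act x c∞)) p)
  ... | σ , q with step (index i) a σ in eq
  ...   | nothing = contradiction q λ ()
  ...   | just j with positive-long x (code j) q
  positive-long (a ∷ x) i p | zero , q | just j | y , h , l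
    with step-zero (index i) a eq (subst (λ j → Related j x y) (index-code j) h)
  ... | refl = contradiction l λ ()
  positive-long (a ∷ x) i p | suc b , q | just j | y , h , l =
    b ∷ y , step-related (index i) a x (suc b) eq y (subst (λ j → Related j x y) (index-code j) h)
    , s≤s l

  long-positive : ∀ x i → ∃ (Long C (index i) x) → 0 < act x c∞ i
  long-positive []      i h with em {∃ (Long C (index i) [])}
  ... | yes _ = s≤s z≤n
  ... | no ¬h = contradiction h ¬h
  long-positive (a ∷ x) i (y , h , l) with related-step (index i) a x y h
  ... | zero , j , s , y′ , h′ , refl with step-zero (index i) a s h′
  ...   | refl = contradiction l λ ()
  long-positive (a ∷ x) i (y , h , s≤s l) | suc b , j , s , y′ , h′ , refl =
    subst (0 <_) (sym (M-act a i (act x c∞)))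
      (ℕ.<-≤-trans
        (subst (λ m → 0 < maybe′ (act x c∞ ∘ code) 0 m) (sym s)
          (long-positive x (code j)
            (y′ , subst (λ j → Related j x y′) (sym (index-code j)) h′ , l)))
        (term≤sum (λ σ → maybe′ (act x c∞ ∘ code) 0 (step (index i) a σ)) (suc b)))

-- Isomorphisms of equivalence structures

≅-sym : ∀ {A B} → A ≅ B → B ≅ A
≅-sym {A} {B} (f , h) = mk↔ₛ′ from to strictlyInverseʳ strictlyInverseˡ , λ x y → mk⇔
  (λ p → Equivalence.from (h (from x) (from y))
    (subst₂ (Setoid._≈_ B) (sym (strictlyInverseˡ x)) (sym (strictlyInverseˡ y)) p))
  (λ p → subst₂ (Setoid._≈_ B) (strictlyInverseˡ x) (strictlyInverseˡ y)
    (Equivalence.to (h (from x) (from y)) p))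
  where open Inverse f

≅-trans : ∀ {A B C} → A ≅ B → B ≅ C → A ≅ C
≅-trans (f , h) (g , k) = mk↔ₛ′ (G.to ∘ F.to) (F.from ∘ G.from)
    (λ z → trans (cong G.to (F.strictlyInverseˡ _)) (G.strictlyInverseˡ z))
    (λ x → trans (cong F.from (G.strictlyInverseʳ _)) (F.strictlyInverseʳ x))
  , λ x y → mk⇔ (Equivalence.to (k _ _) ∘ Equivalence.to (h x y))
                (Equivalence.from (h x y) ∘ Equivalence.from (k _ _))
  where
  module F = Inverse f
  module G = Inverse g

≅-refl : ∀ {A} → A ≅ A
≅-refl = mk↔ₛ′ id id (λ _ → refl) (λ _ → refl) , λ _ _ → mk⇔ id id

-- From presentations to decompositions

word-code : ∀ {k} → List (Fin k) → ℕ
word-code     []      = 0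
word-code {k} (a ∷ w) = suc (toℕ a + word-code w * k)

word-code-injective : ∀ {k} → Injective _≡_ _≡_ (word-code {k})
word-code-injective {k} {[]}    {[]}    eq = refl
word-code-injective {k} {a ∷ u} {b ∷ v} eq =
  let (eq₁ , eq₂) = digit-injective a b {word-code u} {word-code v} (ℕ.suc-injective eq)
  in cong₂ _∷_ eq₁ (word-code-injective {k} eq₂)

enum-minimum : ExcludedMiddle 0ℓ → ∀ {k} n {P : Pred (List (Fin k)) 0ℓ} → Enum (suc n) P →
  ∃ λ x → P x × (∀ y → P y → ¬ y <ˡ x)
enum-minimum em {k} n {P} (enum e _ (f , g)) =
  let (i , h) = minimum n e in e i , g (i , refl) , λ y p → let (j , eq) = f p in
    subst (λ y → ¬ y <ˡ e i) eq (h j)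
  where
  <ˡ-trans : ∀ {x y z : List (Fin k)} → x <ˡ y → y <ˡ z → x <ˡ z
  <ˡ-trans = Lex.<-transitive isEquivalence ((λ { refl → id }) , (λ { refl → id })) Fin.<-trans
  <ˡ-irrefl : ∀ {x : List (Fin k)} → ¬ x <ˡ x
  <ˡ-irrefl = Lex.<-irreflexive Fin.<-irrefl (Pointwise.refl refl)
  minimum : ∀ n (e : Fin (suc n) → List (Fin k)) → ∃ λ i → ∀ j → ¬ e j <ˡ e i
  minimum zero    e = zero , λ { zero → <ˡ-irrefl }
  minimum (suc n) e with minimum n (e ∘ suc)
  ... | i , h with em {e zero <ˡ e (suc i)}
  ...   | yes lt = zero , λ { zero → <ˡ-irrefl ; (suc j) lt′ → h j (<ˡ-trans lt′ lt) }
  ...   | no ¬lt = suc i , λ { zero → ¬lt ; (suc j) → h j }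

module Presented (em : ExcludedMiddle 0ℓ) {A : EquivalenceStructure}
  (P : AutomaticPresentation A) (growth : PolynomialGrowth (AutomaticPresentation.Universe P)) where

  open AutomaticPresentation P
  open Counting em (proj₁ ∼-regular)
  open Matrices M using (act)
  module S = Setoid structure

  -- A record rather than a synonym for acceptance keeps the two words visible to unification.
  record _≈ʷ_ (x y : Word) : Set where
    constructor related
    field accepted : Accepts (proj₁ ∼-regular) (conv x y)

  open _≈ʷ_

  ≈ʷ-sound : ∀ {x y} → x ≈ʷ y → ∃₂ λ u v → u ∼ v × proj₁ u ≡ x × proj₁ v ≡ y
  ≈ʷ-sound {x} {y} (related h) with proj₂ (proj₂ ∼-regular) h
  ... | _ , (u , v , u∼v , refl) , eq =
    let (eq₁ , eq₂) = conv-injective x y _ _ (trans eq (convolution-conv (proj₁ u) (proj₁ v)))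
    in u , v , u∼v , sym eq₁ , sym eq₂

  ≈ʷ-complete : ∀ {u v} → u ∼ v → proj₁ u ≈ʷ proj₁ v
  ≈ʷ-complete {u} {v} u∼v = related (proj₁ (proj₂ ∼-regular)
    (_ , (u , v , u∼v , refl) , sym (convolution-conv (proj₁ u) (proj₁ v))))

  element-≡ : {u v : ∃ Universe} → proj₁ u ≡ proj₁ v → u ≡ v
  element-≡ {w , p} {_ , q} refl = cong (w ,_) (Accepts-irrelevant universe {w} p q)

  ≈ʷ-refl : ∀ {x} → Universe x → x ≈ʷ x
  ≈ʷ-refl {x} p = ≈ʷ-complete {x , p} {x , p} S.refl

  ≈ʷ-sym : ∀ {x y} → x ≈ʷ y → y ≈ʷ x
  ≈ʷ-sym h with ≈ʷ-sound h
  ... | u , v , u∼v , refl , refl = ≈ʷ-complete {v} {u} (S.sym u∼v)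

  ≈ʷ-trans : ∀ {x y z} → x ≈ʷ y → y ≈ʷ z → x ≈ʷ z
  ≈ʷ-trans h k with ≈ʷ-sound h | ≈ʷ-sound k
  ... | u , v , u∼v , refl , eq | v′ , w , v′∼w , eq′ , refl
    with element-≡ {v} {v′} (trans eq (sym eq′))
  ...   | refl = ≈ʷ-complete {u} {w} (S.trans u∼v v′∼w)

  ≈ʷ-universeˡ : ∀ {x y} → x ≈ʷ y → Universe x
  ≈ʷ-universeˡ h with ≈ʷ-sound h
  ... | (_ , p) , _ , _ , refl , _ = p

  ≈ʷ-universeʳ : ∀ {x y} → x ≈ʷ y → Universe y
  ≈ʷ-universeʳ = ≈ʷ-universeˡ ∘ ≈ʷ-sym

  initial : Fin 3 → Fin (3 * DFA.states (proj₁ ∼-regular))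
  initial κ = code (κ , DFA.start (proj₁ ∼-regular))

  index-initial : ∀ κ → index (initial κ) ≡ (κ , DFA.start (proj₁ ∼-regular))
  index-initial κ = index-code _

  InMode : Fin 3 → Word → Pred Word 0ℓ
  InMode κ x y = (Mode κ x y × Accepts (proj₁ ∼-regular) (conv x y)) × length y ≤ length x + C

  enum-mode : ∀ κ x → Enum (act x c (initial κ)) (InMode κ x)
  enum-mode κ x = subst (λ i → Enum (act x c (initial κ)) (Short C i x)) (index-initial κ)
    (enum-short x (initial κ))

  open Trim em M c using (Tame; M′; mat′-loop; act-trim)
  module M′ = Matrices M′

  -- The words counted lie in the universe and have length at most |x| + C, so the growth polynomial
  -- bounds their number. Along w u^n w′ this length is linear in n, and `poly<2^` supplies an n at
  -- which the bound is below 2 ^ n.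
  tame : ∀ κ → Tame (initial κ)
  tame κ w u w′ =
    let (p , inj) = growth
        l         = length w + length w′ + C
        (n , h)   = poly<2^ p (length u) l
        x         = w ++ u ^^ n ++ w′
    in n , ℕ.≤-<-trans
      (enum-≤ (enum-mode κ x) (λ {y} ((_ , h) , l) → ≈ʷ-universeʳ {x} {y} (related h) , l)
        (subst (λ m → (∃ λ y → Universe y × length y ≤ m) ↣ Fin (⟦ p ⟧ (n * length u + l ∷ [])))
          (sym (trans (cong (_+ C) (length-pumped n))
            (rearrange (length w) (n * length u) (length w′) C)))
          (inj (n * length u + l))))
      h
    where
    length-pumped : ∀ n → length (w ++ u ^^ n ++ w′) ≡ length w + (n * length u + length w′)
    length-pumped n = trans (List.length-++ w) (cong (length w +_)
      (trans (List.length-++ (u ^^ n)) (cong (_+ length w′) (length-^^ u n))))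
    rearrange : ∀ a b c d → a + (b + c) + d ≡ b + (a + c + d)
    rearrange = solve-∀

  -- The size of a finite class, the number of smaller elements of a finite class, and a
  -- number that is positive on the infinite classes only.
  abstract

    size smaller infinite : Word → ℕ
    size x     = act x c (initial free)
    smaller x  = act x c (initial less)
    infinite x = act x c∞ (initial free)

  statistics : Fin 3 → Word → ℕ
  statistics zero             = size
  statistics (suc zero)       = smaller
  statistics (suc (suc zero)) = infinite

  abstract

    -- All three statistics are combinations of entries of one trimmed family, with coefficients
    -- from `c` or `c∞`; hence the pieces found for the entries serve them simultaneously.
    good-universe : Good statistics Universe
    good-universe = good-map (λ e h → λ
        { zero             → derived e h c (λ _ → ℕ.≤-refl) free
        ; (suc zero)       → derived e h c (λ _ → ℕ.≤-refl) less
        ; (suc (suc zero)) → derived e h c∞ c∞≤c free })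
      (Decomposition.good-accepts em universe growth M′ mat′-loop)
      where
      derived : ∀ {n} (e : Vec ℕ n → Word) → (∀ ij → PosPoly (λ x → M′.mat (e x) (proj₁ ij) (proj₂ ij))) →
        ∀ v → (∀ i → v i ≤ c i) → ∀ κ → PosPoly (λ x → act (e x) v (initial κ))
      derived e h v v≤c κ = pos-cong
        (λ x → sym (trans (act-trim v≤c (e x) (tame κ)) (M′.act-mat (e x) v (initial κ))))
        (pos-sum _ (λ j → pos-* (h (initial κ , j)) (pos-const (v j))))

    infinite-class : ∀ x → 0 < infinite x → Infinite (x ≈ʷ_)
    infinite-class x p (ws , all) =
      long-infinite x (index (initial free)) (positive-long x (initial free) p)
        (ws , λ y → all y ∘ related ∘ proj₂ ∘ subst (λ i → Related i x y) (index-initial free))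

    class-bounded : ∀ {x y} → infinite x ≡ 0 → x ≈ʷ y → length y ≤ length x + C
    class-bounded {x} {y} none h = ℕ.≮⇒≥ λ l → contradiction
      (subst (0 <_) none (long-positive x (initial free)
        (y , subst (λ i → Related i x y) (sym (index-initial free)) (tt , accepted h) , l)))
      λ ()

    enum-class : ∀ x → infinite x ≡ 0 → Enum (size x) (x ≈ʷ_)
    enum-class x none = enum-≐
      (related ∘ proj₂ ∘ proj₁ , λ {y} h → (tt , accepted h) , class-bounded {x} {y} none h)
      (enum-mode free x)

    enum-smaller : ∀ x → Enum (smaller x) (InMode less x)
    enum-smaller = enum-mode less

  -- The value of `infinite` depends on the word. That its vanishing depends on the class only is
  -- seen by passing through finiteness of the class.
  infinite-resp : ∀ {x y} → x ≈ʷ y → infinite x ≡ 0 → infinite y ≡ 0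
  infinite-resp {x} {y} x≈y none = ℕ.n≤0⇒n≡0 (ℕ.≮⇒≥ λ p → infinite-class y p
    (let (ws , all) = enum-finite (enum-class x none) in ws , λ z h → all z (≈ʷ-trans x≈y h)))

  Representative : Pred Word 0ℓ
  Representative x = infinite x ≡ 0 × smaller x ≡ 0

  representative-minimal : ∀ {x y} → Representative x → x ≈ʷ y → ¬ y <ˡ x
  representative-minimal {x} {y} (none , least) x≈y y<x with
    subst (λ n → Enum n (InMode less x)) least (enum-smaller x)
  ... | enum _ _ (f , _) = case f ((y<x , accepted x≈y) , class-bounded {x} {y} none x≈y) of λ ()

  representative-unique : ∀ {x y} → Representative x → Representative y → x ≈ʷ y → x ≡ y
  representative-unique {x} {y} p q x≈y with Lex.<-compare sym Fin.<-cmp x y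
  ... | tri< x<y _ _ = contradiction x<y (representative-minimal {y} {x} q (≈ʷ-sym x≈y))
  ... | tri≈ _ eq _  = Pointwise.Pointwise-≡⇒≡ eq
  ... | tri> _ _ y<x = contradiction y<x (representative-minimal {x} {y} p x≈y)

  -- Partial decompositions: a disjoint union of admissible structures whose elements are
  -- identified with the words in S.
  record Cover (S : Pred Word 0ℓ) : Set₁ where
    field
      summands   : List EquivalenceStructure
      admissible : All (λ B → IsPolynomial𝔈 B ⊎ (Countable (Setoid.Carrier B) × EveryClassInfinite B))
                     summands
      word       : Setoid.Carrier (⨆ summands) → Word
      injective  : Injective _≡_ _≡_ word
      image      : S ≐ (λ x → ∃ λ z → word z ≡ x)
      preserves  : ∀ y z → Setoid._≈_ (⨆ summands) y z ⇔ word y ≈ʷ word z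

  cover-≐ : ∀ {S T} → S ≐ T → Cover S → Cover T
  cover-≐ (f , g) K = record { Cover K hiding (image)
                             ; image = proj₁ (Cover.image K) ∘ g , f ∘ proj₂ (Cover.image K) }

  cover-∅ : Cover (λ _ → ⊥)
  cover-∅ = record
    { summands   = []
    ; admissible = []
    ; word       = ⊥-elim
    ; injective  = λ { {()} }
    ; image      = ⊥-elim , λ ()
    ; preserves  = λ ()
    }

  cover-∷ : ∀ {S T} (B : EquivalenceStructure) →
    IsPolynomial𝔈 B ⊎ (Countable (Setoid.Carrier B) × EveryClassInfinite B) →
    (word : Setoid.Carrier B → Word) → Injective _≡_ _≡_ word →
    T ≐ (λ x → ∃ λ z → word z ≡ x) → (∀ y z → Setoid._≈_ B y z ⇔ word y ≈ʷ word z) →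
    (∀ {x y} → T x → S y → ¬ x ≈ʷ y) → Cover S → Cover (λ x → T x ⊎ S x)
  cover-∷ {S} {T} B adm word inj (f , g) pres apart K = record
    { summands   = B ∷ K.summands
    ; admissible = adm ∷ K.admissible
    ; word       = words
    ; injective  = λ {y} {z} → words-injective y z
    ; image      = [ (λ t → let (z , eq) = f t in inj₁ z , eq)
                   , (λ s → let (z , eq) = proj₁ K.image s in inj₂ z , eq) ]′
                 , λ { (inj₁ z , eq) → inj₁ (g (z , eq)) ; (inj₂ z , eq) → inj₂ (proj₂ K.image (z , eq)) }
    ; preserves  = words-preserves
    }
    where
    module K = Cover K
    words : Setoid.Carrier B ⊎ Setoid.Carrier (⨆ K.summands) → Word
    words = [ word , K.word ]′
    T-word : ∀ y → T (word y)
    T-word y = g (y , refl)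
    S-word : ∀ z → S (K.word z)
    S-word z = proj₂ K.image (z , refl)
    T-refl : ∀ y → word y ≈ʷ word y
    T-refl y = Equivalence.to (pres y y) (Setoid.refl B)
    words-injective : ∀ y z → words y ≡ words z → y ≡ z
    words-injective (inj₁ y) (inj₁ z) eq = cong inj₁ (inj eq)
    words-injective (inj₁ y) (inj₂ z) eq =
      contradiction (subst (word y ≈ʷ_) eq (T-refl y)) (apart (T-word y) (S-word z))
    words-injective (inj₂ y) (inj₁ z) eq =
      contradiction (subst (word z ≈ʷ_) (sym eq) (T-refl z)) (apart (T-word z) (S-word y))
    words-injective (inj₂ y) (inj₂ z) eq = cong inj₂ (K.injective eq)
    words-preserves : ∀ y z → Setoid._≈_ (B ⊎ₛ ⨆ K.summands) y z ⇔ words y ≈ʷ words z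
    words-preserves (inj₁ y) (inj₁ z) = mk⇔
      (λ { (Pointwise⊎.inj₁ p) → Equivalence.to (pres y z) p })
      (λ p → Pointwise⊎.inj₁ (Equivalence.from (pres y z) p))
    words-preserves (inj₁ y) (inj₂ z) = mk⇔ (λ ())
      (λ p → contradiction p (apart (T-word y) (S-word z)))
    words-preserves (inj₂ y) (inj₁ z) = mk⇔ (λ ())
      (λ p → contradiction (≈ʷ-sym p) (apart (T-word z) (S-word y)))
    words-preserves (inj₂ y) (inj₂ z) = mk⇔
      (λ { (Pointwise⊎.inj₂ p) → Equivalence.to (K.preserves y z) p })
      (λ p → Pointwise⊎.inj₂ (Equivalence.from (K.preserves y z) p))

  -- A class is assigned to the piece that holds its representative; its other members may lie in
  -- any piece.
  Classes : Pred Word 0ℓ → Pred Word 0ℓ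
  Classes P y = ∃ λ x → P x × Representative x × x ≈ʷ y

  classes-apart : ∀ {P Q : Pred Word 0ℓ} → (∀ {x} → P x → ¬ Q x) →
    ∀ {x y} → Classes P x → Classes Q y → ¬ x ≈ʷ y
  classes-apart {P} {Q} dis (u , p , ru , u≈x) (v , q , rv , v≈y) x≈y =
    dis p (subst Q (sym (representative-unique ru rv (≈ʷ-trans u≈x (≈ʷ-trans x≈y (≈ʷ-sym v≈y))))) q)

  -- If `smaller` or `infinite` is positive along the piece, it holds no representative and
  -- contributes nothing. Otherwise all its words are representatives, and the polynomial for `size`
  -- gives the sizes of their classes.
  cover-piece : ∀ {S P} n (e : Vec ℕ n → Word) → Injective _≡_ _≡_ e →
    P ≐ (λ x → ∃ λ v → e v ≡ x) → (∀ j → PosPoly (statistics j ∘ e)) →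
    (∀ {x y} → Classes P x → S y → ¬ x ≈ʷ y) → Cover S → Cover (λ x → Classes P x ⊎ S x)
  cover-piece {S} {P} n e e-inj (f , g) pos apart K
    with proj₂ (pos (suc zero)) | proj₂ (pos (suc (suc zero)))
  ... | inj₂ smaller>0 | _ = cover-≐
          (inj₂ , [ (λ (x , p , (_ , least) , _) → let (v , eq) = f p in
            contradiction (subst (0 <_) (trans (cong smaller eq) least) (smaller>0 v)) λ ()) , id ]′) K
  ... | inj₁ _ | inj₂ infinite>0 = cover-≐
          (inj₂ , [ (λ (x , p , (none , _) , _) → let (v , eq) = f p in
            contradiction (subst (0 <_) (trans (cong infinite eq) none) (infinite>0 v)) λ ()) , id ]′) K
  ... | inj₁ least | inj₁ none = cover-∷ (𝔈 ([_] ∘ ⟦ p ⟧)) (inj₁ (n , p , ≅-refl {𝔈 ([_] ∘ ⟦ p ⟧)}))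
          (λ (v , t) → at (classes v) t)
          (λ { {u , s} {v , t} eq → pair-≡
            (e-unique (subst (e u ≈ʷ_) eq (at-∈ (classes u) s)) (at-∈ (classes v) t)) eq })
          ( (λ (x , q , _ , x≈y) → let (v , eq) = f q
                                       (t , eq′) = proj₁ (image (classes v)) (subst (_≈ʷ _) (sym eq) x≈y)
                                   in (v , t) , eq′)
          , λ { ((v , t) , refl) → e v , g (v , refl) , representative v , at-∈ (classes v) t })
          (λ { (u , s) (v , t) → mk⇔
            (λ { refl → ≈ʷ-trans (≈ʷ-sym (at-∈ (classes u) s)) (at-∈ (classes v) t) })
            (λ h → e-unique (≈ʷ-trans (at-∈ (classes u) s) h) (at-∈ (classes v) t)) })
          apart K
    where
    open Enum
    p : Polynomial n
    p = proj₁ (proj₁ (pos zero))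
    representative : ∀ v → Representative (e v)
    representative v = none v , least v
    classes : ∀ v → Enum (⟦ p ⟧ v) (e v ≈ʷ_)
    classes v = subst (λ m → Enum m (e v ≈ʷ_)) (sym (proj₂ (proj₁ (pos zero)) v))
      (enum-class (e v) (none v))
    e-unique : ∀ {u v y} → e u ≈ʷ y → e v ≈ʷ y → u ≡ v
    e-unique {u} {v} h k =
      e-inj (representative-unique (representative u) (representative v) (≈ʷ-trans h (≈ʷ-sym k)))
    pair-≡ : ∀ {u v s t} → u ≡ v → at (classes u) s ≡ at (classes v) t → (u , s) ≡ (v , t)
    pair-≡ {u} refl eq = cong (u ,_) (injective (classes u) eq)

  cover-classes : ∀ {S P} → Good statistics P →
    (∀ {x y} → Classes P x → S y → ¬ x ≈ʷ y) → Cover S → Cover (λ x → Classes P x ⊎ S x)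
  cover-classes (piece n e inj P≐ pos) apart K = cover-piece n e inj P≐ pos apart K
  cover-classes (empty ¬P) apart K =
    cover-≐ (inj₂ , [ (λ (x , p , _) → contradiction p (¬P x)) , id ]′) K
  cover-classes (union (f , g) dis G₁ G₂) apart K = cover-≐
    ( [ (λ (x , p , h) → inj₁ (x , g (inj₂ p) , h))
      , [ (λ (x , p , h) → inj₁ (x , g (inj₁ p) , h)) , inj₂ ]′ ]′
    , [ (λ (x , p , h) → [ (λ q → inj₂ (inj₁ (x , q , h))) , (λ q → inj₁ (x , q , h)) ]′ (f p))
      , inj₂ ∘ inj₂ ]′ )
    (cover-classes G₂
      (λ (x , p , h) → [ (λ c x≈y → classes-apart dis c (x , p , h) (≈ʷ-sym x≈y))
                       , apart (x , g (inj₂ p) , h) ]′)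
      (cover-classes G₁ (λ (x , p , h) → apart (x , g (inj₁ p) , h)) K))

  -- All infinite classes together form a single summand.

  Unbounded : EquivalenceStructure
  Unbounded = On.setoid {B = Σ (∃ Universe) (λ u → 0 < infinite (proj₁ u))} structure proj₁

  InInfinite : Pred Word 0ℓ
  InInfinite x = Universe x × 0 < infinite x

  infinite-resp-> : ∀ {x y} → x ≈ʷ y → 0 < infinite x → 0 < infinite y
  infinite-resp-> {x} {y} x≈y p with infinite y in eq
  ... | suc _ = s≤s z≤n
  ... | zero  = contradiction (subst (0 <_) (infinite-resp (≈ʷ-sym x≈y) eq) p) λ ()

  unbounded-≡ : ∀ {u v : Setoid.Carrier Unbounded} → proj₁ (proj₁ u) ≡ proj₁ (proj₁ v) → u ≡ v
  unbounded-≡ {u , p} {v , q} eq with element-≡ {u} {v} eq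
  ... | refl = cong (u ,_) (ℕ.<-irrelevant p q)

  ∼⇔≈ʷ : ∀ u v → u ∼ v ⇔ proj₁ u ≈ʷ proj₁ v
  ∼⇔≈ʷ u v = mk⇔ (≈ʷ-complete {u} {v}) λ h → from (≈ʷ-sound h)
    where
    from : (∃₂ λ u′ v′ → u′ ∼ v′ × proj₁ u′ ≡ proj₁ u × proj₁ v′ ≡ proj₁ v) → u ∼ v
    from (u′ , v′ , h , eq , eq′) = subst₂ _∼_ (element-≡ {u′} {u} eq) (element-≡ {v′} {v} eq′) h

  cover-infinite : Cover (λ x → InInfinite x ⊎ ⊥)
  cover-infinite = cover-∷ Unbounded (inj₂ (countable , everyInfinite)) (proj₁ ∘ proj₁) unbounded-≡
    ((λ {x} (p , q) → ((x , p) , q) , refl) , λ { (((x , p) , q) , refl) → p , q })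
    (λ (u , _) (v , _) → ∼⇔≈ʷ u v) (λ _ ()) cover-∅
    where
    countable : Countable (Setoid.Carrier Unbounded)
    countable = mk↣ {to = word-code ∘ proj₁ ∘ proj₁}
      (λ eq → unbounded-≡ (word-code-injective eq))
    everyInfinite : EveryClassInfinite Unbounded
    everyInfinite (u , p) (us , all) = infinite-class (proj₁ u) p
      (map (proj₁ ∘ proj₁) us , λ y h → ∈ᴸ.∈-map⁺ (proj₁ ∘ proj₁)
        (all ((y , ≈ʷ-universeʳ h) , infinite-resp-> h p)
          (Equivalence.from (∼⇔≈ʷ u (y , ≈ʷ-universeʳ h)) h)))

  -- The class is finite and contains y, so it has a least word x. A positive `smaller x` would
  -- enumerate a word of the class below x.
  representative-exists : ∀ y → Universe y → infinite y ≡ 0 →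
    ∃ λ x → Universe x × Representative x × x ≈ʷ y
  representative-exists y p none with size y | enum-class y none
  ... | zero  | enum _ _ (f , _) = case f (≈ʷ-refl p) of λ ()
  ... | suc n | E =
    let (x , y≈x , least) = enum-minimum em n E
    in x , ≈ʷ-universeʳ y≈x
         , (infinite-resp y≈x none
           , ℕ.n≤0⇒n≡0 (ℕ.≮⇒≥ λ q →
               let module E′ = Enum (enum-smaller x)
                   ((lt , x≈z) , _) = E′.at-∈ (fromℕ< q)
               in least (E′.at (fromℕ< q)) (≈ʷ-trans y≈x (related x≈z)) lt))
         , ≈ʷ-sym y≈x

  cover-universe : Cover Universe
  cover-universe = cover-≐
    ( [ (λ (_ , _ , _ , h) → ≈ʷ-universeʳ h) , [ proj₁ , ⊥-elim ]′ ]′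
    , λ {y} p → classify y p (em {0 < infinite y}) )
    (cover-classes good-universe apart cover-infinite)
    where
    apart : ∀ {x y} → Classes Universe x → InInfinite y ⊎ ⊥ → ¬ x ≈ʷ y
    apart (z , _ , (none , _) , z≈x) (inj₁ (_ , p)) x≈y = contradiction
      (subst (0 <_) none (infinite-resp-> (≈ʷ-sym (≈ʷ-trans z≈x x≈y)) p)) λ ()
    classify : ∀ y → Universe y → Dec (0 < infinite y) → Classes Universe y ⊎ (InInfinite y ⊎ ⊥)
    classify y p (yes q) = inj₂ (inj₁ (p , q))
    classify y p (no ¬q) = inj₁ (representative-exists y p (ℕ.n≤0⇒n≡0 (ℕ.≮⇒≥ ¬q)))

  decomposition : Cover Universe → Σ[ Bs ∈ List EquivalenceStructure ]
    All (λ B → IsPolynomial𝔈 B ⊎ (Countable (Setoid.Carrier B) × EveryClassInfinite B)) Bs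
    × A ≅ ⨆ Bs
  decomposition K = summands , admissible , ≅-trans {A} {structure} {⨆ summands}
    (≅-sym {structure} {A} isomorphic)
    ( mk↔ₛ′ to (λ z → word z , proj₂ image (z , refl))
        (λ z → injective (word-to _)) (λ u → element-≡ (word-to u))
    , λ u v → mk⇔
        (λ h → Equivalence.from (preserves (to u) (to v))
          (subst₂ _≈ʷ_ (sym (word-to u)) (sym (word-to v)) (≈ʷ-complete {u} {v} h)))
        (λ h → Equivalence.from (∼⇔≈ʷ u v)
          (subst₂ _≈ʷ_ (word-to u) (word-to v) (Equivalence.to (preserves (to u) (to v)) h))) )
    where
    open Cover K
    to : ∃ Universe → Setoid.Carrier (⨆ summands)
    to (x , p) = proj₁ (proj₁ image p)
    word-to : ∀ u → word (to u) ≡ proj₁ u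
    word-to (x , p) = proj₂ (proj₁ image p)

-- Partial automata with finite state types

FinType : Set → Set
FinType X = ∃ λ n → Enum {X} n (λ _ → ⊤)

module FinType {X : Set} (F : FinType X) where

  open Enum (proj₂ F)

  size : ℕ
  size = proj₁ F

  decode : Fin size → X
  decode = at

  encode : X → Fin size
  encode x = proj₁ (proj₁ image {x} tt)

  decode-encode : ∀ x → decode (encode x) ≡ x
  decode-encode x = proj₂ (proj₁ image {x} tt)

  encode-decode : ∀ i → encode (decode i) ≡ i
  encode-decode i = injective (decode-encode (decode i))

finite-↔ : ∀ {X Y : Set} → X ↔ Y → FinType X → FinType Y
finite-↔ f (n , enum e inj (g , _)) = n , enum (to ∘ e)
  (λ eq → inj (trans (sym (strictlyInverseʳ _)) (trans (cong from eq) (strictlyInverseʳ _))))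
  ((λ {y} _ → let (i , eq) = g {from y} tt in i , trans (cong to eq) (strictlyInverseˡ y)) , _)
  where open Inverse f

finite-Fin : ∀ n → FinType (Fin n)
finite-Fin n = n , enum id id ((λ {i} _ → i , refl) , _)

finite-⊤ : FinType ⊤
finite-⊤ = finite-↔ Fin.1↔⊤ (finite-Fin 1)

finite-Bool : FinType Bool
finite-Bool = finite-↔ Fin.2↔Bool (finite-Fin 2)

-- Dependent sums are wanted for the letters that record transitions, whose labels depend on state
-- and input.
finite-Σ : ∀ {X : Set} {Y : X → Set} → FinType X → (∀ x → FinType (Y x)) → FinType (Σ X Y)
finite-Σ {X} {Y} F G = sum (λ i → size′ i) , enum-≐
  ( _ , λ { {x , y} _ → encode x , fibre x y })
  (enum-⋃ (λ i → size′ i)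
    (λ { {i} {j} (_ , _ , refl) (_ , _ , eq) →
      trans (sym (encode-decode i)) (trans (cong encode (sym (cong proj₁ eq))) (encode-decode j)) })
    (λ i → enum-image (λ y → decode i , y) (λ { refl → refl }) (proj₂ (G (decode i)))))
  where
  open FinType F
  size′ : Fin size → ℕ
  size′ i = proj₁ (G (decode i))
  Fibre : Fin size → Pred (Σ X Y) 0ℓ
  Fibre i z = ∃ λ y → ⊤ × (decode i , y) ≡ z
  fibre : ∀ x y → Fibre (encode x) (x , y)
  fibre x y with encode x | decode-encode x
  ... | i | refl = y , tt , refl

finite-⊎ : ∀ {X Y : Set} → FinType X → FinType Y → FinType (X ⊎ Y)
finite-⊎ (m , E) (n , E′) = m + n , enum-≐
  ( _ , λ { {inj₁ x} _ → inj₁ (x , tt , refl) ; {inj₂ y} _ → inj₂ (y , tt , refl) })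
  (enum-∪ (λ { (_ , _ , refl) (_ , _ , ()) })
    (enum-image inj₁ (λ { refl → refl }) E) (enum-image inj₂ (λ { refl → refl }) E′))

finite-× : ∀ {X Y : Set} → FinType X → FinType Y → FinType (X × Y)
finite-× F G = finite-Σ F (λ _ → G)



finite-Maybe : ∀ {X : Set} → FinType X → FinType (Maybe X)
finite-Maybe F = finite-↔
  (mk↔ₛ′ [ (λ _ → nothing) , just ]′ (maybe′ inj₂ (inj₁ tt))
    (λ { nothing → refl ; (just _) → refl }) (λ { (inj₁ _) → refl ; (inj₂ _) → refl }))
  (finite-⊎ finite-⊤ F)

-- Partial transitions spare every construction an explicit sink; `Totalise` adds it once.
record PDFA (A : Set) : Set₁ where
  field
    State  : Set
    states : FinType State
    start  : State
    step   : State → A → Maybe State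
    final  : State → Bool

  AcceptsFrom : Maybe State → Pred (List A) 0ℓ
  AcceptsFrom nothing  w       = ⊥
  AcceptsFrom (just q) []      = T (final q)
  AcceptsFrom (just q) (a ∷ w) = AcceptsFrom (step q a) w

  Accepted : Pred (List A) 0ℓ
  Accepted = AcceptsFrom (just start)

∈ˢ-tabulate : ∀ {n} (f : Fin n → Bool) i → (i ∈ˢ Vec.tabulate f) ⇔ T (f i)
∈ˢ-tabulate f i = mk⇔
  (λ h → Equivalence.from Bool.T-≡ (trans (sym (Vec.lookup∘tabulate f i)) (Vec.[]=⇒lookup h)))
  (λ h → Vec.lookup⇒[]= i _ (trans (Vec.lookup∘tabulate f i) (Equivalence.to Bool.T-≡ h)))

module Totalise {A : Set} (M : PDFA A) where

  open PDFA M
  open FinType (finite-Maybe states)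

  isFinal : Fin size → Bool
  isFinal i = maybe′ final false (decode i)

  advance : Maybe State → A → Maybe State
  advance nothing  a = nothing
  advance (just q) a = step q a

  dfa : DFA A
  dfa = record
    { states = size
    ; start  = encode (just start)
    ; δ      = λ i a → encode (advance (decode i) a)
    ; final  = Vec.tabulate isFinal
    }

  accepts-from⇔ : ∀ q w → List.foldl (DFA.δ dfa) (encode q) w ∈ˢ DFA.final dfa ⇔ AcceptsFrom q w
  accepts-from⇔ q [] = mk⇔
    (λ h → from-final q (subst (T ∘ maybe′ final false) (decode-encode q)
      (Equivalence.to (∈ˢ-tabulate isFinal (encode q)) h)))
    (λ h → Equivalence.from (∈ˢ-tabulate isFinal (encode q))
      (subst (T ∘ maybe′ final false) (sym (decode-encode q)) (to-final q h)))
    where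
    from-final : ∀ q → T (maybe′ final false q) → AcceptsFrom q []
    from-final (just q) h = h
    to-final : ∀ q → AcceptsFrom q [] → T (maybe′ final false q)
    to-final (just q) h = h
  accepts-from⇔ q (a ∷ w) = mk⇔
    (λ h → from-next q (Equivalence.to (accepts-from⇔ (advance q a) w) (subst state (decode-encode q) h)))
    (λ h → subst state (sym (decode-encode q))
      (Equivalence.from (accepts-from⇔ (advance q a) w) (to-next q h)))
    where
    state : Maybe State → Set
    state q = List.foldl (DFA.δ dfa) (encode (advance q a)) w ∈ˢ DFA.final dfa
    from-next : ∀ q → AcceptsFrom (advance q a) w → AcceptsFrom q (a ∷ w)
    from-next (just q) h = h
    to-next : ∀ q → AcceptsFrom q (a ∷ w) → AcceptsFrom (advance q a) w
    to-next (just q) h = h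

  accepts⇔ : ∀ w → Accepts dfa w ⇔ Accepted w
  accepts⇔ = accepts-from⇔ (just start)

-- Recognising pairs of words with equal labels

module Synchronised (em : ExcludedMiddle 0ℓ) {A Γ : Set} (M : PDFA A) (π : A → Maybe Γ) where

  open PDFA M

  label : Maybe A → Maybe Γ
  label = maybe′ π nothing

  Agree : Rel (List A) 0ℓ
  Agree u v = ∀ j → label (letter j u) ≡ label (letter j v)

  -- A track is in state nothing after its word has ended.
  Track : Set
  Track = Maybe State

  -- Padding begins where the word of the track ends, so it is possible only in a final state and is
  -- followed by padding only.
  move : Track → Maybe A → Maybe Track
  move (just q) (just a) = Maybe.map just (step q a)
  move (just q) nothing  = if final q then just nothing else nothing
  move nothing  (just a) = nothing
  move nothing  nothing  = just nothing

  -- A column of two paddings does not occur in a convolution. It is refused separately, since two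
  -- ended tracks would read it for ever.
  move₂ : Track × Track → Pair A → Maybe (Track × Track)
  move₂ (p , q) (nothing ∷ nothing ∷ []) = nothing
  move₂ (p , q) (x       ∷ y       ∷ []) =
    if does (em {label x ≡ label y}) then Maybe.zip (move p x) (move q y) else nothing

  ended : Track → Bool
  ended (just q) = final q
  ended nothing  = true

  pairs : PDFA (Pair A)
  pairs = record
    { State  = Track × Track
    ; states = finite-× (finite-Maybe states) (finite-Maybe states)
    ; start  = just start , just start
    ; step   = move₂
    ; final  = λ (p , q) → ended p ∧ ended q
    }

  module Pairs = PDFA pairs

  Tail : Track → Pred (List A) 0ℓ
  Tail (just q) u = AcceptsFrom (just q) u
  Tail nothing  u = u ≡ []

  cons : Maybe A → List A → List A
  cons (just a) u = a ∷ u
  cons nothing  u = u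

  -- The second conclusion makes `cons` compatible with `letter` and `conv`: a padding drops out of
  -- the word without displacing any later letter.
  move-tail : ∀ p x {p′ u} → move p x ≡ just p′ → Tail p′ u →
    Tail p (cons x u) × (x ≡ nothing → u ≡ [])
  move-tail (just q) (just a) eq t with step q a
  move-tail (just q) (just a) refl t | just q′ = t , λ ()
  move-tail (just q) nothing eq t with final q in f
  move-tail (just q) nothing refl refl | true = subst T (sym f) tt , λ _ → refl
  move-tail nothing nothing refl refl = refl , λ _ → refl

  tail-move : ∀ p a u → Tail p (a ∷ u) → ∃ λ p′ → move p (just a) ≡ just p′ × Tail p′ u
  tail-move (just q) a u t with step q a
  ... | just q′ = just q′ , refl , t

  tail-end : ∀ p → Tail p [] → move p nothing ≡ just nothing
  tail-end (just q) t with final q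
  ... | true = refl
  tail-end nothing  t = refl

  ended⇔ : ∀ p → T (ended p) ⇔ Tail p []
  ended⇔ (just q) = mk⇔ id id
  ended⇔ nothing  = mk⇔ (λ _ → refl) (λ _ → tt)

  zip-just : ∀ {X Y : Set} {s : Maybe X} {t : Maybe Y} {x y} → Maybe.zip s t ≡ just (x , y) →
    s ≡ just x × t ≡ just y
  zip-just {s = just _} {just _} refl = refl , refl

  Both : Maybe A → Maybe A → Set
  Both x y = ¬ (x ≡ nothing × y ≡ nothing)

  move₂⇒ : ∀ p q x y {p′ q′} → move₂ (p , q) (x ∷ y ∷ []) ≡ just (p′ , q′) →
    Both x y × label x ≡ label y × move p x ≡ just p′ × move q y ≡ just q′
  move₂⇒ p q (just a) y        eq with em {label (just a) ≡ label y}
  ... | yes l = (λ ()) , l , zip-just eq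
  move₂⇒ p q nothing  (just b) eq with em {label nothing ≡ label (just b)}
  ... | yes l = (λ ()) , l , zip-just {s = move p nothing} eq

  ⇒move₂ : ∀ p q x y {p′ q′} → Both x y → label x ≡ label y →
    move p x ≡ just p′ → move q y ≡ just q′ → move₂ (p , q) (x ∷ y ∷ []) ≡ just (p′ , q′)
  ⇒move₂ p q nothing  nothing  b _ _ _ = contradiction (refl , refl) b
  ⇒move₂ p q (just a) y        _ l s t with em {label (just a) ≡ label y}
  ... | yes _ = cong₂ Maybe.zip s t
  ... | no ¬l = contradiction l ¬l
  ⇒move₂ p q nothing  (just b) _ l s t with em {label nothing ≡ label (just b)}
  ... | yes _ = cong₂ Maybe.zip s t
  ... | no ¬l = contradiction l ¬l

  letter-cons : ∀ x u → (x ≡ nothing → u ≡ []) →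
    letter 0 (cons x u) ≡ x × (∀ j → letter (suc j) (cons x u) ≡ letter j u)
  letter-cons (just a) u e = refl , λ _ → refl
  letter-cons nothing  u e with e refl
  ... | refl = refl , λ j → sym (letter-[] j)

  agree-cons : ∀ {x y u v} → (x ≡ nothing → u ≡ []) → (y ≡ nothing → v ≡ []) →
    label x ≡ label y → Agree u v → Agree (cons x u) (cons y v)
  agree-cons {x} {y} {u} {v} e f l ag zero
    rewrite proj₁ (letter-cons x u e) | proj₁ (letter-cons y v f) = l
  agree-cons {x} {y} {u} {v} e f l ag (suc j)
    rewrite proj₂ (letter-cons x u e) j | proj₂ (letter-cons y v f) j = ag j

  conv-cons : ∀ {x y u v} → Both x y → (x ≡ nothing → u ≡ []) → (y ≡ nothing → v ≡ []) →
    (x ∷ y ∷ []) ∷ conv u v ≡ conv (cons x u) (cons y v)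
  conv-cons {just a}  {just b}  _ _ _ = refl
  conv-cons {just a}  {nothing} {u} _ _ f with f refl
  ... | refl = refl
  conv-cons {nothing} {just b}  _ e _ with e refl
  ... | refl = refl
  conv-cons {nothing} {nothing} b _ _ = contradiction (refl , refl) b

  sound : ∀ p q W → Pairs.AcceptsFrom (just (p , q)) W →
    ∃₂ λ u v → Tail p u × Tail q v × Agree u v × W ≡ conv u v
  sound p q [] h =
    let (a , b) = Equivalence.to (Bool.T-∧ {ended p}) h
    in [] , [] , Equivalence.to (ended⇔ p) a , Equivalence.to (ended⇔ q) b , (λ _ → refl) , refl
  sound p q ((x ∷ y ∷ []) ∷ W) h with move₂ (p , q) (x ∷ y ∷ []) in eq
  ... | just (p′ , q′) =
    let (b , l , s , t)          = move₂⇒ p q x y eq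
        (u , v , tu , tv , ag , e) = sound p′ q′ W h
        (tu′ , eu)               = move-tail p x s tu
        (tv′ , ev)               = move-tail q y t tv
    in cons x u , cons y v , tu′ , tv′ , agree-cons {x} {y} {u} {v} eu ev l ag
       , trans (cong (_ ∷_) e) (conv-cons {x} {y} {u} {v} b eu ev)

  complete : ∀ p q u v → Tail p u → Tail q v → Agree u v → Pairs.AcceptsFrom (just (p , q)) (conv u v)
  complete p q [] [] s t _ =
    Equivalence.from (Bool.T-∧ {ended p}) (Equivalence.from (ended⇔ p) s , Equivalence.from (ended⇔ q) t)
  complete p q [] (b ∷ v) s t ag =
    let (q′ , eq , t′) = tail-move q b v t in
    subst (λ s → Pairs.AcceptsFrom s (conv [] v))
      (sym (⇒move₂ p q nothing (just b) (λ ()) (ag 0) (tail-end p s) eq))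
      (complete nothing q′ [] v refl t′ (λ j → trans (cong label (letter-[] j)) (ag (suc j))))
  complete p q (a ∷ u) [] s t ag =
    let (p′ , eq , s′) = tail-move p a u s in
    subst (λ s → Pairs.AcceptsFrom s (conv u []))
      (sym (⇒move₂ p q (just a) nothing (λ ()) (ag 0) eq (tail-end q t)))
      (complete p′ nothing u [] s′ refl (λ j → trans (ag (suc j)) (sym (cong label (letter-[] j)))))
  complete p q (a ∷ u) (b ∷ v) s t ag =
    let (p′ , eq , s′)  = tail-move p a u s
        (q′ , eq′ , t′) = tail-move q b v t
    in subst (λ s → Pairs.AcceptsFrom s (conv u v))
      (sym (⇒move₂ p q (just a) (just b) (λ ()) (ag 0) eq eq′))
      (complete p′ q′ u v s′ t′ (ag ∘ suc))

-- Equivalence structures whose elements are coded by the words of a language of polynomial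
-- growth, in such a way that two elements are equivalent iff their words carry the same
-- labels.  Labels may be nothing, so that equivalent words can have different lengths.
record Coded (B : EquivalenceStructure) : Set₁ where
  open Setoid B using (Carrier; _≈_)
  field
    Letter    : Set
    letters   : FinType Letter
    automaton : PDFA Letter
    word      : Carrier → List Letter
    injective : Injective _≡_ _≡_ word
    image     : PDFA.Accepted automaton ≐ (λ w → ∃ λ z → word z ≡ w)
    Γ         : Set
    π         : Letter → Maybe Γ
    preserves : ∀ y z → y ≈ z ⇔
                (∀ j → maybe′ π nothing (letter j (word y)) ≡ maybe′ π nothing (letter j (word z)))
    rank      : Carrier → ℕ
    rank-injective : Injective _≡_ _≡_ rank
    bound     : Polynomial 1
    bounded   : ∀ z → rank z < ⟦ bound ⟧ (length (word z) ∷ [])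

-- Presentations of coded structures

poly-mono : ∀ (p : Polynomial 1) {m n} → m ≤ n → ⟦ p ⟧ (m ∷ []) ≤ ⟦ p ⟧ (n ∷ [])
poly-mono []                  m≤n = z≤n
poly-mono ((c , e ∷ []) ∷ p) m≤n =
  ℕ.+-mono-≤ (ℕ.*-monoʳ-≤ c (ℕ.*-monoˡ-≤ 1 (ℕ.^-monoˡ-≤ e m≤n))) (poly-mono p m≤n)

module Presentation (em : ExcludedMiddle 0ℓ) {B : EquivalenceStructure} (coded : Coded B) where

  open Coded coded
  open Setoid B using (Carrier; _≈_)
  module L = FinType letters

  renamed : PDFA (Fin L.size)
  renamed = record { PDFA automaton ; step = λ q i → PDFA.step automaton q (L.decode i) }

  renamed⇒ : ∀ q w → PDFA.AcceptsFrom renamed q w → PDFA.AcceptsFrom automaton q (map L.decode w)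
  renamed⇒ (just q) []      h = h
  renamed⇒ (just q) (a ∷ w) h = renamed⇒ (PDFA.step automaton q (L.decode a)) w h

  ⇒renamed : ∀ q w → PDFA.AcceptsFrom automaton q (map L.decode w) → PDFA.AcceptsFrom renamed q w
  ⇒renamed (just q) []      h = h
  ⇒renamed (just q) (a ∷ w) h = ⇒renamed (PDFA.step automaton q (L.decode a)) w h

  universe : DFA (Fin L.size)
  universe = Totalise.dfa renamed

  decode-word : List (Fin L.size) → List Letter
  decode-word = map L.decode

  encode-word : List Letter → List (Fin L.size)
  encode-word = map L.encode

  decode-encode : ∀ w → decode-word (encode-word w) ≡ w
  decode-encode []      = refl
  decode-encode (a ∷ w) = cong₂ _∷_ (L.decode-encode a) (decode-encode w)

  decode-injective : ∀ {u v} → decode-word u ≡ decode-word v → u ≡ v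
  decode-injective {[]}    {[]}    _  = refl
  decode-injective {a ∷ u} {b ∷ v} eq = cong₂ _∷_
    (trans (sym (L.encode-decode a)) (trans (cong L.encode (List.∷-injectiveˡ eq)) (L.encode-decode b)))
    (decode-injective (List.∷-injectiveʳ eq))

  element : ∀ {w} → Accepts universe w → ∃ λ z → word z ≡ decode-word w
  element {w} p = proj₁ image (renamed⇒ (just (PDFA.start renamed)) w
    (Equivalence.to (Totalise.accepts⇔ renamed w) p))

  to : ∃ (Accepts universe) → Carrier
  to (w , p) = proj₁ (element {w} p)

  word-to : ∀ u → word (to u) ≡ decode-word (proj₁ u)
  word-to (w , p) = proj₂ (element {w} p)

  from : Carrier → ∃ (Accepts universe)
  from z = w , Equivalence.from (Totalise.accepts⇔ renamed w)
    (⇒renamed (just (PDFA.start renamed)) w (proj₂ image (z , sym (decode-encode (word z)))))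
    where
    w : List (Fin L.size)
    w = encode-word (word z)

  element-≡ : ∀ {u v : ∃ (Accepts universe)} → proj₁ u ≡ proj₁ v → u ≡ v
  element-≡ {w , p} {_ , q} refl = cong (w ,_) (Accepts-irrelevant universe {w} p q)

  to-injective : ∀ {u v} → to u ≡ to v → u ≡ v
  to-injective {u} {v} eq =
    element-≡ (decode-injective (trans (sym (word-to u)) (trans (cong word eq) (word-to v))))

  to-from : ∀ z → to (from z) ≡ z
  to-from z = injective (trans (word-to (from z)) (decode-encode (word z)))

  π′ : Fin L.size → Maybe Γ
  π′ = π ∘ L.decode

  open Synchronised em renamed π′

  label-decode : ∀ j w → label (letter j w) ≡ maybe′ π nothing (letter j (decode-word w))
  label-decode zero    []      = refl
  label-decode (suc j) []      = refl
  label-decode zero    (a ∷ w) = refl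
  label-decode (suc j) (a ∷ w) = label-decode j w

  ≈⇔agree : ∀ u v → to u ≈ to v ⇔ Agree (proj₁ u) (proj₁ v)
  ≈⇔agree u v = mk⇔
    (λ h j → trans (labels u j) (trans (Equivalence.to (preserves (to u) (to v)) h j) (sym (labels v j))))
    (λ h → Equivalence.from (preserves (to u) (to v))
      (λ j → trans (sym (labels u j)) (trans (h j) (labels v j))))
    where
    labels : ∀ u j → label (letter j (proj₁ u)) ≡ maybe′ π nothing (letter j (word (to u)))
    labels u j = trans (label-decode j (proj₁ u)) (cong (maybe′ π nothing ∘ letter j) (sym (word-to u)))

  accepted⇔ : ∀ w → Accepts universe w ⇔ Tail (just (PDFA.start renamed)) w
  accepted⇔ = Totalise.accepts⇔ renamed

  regular : RegularRelation {n = 2} λ ws → ∃₂ λ (u v : ∃ (Accepts universe)) →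
    to u ≈ to v × ws ≡ proj₁ u ∷ proj₁ v ∷ []
  regular = Totalise.dfa pairs
    , (λ { {W} (_ , (u , v , h , refl) , eq) → Equivalence.from (Totalise.accepts⇔ pairs W)
           (subst Pairs.Accepted (sym (trans eq (convolution-conv (proj₁ u) (proj₁ v))))
             (complete _ _ (proj₁ u) (proj₁ v)
               (Equivalence.to (accepted⇔ (proj₁ u)) (proj₂ u))
               (Equivalence.to (accepted⇔ (proj₁ v)) (proj₂ v))
               (Equivalence.to (≈⇔agree u v) h))) })
    , λ {W} h →
        let (u , v , tu , tv , ag , eq) = sound _ _ W (Equivalence.to (Totalise.accepts⇔ pairs W) h)
            u′ = u , Equivalence.from (accepted⇔ u) tu
            v′ = v , Equivalence.from (accepted⇔ v) tv
        in _ , (u′ , v′ , Equivalence.from (≈⇔agree u′ v′) ag , refl)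
             , trans eq (sym (convolution-conv u v))

  -- `rank` numbers the elements injectively, below a polynomial in the length of their words.
  -- Polynomials with natural coefficients are monotone, so all words of length at most n have ranks
  -- below the value at n.
  growth : PolynomialGrowth (Accepts universe)
  growth = bound , λ n → mk↣ {to = λ (w , p , l) → fromℕ< (rank< n w p l)}
    λ { {w , p , l} {w′ , p′ , l′} eq → triple-≡ (cong proj₁ (to-injective {w , p} {w′ , p′}
          (rank-injective (Fin.fromℕ<-injective _ _ (rank< n w p l) (rank< n w′ p′ l′) eq)))) }
    where
    rank< : ∀ n w p → length w ≤ n → rank (to (w , p)) < ⟦ bound ⟧ (n ∷ [])
    rank< n w p l = ℕ.<-≤-trans (bounded (to (w , p))) (poly-mono bound
      (subst (_≤ n) (sym (trans (cong length (word-to (w , p))) (List.length-map L.decode w))) l))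
    triple-≡ : ∀ {n} {u v : ∃ λ w → Accepts universe w × length w ≤ n} → proj₁ u ≡ proj₁ v → u ≡ v
    triple-≡ {u = w , p , l} {_ , q , m} refl =
      cong₂ (λ p l → w , p , l) (Accepts-irrelevant universe {w} p q) (ℕ.≤-irrelevant l m)

  presentation : PolyGrowthAutomatic B
  presentation = record
    { k             = L.size
    ; universe      = universe
    ; _∼_           = λ u v → to u ≈ to v
    ; isEquivalence = record
        { refl = Setoid.refl B ; sym = Setoid.sym B ; trans = Setoid.trans B }
    ; isomorphic    = mk↔ₛ′ to from to-from (λ u → to-injective (to-from (to u)))
                    , λ _ _ → mk⇔ id id
    ; ∼-regular     = regular
    } , growth

-- Isomorphic copies and disjoint unions of coded structures

label : ∀ {A Γ : Set} → (A → Maybe Γ) → Maybe A → Maybe Γ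
label π = maybe′ π nothing

coded-≅ : ∀ {A B} → A ≅ B → Coded B → Coded A
coded-≅ (f , h) K = record
  { Coded K using (Letter; letters; automaton; Γ; π; bound)
  ; word           = word ∘ to
  ; injective      = to-injective ∘ injective
  ; image          = (λ p → let (z , eq) = proj₁ image p in
                       from z , trans (cong word (strictlyInverseˡ z)) eq)
                   , (λ (z , eq) → proj₂ image (to z , eq))
  ; preserves      = λ y z → mk⇔ (Equivalence.to (preserves (to y) (to z)) ∘ Equivalence.to (h y z))
                       (Equivalence.from (h y z) ∘ Equivalence.from (preserves (to y) (to z)))
  ; rank           = rank ∘ to
  ; rank-injective = to-injective ∘ rank-injective
  ; bounded        = bounded ∘ to
  }
  where
  open Coded K
  open Inverse f using (to; from; strictlyInverseˡ; strictlyInverseʳ)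
  to-injective : ∀ {x y} → to x ≡ to y → x ≡ y
  to-injective {x} {y} eq =
    trans (sym (strictlyInverseʳ x)) (trans (cong from eq) (strictlyInverseʳ y))

coded-⊥ : Coded (setoid ⊥)
coded-⊥ = record
  { letters        = finite-⊤
  ; automaton      = record { states = finite-⊤ ; step = λ _ _ → nothing ; start = tt ; final = λ _ → false }
  ; word           = ⊥-elim
  ; injective      = λ { {()} }
  ; image          = (λ { {[]} () ; {_ ∷ _} () }) , λ ()
  ; Γ              = ⊤
  ; π              = λ _ → nothing
  ; preserves      = λ ()
  ; rank           = ⊥-elim
  ; rank-injective = λ { {()} }
  ; bound          = []
  ; bounded        = λ ()
  }

-- A copy of M runs inside M′ on renamed letters. By `closed` all other letters are refused there,
-- so an embedded state accepts renamed words only.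
module Embed {A A′ : Set} (M : PDFA A) (M′ : PDFA A′)
  (f : PDFA.State M → PDFA.State M′) (l : A → A′)
  (simulates : ∀ q a → PDFA.step M′ (f q) (l a) ≡ Maybe.map f (PDFA.step M q a))
  (closed : ∀ q a′ → PDFA.step M′ (f q) a′ ≡ nothing ⊎ ∃ λ a → l a ≡ a′)
  (finals : ∀ q → PDFA.final M′ (f q) ≡ PDFA.final M q) where

  private
    module M  = PDFA M
    module M′ = PDFA M′

  embed⇒ : ∀ s u → M.AcceptsFrom s u → M′.AcceptsFrom (Maybe.map f s) (map l u)
  embed⇒ (just q) []      h = subst T (sym (finals q)) h
  embed⇒ (just q) (a ∷ u) h = subst (λ s → M′.AcceptsFrom s (map l u)) (sym (simulates q a))
    (embed⇒ (M.step q a) u h)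

  embed⇐ : ∀ s w → M′.AcceptsFrom (Maybe.map f s) w → ∃ λ u → M.AcceptsFrom s u × map l u ≡ w
  embed⇐ (just q) []       h = [] , subst T (finals q) h , refl
  embed⇐ (just q) (a′ ∷ w) h with closed q a′
  ... | inj₁ eq = ⊥-elim (subst (λ s → M′.AcceptsFrom s w) eq h)
  ... | inj₂ (a , refl) =
    let (u , h′ , eq) = embed⇐ (M.step q a) w (subst (λ s → M′.AcceptsFrom s w) (simulates q a) h)
    in a ∷ u , h′ , cong (l a ∷_) eq

<-poly : ∀ {n} {f : Vec ℕ n → ℕ} (p : IsPoly f) {m} x → m < f x → m < ⟦ proj₁ p ⟧ x
<-poly p x = subst (_ <_) (sym (proj₂ p x))

module DisjointUnion {A B : EquivalenceStructure} (K₁ : Coded A) (K₂ : Coded B) where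

  private
    module A  = Setoid A
    module B  = Setoid B
    module K₁ = Coded K₁
    module K₂ = Coded K₂
    module M₁ = PDFA K₁.automaton
    module M₂ = PDFA K₂.automaton

  -- A leading Boolean names the summand. Its label is visible, so words from different summands
  -- disagree at position 0.
  Letter : Set
  Letter = Bool ⊎ (K₁.Letter ⊎ K₂.Letter)

  in₁ : K₁.Letter → Letter
  in₁ = inj₂ ∘ inj₁

  in₂ : K₂.Letter → Letter
  in₂ = inj₂ ∘ inj₂

  State : Set
  State = Maybe (M₁.State ⊎ M₂.State)

  step : State → Letter → Maybe State
  step nothing         (inj₁ false)      = just (just (inj₁ M₁.start))
  step nothing         (inj₁ true)       = just (just (inj₂ M₂.start))
  step (just (inj₁ q)) (inj₂ (inj₁ a)) = Maybe.map (just ∘ inj₁) (M₁.step q a)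
  step (just (inj₂ q)) (inj₂ (inj₂ a)) = Maybe.map (just ∘ inj₂) (M₂.step q a)
  step _               _                 = nothing

  automaton : PDFA Letter
  automaton = record
    { states = finite-Maybe (finite-⊎ M₁.states M₂.states)
    ; start  = nothing
    ; step   = step
    ; final  = maybe′ [ M₁.final , M₂.final ]′ false
    }

  closed₁ : ∀ q a → step (just (inj₁ q)) a ≡ nothing ⊎ ∃ λ b → in₁ b ≡ a
  closed₁ _ (inj₁ _)        = inj₁ refl
  closed₁ _ (inj₂ (inj₁ a)) = inj₂ (a , refl)
  closed₁ _ (inj₂ (inj₂ _)) = inj₁ refl

  closed₂ : ∀ q a → step (just (inj₂ q)) a ≡ nothing ⊎ ∃ λ b → in₂ b ≡ a
  closed₂ _ (inj₁ _)        = inj₁ refl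
  closed₂ _ (inj₂ (inj₁ _)) = inj₁ refl
  closed₂ _ (inj₂ (inj₂ a)) = inj₂ (a , refl)

  open Embed K₁.automaton automaton (just ∘ inj₁) in₁ (λ _ _ → refl) closed₁ (λ _ → refl)
    renaming (embed⇒ to embed₁⇒; embed⇐ to embed₁⇐)

  open Embed K₂.automaton automaton (just ∘ inj₂) in₂ (λ _ _ → refl) closed₂ (λ _ → refl)
    renaming (embed⇒ to embed₂⇒; embed⇐ to embed₂⇐)

  word : A.Carrier ⊎ B.Carrier → List Letter
  word (inj₁ y) = inj₁ false ∷ map in₁ (K₁.word y)
  word (inj₂ z) = inj₁ true ∷ map in₂ (K₂.word z)

  word-injective : ∀ y z → word y ≡ word z → y ≡ z
  word-injective (inj₁ y) (inj₁ z) eq =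
    cong inj₁ (K₁.injective (List.map-injective (λ { refl → refl }) (List.∷-injectiveʳ eq)))
  word-injective (inj₂ y) (inj₂ z) eq =
    cong inj₂ (K₂.injective (List.map-injective (λ { refl → refl }) (List.∷-injectiveʳ eq)))

  image⇒ : ∀ w → PDFA.Accepted automaton w → ∃ λ z → word z ≡ w
  image⇒ (inj₁ false ∷ w) h =
    let (u , h′ , eq) = embed₁⇐ (just M₁.start) w h
        (z , eq′)     = proj₁ K₁.image h′
    in inj₁ z , cong (_ ∷_) (trans (cong (map in₁) eq′) eq)
  image⇒ (inj₁ true ∷ w) h =
    let (u , h′ , eq) = embed₂⇐ (just M₂.start) w h
        (z , eq′)     = proj₁ K₂.image h′
    in inj₂ z , cong (_ ∷_) (trans (cong (map in₂) eq′) eq)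

  ⇒image : ∀ z → PDFA.Accepted automaton (word z)
  ⇒image (inj₁ z) = embed₁⇒ (just M₁.start) (K₁.word z) (proj₂ K₁.image (z , refl))
  ⇒image (inj₂ z) = embed₂⇒ (just M₂.start) (K₂.word z) (proj₂ K₂.image (z , refl))

  Γ : Set
  Γ = Bool ⊎ (K₁.Γ ⊎ K₂.Γ)

  π : Letter → Maybe Γ
  π (inj₁ b)        = just (inj₁ b)
  π (inj₂ (inj₁ a)) = Maybe.map (inj₂ ∘ inj₁) (K₁.π a)
  π (inj₂ (inj₂ a)) = Maybe.map (inj₂ ∘ inj₂) (K₂.π a)

  label-map : ∀ {L G : Set} (l : L → Letter) (p : L → Maybe G) (g : G → Γ) →
    (∀ a → π (l a) ≡ Maybe.map g (p a)) →
    ∀ j u → label π (letter j (map l u)) ≡ Maybe.map g (label p (letter j u))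
  label-map l p g eq zero    []      = refl
  label-map l p g eq (suc j) []      = refl
  label-map l p g eq zero    (a ∷ u) = eq a
  label-map l p g eq (suc j) (a ∷ u) = label-map l p g eq j u

  label₁ : ∀ j u → label π (letter j (map in₁ u)) ≡ Maybe.map (inj₂ ∘ inj₁) (label K₁.π (letter j u))
  label₁ = label-map in₁ K₁.π (inj₂ ∘ inj₁) (λ _ → refl)

  label₂ : ∀ j u → label π (letter j (map in₂ u)) ≡ Maybe.map (inj₂ ∘ inj₂) (label K₂.π (letter j u))
  label₂ = label-map in₂ K₂.π (inj₂ ∘ inj₂) (λ _ → refl)

  preserves : ∀ y z → Setoid._≈_ (A ⊎ₛ B) y z ⇔
    (∀ j → label π (letter j (word y)) ≡ label π (letter j (word z)))
  preserves (inj₁ y) (inj₁ z) = mk⇔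
    (λ { (Pointwise⊎.inj₁ h) zero    → refl
       ; (Pointwise⊎.inj₁ h) (suc j) → trans (label₁ j (K₁.word y))
           (trans (cong (Maybe.map _) (Equivalence.to (K₁.preserves y z) h j))
             (sym (label₁ j (K₁.word z)))) })
    (λ h → Pointwise⊎.inj₁ (Equivalence.from (K₁.preserves y z) λ j →
      Maybe.map-injective (λ { refl → refl })
        (trans (sym (label₁ j (K₁.word y))) (trans (h (suc j)) (label₁ j (K₁.word z))))))
  preserves (inj₁ y) (inj₂ z) = mk⇔ (λ ()) (λ h → case h 0 of λ ())
  preserves (inj₂ y) (inj₁ z) = mk⇔ (λ ()) (λ h → case h 0 of λ ())
  preserves (inj₂ y) (inj₂ z) = mk⇔
    (λ { (Pointwise⊎.inj₂ h) zero    → refl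
       ; (Pointwise⊎.inj₂ h) (suc j) → trans (label₂ j (K₂.word y))
           (trans (cong (Maybe.map _) (Equivalence.to (K₂.preserves y z) h j))
             (sym (label₂ j (K₂.word z)))) })
    (λ h → Pointwise⊎.inj₂ (Equivalence.from (K₂.preserves y z) λ j →
      Maybe.map-injective (λ { refl → refl })
        (trans (sym (label₂ j (K₂.word y))) (trans (h (suc j)) (label₂ j (K₂.word z))))))

  rank : A.Carrier ⊎ B.Carrier → ℕ
  rank (inj₁ y) = 2 * K₁.rank y
  rank (inj₂ z) = suc (2 * K₂.rank z)

  rank-injective : ∀ y z → rank y ≡ rank z → y ≡ z
  rank-injective (inj₁ y) (inj₁ z) eq = cong inj₁ (K₁.rank-injective (ℕ.*-cancelˡ-≡ _ _ 2 eq))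
  rank-injective (inj₁ y) (inj₂ z) eq = contradiction eq (ℕ.even≢odd (K₁.rank y) (K₂.rank z))
  rank-injective (inj₂ y) (inj₁ z) eq = contradiction (sym eq) (ℕ.even≢odd (K₁.rank z) (K₂.rank y))
  rank-injective (inj₂ y) (inj₂ z) eq =
    cong inj₂ (K₂.rank-injective (ℕ.*-cancelˡ-≡ _ _ 2 (ℕ.suc-injective eq)))

  bound : IsPoly {1} (λ n → 2 * (⟦ K₁.bound ⟧ n + ⟦ K₂.bound ⟧ n))
  bound = poly-* (poly-const 2) (poly-+ (K₁.bound , λ _ → refl) (K₂.bound , λ _ → refl))

  bounded : ∀ z → rank z < ⟦ proj₁ bound ⟧ (length (word z) ∷ [])
  bounded z = <-poly bound (length (word z) ∷ []) (below z)
    where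
    open ℕ.≤-Reasoning
    shorter : ∀ {L : Set} (p : Polynomial 1) (l : L → Letter) u →
      ⟦ p ⟧ (length u ∷ []) ≤ ⟦ p ⟧ (suc (length (map l u)) ∷ [])
    shorter p l u = poly-mono p (ℕ.≤-trans (ℕ.≤-reflexive (sym (List.length-map l u))) (ℕ.n≤1+n _))
    bound₁ bound₂ : ℕ → ℕ
    bound₁ n = ⟦ K₁.bound ⟧ (n ∷ [])
    bound₂ n = ⟦ K₂.bound ⟧ (n ∷ [])
    below : ∀ z → rank z < 2 * (bound₁ (length (word z)) + bound₂ (length (word z)))
    below (inj₁ y) = begin-strict
      2 * K₁.rank y                            <⟨ ℕ.*-monoʳ-< 2 (K₁.bounded y) ⟩
      2 * bound₁ (length (K₁.word y))          ≤⟨ ℕ.*-monoʳ-≤ 2 (ℕ.≤-trans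
                                                    (shorter K₁.bound in₁ (K₁.word y))
                                                    (ℕ.m≤m+n (bound₁ n) (bound₂ n))) ⟩
      2 * (bound₁ n + bound₂ n)                ∎
      where n = length (word (inj₁ y))
    below (inj₂ z) = begin-strict
      suc (2 * K₂.rank z)                      <⟨ ℕ.n<1+n _ ⟩
      2 + 2 * K₂.rank z                        ≡⟨ ℕ.*-suc 2 (K₂.rank z) ⟨
      2 * suc (K₂.rank z)                      ≤⟨ ℕ.*-monoʳ-≤ 2 (ℕ.≤-trans (K₂.bounded z)
                                                    (ℕ.≤-trans (shorter K₂.bound in₂ (K₂.word z))
                                                      (ℕ.m≤n+m (bound₂ n) (bound₁ n)))) ⟩
      2 * (bound₁ n + bound₂ n)                ∎
      where n = length (word (inj₂ z))

  coded-⊎ : Coded (A ⊎ₛ B)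
  coded-⊎ = record
    { letters        = finite-⊎ finite-Bool (finite-⊎ K₁.letters K₂.letters)
    ; automaton      = automaton
    ; word           = word
    ; injective      = word-injective _ _
    ; image          = (λ {w} → image⇒ w) , λ { (z , refl) → ⇒image z }
    ; Γ              = Γ
    ; π              = π
    ; preserves      = preserves
    ; rank           = rank
    ; rank-injective = rank-injective _ _
    ; bound          = proj₁ bound
    ; bounded        = bounded
    }

-- A pairing function with natural coefficients

pair : ℕ → ℕ → ℕ
pair a b = (a + b) * (a + b) + a

-- Since a ≤ a + b, the value lies between the square of a + b and the next square. Thus a + b is
-- recovered first, and a from it. Cantor's pairing would bring in coefficients 1/2.
pair-injective : ∀ {a b c d} → pair a b ≡ pair c d → a ≡ c × b ≡ d
pair-injective {a} {b} {c} {d} eq =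
  a≡c , ℕ.+-cancelˡ-≡ a b d (trans a+b≡c+d (cong (_+ d) (sym a≡c)))
  where
  below : ∀ {a b c d} → a + b < c + d → pair a b < pair c d
  below {a} {b} {c} {d} lt = begin-strict
    (a + b) * (a + b) + a              ≤⟨ ℕ.+-monoʳ-≤ ((a + b) * (a + b)) (ℕ.m≤m+n a b) ⟩
    (a + b) * (a + b) + (a + b)        ≡⟨ ℕ.+-comm _ (a + b) ⟩
    suc (a + b) * (a + b)              <⟨ ℕ.*-monoʳ-< (suc (a + b)) (ℕ.n<1+n (a + b)) ⟩
    suc (a + b) * suc (a + b)          ≤⟨ ℕ.*-mono-≤ lt lt ⟩
    (c + d) * (c + d)                  ≤⟨ ℕ.m≤m+n _ c ⟩
    (c + d) * (c + d) + c              ∎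
    where open ℕ.≤-Reasoning
  a+b≡c+d : a + b ≡ c + d
  a+b≡c+d with ℕ.<-cmp (a + b) (c + d)
  ... | tri< lt _ _ = contradiction eq (ℕ.<⇒≢ (below {a} {b} {c} {d} lt))
  ... | tri≈ _ e _  = e
  ... | tri> _ _ gt = contradiction (sym eq) (ℕ.<⇒≢ (below {c} {d} {a} {b} gt))
  a≡c : a ≡ c
  a≡c = ℕ.+-cancelˡ-≡ ((a + b) * (a + b)) a c (trans eq (cong (λ s → s * s + c) (sym a+b≡c+d)))

pair-mono : ∀ {a b c d} → a ≤ c → b ≤ d → pair a b ≤ pair c d
pair-mono p q = ℕ.+-mono-≤ (ℕ.*-mono-≤ (ℕ.+-mono-≤ p q) (ℕ.+-mono-≤ p q)) p

poly-pair : ∀ {n} {f g : Vec ℕ n → ℕ} → IsPoly f → IsPoly g → IsPoly (λ x → pair (f x) (g x))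
poly-pair f g = poly-+ (poly-* (poly-+ f g) (poly-+ f g)) f

-- Structures in which all classes are countably infinite

Rows : Set → EquivalenceStructure
Rows I = On.setoid {B = I × ℕ} (setoid I) proj₁

letter-replicate : ∀ {A : Set} (j : ℕ) n (a : A) →
  letter j (replicate n a) ≡ just a ⊎ letter j (replicate n a) ≡ nothing
letter-replicate j       zero    a = inj₂ (letter-[] j)
letter-replicate zero    (suc n) a = inj₁ refl
letter-replicate (suc j) (suc n) a = letter-replicate j n a

-- The element (i , j) is coded by the visible letter i followed by j invisible ones, which look
-- like the void after the end of the word.
rows-Fin : ∀ m → Coded (Rows (Fin m))
rows-Fin m = record
  { letters        = finite-Maybe (finite-Fin m)
  ; automaton      = automaton
  ; word           = word
  ; injective      = word-injective
  ; image          = (λ {w} → image⇒ w) , λ { ((i , j) , refl) → loop j }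
  ; Γ              = Fin m
  ; π              = id
  ; preserves      = λ (i , j) (i′ , j′) → mk⇔
      (λ { refl zero → refl ; refl (suc l) → trans (blank l j) (sym (blank l j′)) })
      (λ h → Maybe.just-injective (h 0))
  ; rank           = λ (i , j) → pair (toℕ i) j
  ; rank-injective = λ { {i , j} {i′ , j′} eq →
      let (eq₁ , eq₂) = pair-injective {toℕ i} {j} eq in cong₂ _,_ (Fin.toℕ-injective eq₁) eq₂ }
  ; bound          = proj₁ bound
  ; bounded        = λ (i , j) → <-poly bound (length (word (i , j)) ∷ [])
      (s≤s (pair-mono (ℕ.<⇒≤ (Fin.toℕ<n i))
        (ℕ.≤-trans (ℕ.≤-reflexive (sym (List.length-replicate j))) (ℕ.n≤1+n _))))
  }
  where
  step : Bool → Maybe (Fin m) → Maybe Bool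
  step false (just i) = just true
  step true  nothing  = just true
  step _     _        = nothing
  automaton : PDFA (Maybe (Fin m))
  automaton = record { states = finite-Bool ; start = false ; step = step ; final = id }
  word : Fin m × ℕ → List (Maybe (Fin m))
  word (i , j) = just i ∷ replicate j nothing
  word-injective : Injective _≡_ _≡_ word
  word-injective {i , j} {i′ , j′} eq = cong₂ _,_ (Maybe.just-injective (List.∷-injectiveˡ eq))
    (trans (sym (List.length-replicate j))
      (trans (cong length (List.∷-injectiveʳ eq)) (List.length-replicate j′)))
  loop : ∀ j → PDFA.AcceptsFrom automaton (just true) (replicate j nothing)
  loop zero    = tt
  loop (suc j) = loop j
  tail : ∀ w → PDFA.AcceptsFrom automaton (just true) w → ∃ λ j → replicate j nothing ≡ w
  tail []            h = 0 , refl
  tail (nothing ∷ w) h = let (j , eq) = tail w h in suc j , cong (nothing ∷_) eq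
  image⇒ : ∀ w → PDFA.Accepted automaton w → ∃ λ z → word z ≡ w
  image⇒ (just i ∷ w) h = let (j , eq) = tail w h in (i , j) , cong (just i ∷_) eq
  blank : ∀ l j → label id (letter l (replicate j nothing)) ≡ nothing
  blank l j with letter-replicate l j (nothing {A = Fin m})
  ... | inj₁ eq = cong (label id) eq
  ... | inj₂ eq = cong (label id) eq
  bound : IsPoly {1} (λ v → suc (pair m (lookup v zero)))
  bound = poly-+ (poly-const 1) (poly-pair (poly-const m) (poly-var zero))

-- With infinitely many rows, i is given in unary by visible letters `false`; the j letters `true`
-- after them are invisible.
rows-ℕ : Coded (Rows ℕ)
rows-ℕ = record
  { letters        = finite-Bool
  ; automaton      = automaton
  ; word           = word
  ; injective      = λ { {i , j} {i′ , j′} → word-injective i i′ }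
  ; image          = (λ {w} → image⇒ w) , λ { ((i , j) , refl) → accept i j }
  ; Γ              = ⊤
  ; π              = π
  ; preserves      = λ (i , j) (i′ , j′) → mk⇔
      (λ { refl l → same i l j j′ })
      (λ h → separate i i′ h)
  ; rank           = λ (i , j) → pair i j
  ; rank-injective = λ { {i , j} {i′ , j′} eq →
      let (eq₁ , eq₂) = pair-injective {i} {j} eq in cong₂ _,_ eq₁ eq₂ }
  ; bound          = proj₁ bound
  ; bounded        = λ (i , j) → <-poly bound (length (word (i , j)) ∷ [])
      (s≤s (pair-mono
        (subst (i ≤_) (sym (length-word i j)) (ℕ.m≤m+n i j))
        (subst (j ≤_) (sym (length-word i j)) (ℕ.m≤n+m j i))))
  }
  where
  step : Bool → Bool → Maybe Bool
  step false b     = just b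
  step true  true  = just true
  step true  false = nothing
  automaton : PDFA Bool
  automaton = record { states = finite-Bool ; start = false ; step = step ; final = λ _ → true }
  word : ℕ × ℕ → List Bool
  word (i , j) = replicate i false ++ replicate j true
  π : Bool → Maybe ⊤
  π = if_then nothing else just tt
  length-word : ∀ i j → length (word (i , j)) ≡ i + j
  length-word i j = trans (List.length-++ (replicate i false))
    (cong₂ _+_ (List.length-replicate i) (List.length-replicate j))
  word-injective : ∀ i i′ {j j′} → word (i , j) ≡ word (i′ , j′) → (i , j) ≡ (i′ , j′)
  word-injective zero    zero     {j} {j′} eq = cong (0 ,_)
    (trans (sym (List.length-replicate j)) (trans (cong length eq) (List.length-replicate j′)))
  word-injective zero    (suc i′) {suc j} ()
  word-injective (suc i) zero     {j′ = suc j′} ()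
  word-injective (suc i) (suc i′) eq = cong (Product.map₁ suc) (word-injective i i′ (List.∷-injectiveʳ eq))
  accept : ∀ i j → PDFA.AcceptsFrom automaton (just false) (word (i , j))
  accept (suc i) j       = accept i j
  accept zero    zero    = tt
  accept zero    (suc j) = loop j
    where
    loop : ∀ j → PDFA.AcceptsFrom automaton (just true) (replicate j true)
    loop zero    = tt
    loop (suc j) = loop j
  tail : ∀ w → PDFA.AcceptsFrom automaton (just true) w → ∃ λ j → replicate j true ≡ w
  tail []         h = 0 , refl
  tail (true ∷ w) h = let (j , eq) = tail w h in suc j , cong (true ∷_) eq
  image⇒ : ∀ w → PDFA.Accepted automaton w → ∃ λ z → word z ≡ w
  image⇒ []          h = (0 , 0) , refl
  image⇒ (false ∷ w) h = let ((i , j) , eq) = image⇒ w h in (suc i , j) , cong (false ∷_) eq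
  image⇒ (true ∷ w)  h = let (j , eq) = tail w h in (0 , suc j) , cong (true ∷_) eq
  blank : ∀ l j → label π (letter l (replicate j true)) ≡ nothing
  blank l j with letter-replicate l j true
  ... | inj₁ eq = cong (label π) eq
  ... | inj₂ eq = cong (label π) eq
  same : ∀ i l j j′ → label π (letter l (word (i , j))) ≡ label π (letter l (word (i , j′)))
  same zero    l       j j′ = trans (blank l j) (sym (blank l j′))
  same (suc i) zero    j j′ = refl
  same (suc i) (suc l) j j′ = same i l j j′
  separate : ∀ i i′ {j j′} →
    (∀ l → label π (letter l (word (i , j))) ≡ label π (letter l (word (i′ , j′)))) → i ≡ i′
  separate zero    zero     h = refl
  separate zero    (suc i′) {j} h = case trans (sym (blank 0 j)) (h 0) of λ ()
  separate (suc i) zero     {j′ = j′} h = case trans (h 0) (blank 0 j′) of λ ()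
  separate (suc i) (suc i′) h = cong suc (separate i i′ (h ∘ suc))
  bound : IsPoly {1} (λ v → suc (pair (lookup v zero) (lookup v zero)))
  bound = poly-+ (poly-const 1) (poly-pair (poly-var zero) (poly-var zero))

-- Counting by runs of nondeterministic automata

-- The transitions from q under γ are Labels q γ; the function computed is the number of
-- accepting runs.
record CountingAutomaton (Γ : Set) : Set₁ where
  field
    State  : Set
    states : FinType State
    Labels : State → Γ → Set
    labels : ∀ q γ → FinType (Labels q γ)
    move   : ∀ q γ → Labels q γ → State
    start  : State
    final  : State → Bool

  Run : State → List Γ → Set
  Run q []      = T (final q)
  Run q (γ ∷ w) = Σ[ l ∈ Labels q γ ] Run (move q γ l) w

-- The closing letter keeps every codeword nonempty, on which the sum of two automata relies.
codeword : ∀ {n} → Vec ℕ n → List (Fin (suc n))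
codeword []      = zero ∷ []
codeword (a ∷ x) = replicate a zero ++ map suc (codeword x)

codeword-nonempty : ∀ {n} (x : Vec ℕ n) → ∃₂ λ γ w → codeword x ≡ γ ∷ w
codeword-nonempty []          = _ , _ , refl
codeword-nonempty (suc a ∷ x) = _ , _ , refl
codeword-nonempty (zero ∷ x)  =
  let (γ , w , eq) = codeword-nonempty x in suc γ , map suc w , cong (map suc) eq

Computes : ∀ {n} → CountingAutomaton (Fin (suc n)) → (Vec ℕ n → ℕ) → Set
Computes W g = ∀ x → Fin (g x) ↔ Run start (codeword x)
  where open CountingAutomaton W

Computable : ∀ {n} → (Vec ℕ n → ℕ) → Set₁
Computable g = Σ[ W ∈ CountingAutomaton _ ] Computes W g

≡⇒Fin↔ : ∀ {m n} → m ≡ n → Fin m ↔ Fin n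
≡⇒Fin↔ refl = mk↔ₛ′ id id (λ _ → refl) (λ _ → refl)

computable-cong : ∀ {n} {f g : Vec ℕ n → ℕ} → f ≗ g → Computable f → Computable g
computable-cong eq (W , h) = W , λ x → ↔-trans (≡⇒Fin↔ (sym (eq x))) (h x)

Σ-↔ : ∀ {A : Set} {B C : A → Set} → (∀ a → B a ↔ C a) → Σ A B ↔ Σ A C
Σ-↔ f = mk↔ₛ′ (λ (a , b) → a , Inverse.to (f a) b) (λ (a , c) → a , Inverse.from (f a) c)
  (λ (a , c) → cong (a ,_) (Inverse.strictlyInverseˡ (f a) c))
  (λ (a , b) → cong (a ,_) (Inverse.strictlyInverseʳ (f a) b))

⊤-Σ : ∀ {B : ⊤ → Set} → B tt ↔ Σ ⊤ B
⊤-Σ = mk↔ₛ′ (tt ,_) proj₂ (λ _ → refl) (λ _ → refl)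

computable-0 : ∀ {n} → Computable {n} (λ _ → 0)
computable-0 = W , λ x → ↔-trans Fin.0↔⊥ (run (codeword x))
  where
  W : CountingAutomaton _
  W = record { states = finite-⊤ ; Labels = λ _ _ → ⊤ ; labels = λ _ _ → finite-⊤
             ; move = λ _ _ _ → tt ; start = tt ; final = λ _ → false }
  run : ∀ w → ⊥ ↔ CountingAutomaton.Run W tt w
  run []      = mk↔ₛ′ id id (λ _ → refl) (λ _ → refl)
  run (γ ∷ w) = ↔-trans (run w) ⊤-Σ

computable-1 : ∀ {n} → Computable {n} (λ _ → 1)
computable-1 = W , λ x → ↔-trans Fin.1↔⊤ (run (codeword x))
  where
  W : CountingAutomaton _
  W = record { states = finite-⊤ ; Labels = λ _ _ → ⊤ ; labels = λ _ _ → finite-⊤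
             ; move = λ _ _ _ → tt ; start = tt ; final = λ _ → true }
  run : ∀ w → ⊤ ↔ CountingAutomaton.Run W tt w
  run []      = mk↔ₛ′ id id (λ _ → refl) (λ _ → refl)
  run (γ ∷ w) = ↔-trans (run w) ⊤-Σ

module SumAutomaton {Γ : Set} (W₁ W₂ : CountingAutomaton Γ) where

  private
    module W₁ = CountingAutomaton W₁
    module W₂ = CountingAutomaton W₂

  State : Set
  State = Maybe (W₁.State ⊎ W₂.State)

  Labels : State → Γ → Set
  Labels nothing         γ = W₁.Labels W₁.start γ ⊎ W₂.Labels W₂.start γ
  Labels (just (inj₁ q)) γ = W₁.Labels q γ
  Labels (just (inj₂ q)) γ = W₂.Labels q γ

  automaton : CountingAutomaton Γ
  automaton = record
    { states = finite-Maybe (finite-⊎ W₁.states W₂.states)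
    ; Labels = Labels
    ; labels = λ { nothing         γ → finite-⊎ (W₁.labels W₁.start γ) (W₂.labels W₂.start γ)
                 ; (just (inj₁ q)) γ → W₁.labels q γ
                 ; (just (inj₂ q)) γ → W₂.labels q γ }
    ; move   = λ { nothing         γ (inj₁ l) → just (inj₁ (W₁.move W₁.start γ l))
                 ; nothing         γ (inj₂ l) → just (inj₂ (W₂.move W₂.start γ l))
                 ; (just (inj₁ q)) γ l        → just (inj₁ (W₁.move q γ l))
                 ; (just (inj₂ q)) γ l        → just (inj₂ (W₂.move q γ l)) }
    ; start  = nothing
    ; final  = maybe′ [ W₁.final , W₂.final ]′ false
    }

  open CountingAutomaton automaton using (Run)

  run₁ : ∀ q w → W₁.Run q w ↔ Run (just (inj₁ q)) w
  run₁ q []      = mk↔ₛ′ id id (λ _ → refl) (λ _ → refl)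
  run₁ q (γ ∷ w) = Σ-↔ (λ l → run₁ (W₁.move q γ l) w)

  run₂ : ∀ q w → W₂.Run q w ↔ Run (just (inj₂ q)) w
  run₂ q []      = mk↔ₛ′ id id (λ _ → refl) (λ _ → refl)
  run₂ q (γ ∷ w) = Σ-↔ (λ l → run₂ (W₂.move q γ l) w)

  -- The empty word is excluded, since the fresh initial state accepts nothing on it.
  run : ∀ γ w → (W₁.Run W₁.start (γ ∷ w) ⊎ W₂.Run W₂.start (γ ∷ w)) ↔ Run nothing (γ ∷ w)
  run γ w = mk↔ₛ′
    (λ { (inj₁ (l , r)) → inj₁ l , Inverse.to (run₁ _ w) r
       ; (inj₂ (l , r)) → inj₂ l , Inverse.to (run₂ _ w) r })
    (λ { (inj₁ l , r) → inj₁ (l , Inverse.from (run₁ _ w) r)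
       ; (inj₂ l , r) → inj₂ (l , Inverse.from (run₂ _ w) r) })
    (λ { (inj₁ l , r) → cong (inj₁ l ,_) (Inverse.strictlyInverseˡ (run₁ _ w) r)
       ; (inj₂ l , r) → cong (inj₂ l ,_) (Inverse.strictlyInverseˡ (run₂ _ w) r) })
    (λ { (inj₁ (l , r)) → cong (λ r → inj₁ (l , r)) (Inverse.strictlyInverseʳ (run₁ _ w) r)
       ; (inj₂ (l , r)) → cong (λ r → inj₂ (l , r)) (Inverse.strictlyInverseʳ (run₂ _ w) r) })

computable-+ : ∀ {n} {f g : Vec ℕ n → ℕ} → Computable f → Computable g → Computable (λ x → f x + g x)
computable-+ (W₁ , h₁) (W₂ , h₂) = automaton , λ x →
  ↔-trans Fin.+↔⊎ (↔-trans (h₁ x ⊎-↔ h₂ x) (runs x))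
  where
  open SumAutomaton W₁ W₂
  runs : ∀ x → (CountingAutomaton.Run W₁ (CountingAutomaton.start W₁) (codeword x)
                ⊎ CountingAutomaton.Run W₂ (CountingAutomaton.start W₂) (codeword x))
               ↔ CountingAutomaton.Run automaton nothing (codeword x)
  runs x with codeword x | codeword-nonempty x
  ... | _ | γ , w , refl = run γ w

module ProductAutomaton {Γ : Set} (W₁ W₂ : CountingAutomaton Γ) where

  private
    module W₁ = CountingAutomaton W₁
    module W₂ = CountingAutomaton W₂

  automaton : CountingAutomaton Γ
  automaton = record
    { states = finite-× W₁.states W₂.states
    ; Labels = λ (p , q) γ → W₁.Labels p γ × W₂.Labels q γ
    ; labels = λ (p , q) γ → finite-× (W₁.labels p γ) (W₂.labels q γ)
    ; move   = λ (p , q) γ (l , m) → W₁.move p γ l , W₂.move q γ m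
    ; start  = W₁.start , W₂.start
    ; final  = λ (p , q) → W₁.final p ∧ W₂.final q
    }

  T-∧-↔ : ∀ a b → (T a × T b) ↔ T (a ∧ b)
  T-∧-↔ true  b = mk↔ₛ′ proj₂ (tt ,_) (λ _ → refl) (λ _ → refl)
  T-∧-↔ false b = mk↔ₛ′ proj₁ (λ ()) (λ ()) (λ ())

  run : ∀ p q w → (W₁.Run p w × W₂.Run q w) ↔ CountingAutomaton.Run automaton (p , q) w
  run p q []      = T-∧-↔ (W₁.final p) (W₂.final q)
  run p q (γ ∷ w) = ↔-trans
    (mk↔ₛ′ (λ ((l , r) , (m , s)) → (l , m) , (r , s)) (λ ((l , m) , (r , s)) → (l , r) , (m , s))
      (λ _ → refl) (λ _ → refl))
    (Σ-↔ (λ (l , m) → run (W₁.move p γ l) (W₂.move q γ m) w))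

computable-* : ∀ {n} {f g : Vec ℕ n → ℕ} → Computable f → Computable g → Computable (λ x → f x * g x)
computable-* (W₁ , h₁) (W₂ , h₂) = automaton , λ x →
  ↔-trans Fin.*↔× (↔-trans (h₁ x ×-↔ h₂ x) (run _ _ (codeword x)))
  where open ProductAutomaton W₁ W₂

-- A run marks one occurrence of the letter i.
module MarkAutomaton {m} (i : Fin m) where

  Labels : Bool → Fin m → Set
  Labels true  γ = ⊤
  Labels false γ = if does (γ Fin.≟ i) then Bool else ⊤

  labels : ∀ q γ → FinType (Labels q γ)
  labels true  γ = finite-⊤
  labels false γ with γ Fin.≟ i
  ... | yes _ = finite-Bool
  ... | no  _ = finite-⊤

  move : ∀ q γ → Labels q γ → Bool
  move true  γ _ = true
  move false γ l with γ Fin.≟ i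
  ... | yes _ = l
  ... | no  _ = false

  automaton : CountingAutomaton (Fin m)
  automaton = record
    { states = finite-Bool ; Labels = Labels ; labels = labels ; move = move ; start = false ; final = id }

  open CountingAutomaton automaton using (Run)

  occurrences : List (Fin m) → ℕ
  occurrences []      = 0
  occurrences (γ ∷ w) = if does (γ Fin.≟ i) then suc (occurrences w) else occurrences w

  run-true : ∀ w → ⊤ ↔ Run true w
  run-true []      = mk↔ₛ′ id id (λ _ → refl) (λ _ → refl)
  run-true (γ ∷ w) = ↔-trans (run-true w) ⊤-Σ

  run-false : ∀ w → Fin (occurrences w) ↔ Run false w
  run-false [] = Fin.0↔⊥
  run-false (γ ∷ w) with γ Fin.≟ i
  ... | no _  = ↔-trans (run-false w) ⊤-Σ
  ... | yes _ = ↔-trans (Fin.+↔⊎ {1}) (↔-trans (↔-trans Fin.1↔⊤ (run-true w) ⊎-↔ run-false w)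
    (mk↔ₛ′ [ true ,_ , false ,_ ]′ (λ { (true , r) → inj₁ r ; (false , r) → inj₂ r })
      (λ { (true , r) → refl ; (false , r) → refl }) (λ { (inj₁ _) → refl ; (inj₂ _) → refl })))

occurrences-map-suc : ∀ {m} (i : Fin m) w →
  MarkAutomaton.occurrences (suc i) (map suc w) ≡ MarkAutomaton.occurrences i w
occurrences-map-suc i []      = refl
occurrences-map-suc i (γ ∷ w) with γ Fin.≟ i
... | yes _ = cong suc (occurrences-map-suc i w)
... | no  _ = occurrences-map-suc i w

occurrences-codeword : ∀ {n} (i : Fin n) x →
  MarkAutomaton.occurrences (Fin.inject₁ i) (codeword x) ≡ lookup x i
occurrences-codeword zero    (a ∷ x) = zeros a
  where
  none : ∀ {m} (w : List (Fin m)) → MarkAutomaton.occurrences zero (map suc w) ≡ 0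
  none []      = refl
  none (γ ∷ w) = none w
  zeros : ∀ a → MarkAutomaton.occurrences zero (replicate a zero ++ map suc (codeword x)) ≡ a
  zeros zero    = none (codeword x)
  zeros (suc a) = cong suc (zeros a)
occurrences-codeword (suc i) (a ∷ x) = zeros a
  where
  zeros : ∀ a → MarkAutomaton.occurrences (suc (Fin.inject₁ i)) (replicate a zero ++ map suc (codeword x))
    ≡ lookup x i
  zeros zero    = trans (occurrences-map-suc (Fin.inject₁ i) (codeword x)) (occurrences-codeword i x)
  zeros (suc a) = zeros a

computable-var : ∀ {n} (i : Fin n) → Computable (λ x → lookup x i)
computable-var i = automaton , λ x →
  ↔-trans (≡⇒Fin↔ (sym (occurrences-codeword i x))) (run-false (codeword x))
  where open MarkAutomaton (Fin.inject₁ i)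

computable-const : ∀ {n} c → Computable {n} (λ _ → c)
computable-const zero    = computable-0
computable-const (suc c) = computable-+ computable-1 (computable-const c)

computable-^ : ∀ {n} {f : Vec ℕ n → ℕ} → Computable f → ∀ k → Computable (λ x → f x ^ k)
computable-^ f zero    = computable-1
computable-^ f (suc k) = computable-* f (computable-^ f k)

-- The recursion on the exponents removes variables, while the automata go on reading codewords of
-- the full tuple; ρ tells which variables are left.
computable-monomial : ∀ {m n} (ρ : Fin n → Fin m) (e : Vec ℕ n) →
  Computable (λ x → monomial e (Vec.tabulate (λ i → lookup x (ρ i))))
computable-monomial ρ []      = computable-1
computable-monomial ρ (k ∷ e) =
  computable-* (computable-^ (computable-var (ρ zero)) k) (computable-monomial (ρ ∘ suc) e)

computable-poly : ∀ {n} (p : Polynomial n) → Computable ⟦ p ⟧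
computable-poly []            = computable-0
computable-poly ((c , e) ∷ p) = computable-+
  (computable-* (computable-const c)
    (computable-cong (λ x → cong (monomial e) (Vec.tabulate∘lookup x)) (computable-monomial id e)))
  (computable-poly p)

-- The state `nothing` reads the zeros that code the first entry. The first other letter starts the
-- automaton for the remaining entries, whose letters are shifted by `suc`.
codewords : ∀ n → PDFA (Fin (suc n))
codewords zero = record
  { states = finite-Bool ; start = false ; step = λ q _ → if q then nothing else just true ; final = id }
codewords (suc n) = record
  { states = finite-Maybe states
  ; start  = nothing
  ; step   = λ { nothing  zero    → just nothing
               ; nothing  (suc γ) → Maybe.map just (step start γ)
               ; (just q) zero    → nothing
               ; (just q) (suc γ) → Maybe.map just (step q γ) }
  ; final  = maybe′ final false
  }
  where open PDFA (codewords n)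

codewords-closed : ∀ n q γ →
  PDFA.step (codewords (suc n)) (just q) γ ≡ nothing ⊎ ∃ λ γ′ → suc γ′ ≡ γ
codewords-closed n q zero    = inj₁ refl
codewords-closed n q (suc γ) = inj₂ (γ , refl)

module CodewordsSuc n = Embed (codewords n) (codewords (suc n)) just suc
  (λ _ _ → refl) (codewords-closed n) (λ _ → refl)

codewords-sound : ∀ {n} (x : Vec ℕ n) → PDFA.Accepted (codewords n) (codeword x)
codewords-sound []                  = tt
codewords-sound {suc n} (suc a ∷ x) = codewords-sound (a ∷ x)
codewords-sound {suc n} (zero ∷ x)  with codeword x | codeword-nonempty x | codewords-sound x
... | _ | γ , w , refl | h = CodewordsSuc.embed⇒ n (PDFA.step (codewords n) (PDFA.start (codewords n)) γ) w h

codewords-complete : ∀ n w → PDFA.Accepted (codewords n) w → ∃ λ (x : Vec ℕ n) → codeword x ≡ w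
codewords-complete zero    (zero ∷ [])  _ = [] , refl
codewords-complete (suc n) (zero ∷ w)   h with codewords-complete (suc n) w h
... | a ∷ x , eq = suc a ∷ x , cong (zero ∷_) eq
codewords-complete (suc n) (suc γ ∷ w)  h =
  let (u , h′ , eq) = CodewordsSuc.embed⇐ n (PDFA.step (codewords n) (PDFA.start (codewords n)) γ) w h
      (x , eq′)     = codewords-complete n (γ ∷ u) h′
  in 0 ∷ x , trans (cong (map suc) eq′) (cong (suc γ ∷_) eq)

codeword-injective : ∀ {n} (x y : Vec ℕ n) → codeword x ≡ codeword y → x ≡ y
codeword-injective []          []          _  = refl
codeword-injective (zero ∷ x)  (zero ∷ y)  eq =
  cong (0 ∷_) (codeword-injective x y (List.map-injective Fin.suc-injective eq))
codeword-injective (suc a ∷ x) (suc b ∷ y) eq with codeword-injective (a ∷ x) (b ∷ y) (List.∷-injectiveʳ eq)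
... | refl = refl
codeword-injective (zero ∷ x)  (suc b ∷ y) eq with codeword x | codeword-nonempty x
... | _ | _ , _ , refl = case List.∷-injectiveˡ eq of λ ()
codeword-injective (suc a ∷ x) (zero ∷ y)  eq with codeword y | codeword-nonempty y
... | _ | _ , _ , refl = case List.∷-injectiveˡ eq of λ ()

lookup≤length : ∀ {n} (x : Vec ℕ n) i → lookup x i ≤ length (codeword x)
lookup≤length (a ∷ x) i = subst (lookup (a ∷ x) i ≤_)
  (sym (trans (List.length-++ (replicate a zero))
    (cong₂ _+_ (List.length-replicate a) (List.length-map suc (codeword x)))))
  (bound i)
  where
  bound : ∀ i → lookup (a ∷ x) i ≤ a + length (codeword x)
  bound zero    = ℕ.m≤m+n a _
  bound (suc i) = ℕ.≤-trans (lookup≤length x i) (ℕ.m≤n+m _ a)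

-- The structure 𝔈(p) is coded by the accepting runs on codewords.
module Paths (em : ExcludedMiddle 0ℓ) {n} (p : Polynomial n)
  (W : CountingAutomaton (Fin (suc n))) (computes : Computes W ⟦ p ⟧) where

  private
    module W = CountingAutomaton W
    module C = PDFA (codewords n)

  -- A letter contains its source state because the type of the label depends on it. The automaton
  -- compares it with the current state, and so the path determines its run.
  Letter : Set
  Letter = Σ W.State λ q → Σ (Fin (suc n)) (W.Labels q)

  State : Set
  State = W.State × C.State

  stepIf : ∀ {q q′} → C.State → Dec (q ≡ q′) → ∀ γ → W.Labels q′ γ → Maybe State
  stepIf {q} c (yes refl) γ l = Maybe.map (W.move q γ l ,_) (C.step c γ)
  stepIf     c (no _)     γ l = nothing

  automaton : PDFA Letter
  automaton = record
    { states = finite-× W.states C.states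
    ; start  = W.start , C.start
    ; step   = λ (q , c) (q′ , γ , l) → stepIf c (em {q ≡ q′}) γ l
    ; final  = λ (q , c) → W.final q ∧ C.final c
    }

  open PDFA automaton using (AcceptsFrom; Accepted)

  path : ∀ q w → W.Run q w → List Letter
  path q []      _       = []
  path q (γ ∷ w) (l , r) = (q , γ , l) ∷ path (W.move q γ l) w r

  accepts-path : ∀ q s w r → C.AcceptsFrom s w → AcceptsFrom (Maybe.map (q ,_) s) (path q w r)
  accepts-path q (just c) []      r       h = Equivalence.from (Bool.T-∧ {W.final q}) (r , h)
  accepts-path q (just c) (γ ∷ w) (l , r) h with em {q ≡ q}
  ... | yes refl = accepts-path (W.move q γ l) (C.step c γ) w r h
  ... | no q≢q   = contradiction refl q≢q

  accepted-path : ∀ q s u → AcceptsFrom (Maybe.map (q ,_) s) u →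
    ∃₂ λ w r → C.AcceptsFrom s w × path q w r ≡ u
  accepted-path q (just c) [] h =
    let (r , h′) = Equivalence.to (Bool.T-∧ {W.final q}) h in [] , r , h′ , refl
  accepted-path q (just c) ((q′ , γ , l) ∷ u) h with em {q ≡ q′}
  ... | yes refl =
    let (w , r , h′ , eq) = accepted-path (W.move q γ l) (C.step c γ) u h
    in γ ∷ w , (l , r) , h′ , cong (_ ∷_) eq

  π : Letter → Maybe (Fin (suc n))
  π (q , γ , l) = just γ

  label-path : ∀ q w r j → label π (letter j (path q w r)) ≡ letter j w
  label-path q []      r       zero    = refl
  label-path q []      r       (suc j) = refl
  label-path q (γ ∷ w) (l , r) zero    = refl
  label-path q (γ ∷ w) (l , r) (suc j) = label-path (W.move q γ l) w r j

  letters-injective : ∀ {A : Set} (u v : List A) → (∀ j → letter j u ≡ letter j v) → u ≡ v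
  letters-injective []      []      h = refl
  letters-injective []      (b ∷ v) h = case h 0 of λ ()
  letters-injective (a ∷ u) []      h = case h 0 of λ ()
  letters-injective (a ∷ u) (b ∷ v) h =
    cong₂ _∷_ (Maybe.just-injective (h 0)) (letters-injective u v (h ∘ suc))

  length-path : ∀ q w r → length (path q w r) ≡ length w
  length-path q []      r       = refl
  length-path q (γ ∷ w) (l , r) = cong suc (length-path (W.move q γ l) w r)

  path-injective : ∀ q w {r s} → path q w r ≡ path q w s → r ≡ s
  path-injective q []      {r} {s} _ = Bool.T-irrelevant r s
  path-injective q (γ ∷ w) {l , r} {m , s} eq with List.∷-injective eq
  ... | refl , eq′ = cong (l ,_) (path-injective (W.move q γ l) w eq′)

  Element : Set
  Element = Σ[ x ∈ Vec ℕ n ] Fin (⟦ p ⟧ x)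

  word : Element → List Letter
  word (x , t) = path W.start (codeword x) (Inverse.to (computes x) t)

  same-index : ∀ y z → (∀ j → label π (letter j (word y)) ≡ label π (letter j (word z))) →
    proj₁ y ≡ proj₁ z
  same-index (x , t) (y , s) h = codeword-injective x y (letters-injective _ _ (λ j →
    trans (sym (label-path W.start (codeword x) _ j)) (trans (h j) (label-path W.start (codeword y) _ j))))

  word-injective : ∀ y z → word y ≡ word z → y ≡ z
  word-injective (x , t) (y , s) eq with same-index (x , t) (y , s) (λ j → cong (label π ∘ letter j) eq)
  ... | refl = cong (x ,_) (trans (sym (strictlyInverseʳ t))
      (trans (cong from (path-injective W.start (codeword x) eq)) (strictlyInverseʳ s)))
    where open Inverse (computes x)

  word-surjective : ∀ u → Accepted u → ∃ λ z → word z ≡ u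
  word-surjective u h with accepted-path W.start (just C.start) u h
  ... | w , r , h′ , refl with codewords-complete n w h′
  ...   | x , refl = (x , Inverse.from (computes x) r)
                   , cong (path W.start (codeword x)) (Inverse.strictlyInverseˡ (computes x) r)

  word-accepted : ∀ z → Accepted (word z)
  word-accepted (x , t) = accepts-path W.start (just C.start) (codeword x) _ (codewords-sound x)

  tuple : ∀ {k} → Vec ℕ k → ℕ
  tuple []      = 0
  tuple (a ∷ x) = pair a (tuple x)

  tuple-injective : ∀ {k} (x y : Vec ℕ k) → tuple x ≡ tuple y → x ≡ y
  tuple-injective []      []      _  = refl
  tuple-injective (a ∷ x) (b ∷ y) eq =
    let (eq₁ , eq₂) = pair-injective {a} {tuple x} eq in cong₂ _∷_ eq₁ (tuple-injective x y eq₂)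

  tuple-mono : ∀ {k} (x : Vec ℕ k) {m} → (∀ i → lookup x i ≤ m) → tuple x ≤ tuple (Vec.replicate k m)
  tuple-mono []      h = z≤n
  tuple-mono (a ∷ x) h = pair-mono (h zero) (tuple-mono x (h ∘ suc))

  poly-tuple : ∀ k → IsPoly {1} (λ v → tuple (Vec.replicate k (lookup v zero)))
  poly-tuple zero    = poly-const 0
  poly-tuple (suc k) = poly-pair (poly-var zero) (poly-tuple k)

  monomial-mono : ∀ {k} (e x : Vec ℕ k) {m} → (∀ i → lookup x i ≤ m) →
    monomial e x ≤ monomial e (Vec.replicate k m)
  monomial-mono []      []      h = ℕ.≤-refl
  monomial-mono (j ∷ e) (a ∷ x) h = ℕ.*-mono-≤ (ℕ.^-monoˡ-≤ j (h zero)) (monomial-mono e x (h ∘ suc))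

  ⟦⟧-mono : ∀ (q : Polynomial n) x {m} → (∀ i → lookup x i ≤ m) → ⟦ q ⟧ x ≤ ⟦ q ⟧ (Vec.replicate n m)
  ⟦⟧-mono []            x h = z≤n
  ⟦⟧-mono ((c , e) ∷ q) x h = ℕ.+-mono-≤ (ℕ.*-monoʳ-≤ c (monomial-mono e x h)) (⟦⟧-mono q x h)

  rank : Element → ℕ
  rank (x , t) = pair (tuple x) (toℕ t)

  rank-injective : ∀ y z → rank y ≡ rank z → y ≡ z
  rank-injective (x , t) (y , s) eq with pair-injective {tuple x} {toℕ t} eq
  ... | eq₁ , eq₂ with tuple-injective x y eq₁
  ...   | refl = cong (x ,_) (Fin.toℕ-injective eq₂)

  -- The entries of x are at most the length of the word, and every ingredient of `rank` is
  -- monotone, so each entry may be replaced by that length.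
  bound : IsPoly {1} (λ v → suc (pair (tuple (Vec.replicate n (lookup v zero)))
                                      (⟦ p ⟧ (Vec.replicate n (lookup v zero)))))
  bound = poly-+ (poly-const 1) (poly-pair (poly-tuple n)
    (poly-∘ {f = ⟦ p ⟧} (λ v → Vec.replicate n (lookup v zero))
      (λ i → poly-cong (λ v → sym (Vec.lookup-replicate i (lookup v zero))) (poly-var zero))
      (p , λ _ → refl)))

  coded-𝔈 : Coded (𝔈 ([_] ∘ ⟦ p ⟧))
  coded-𝔈 = record
    { letters        = finite-Σ W.states (λ q → finite-Σ (finite-Fin (suc n)) (W.labels q))
    ; automaton      = automaton
    ; word           = word
    ; injective      = word-injective _ _
    ; image          = (λ {u} → word-surjective u) , λ { (z , refl) → word-accepted z }
    ; Γ              = Fin (suc n)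
    ; π              = π
    ; preserves      = λ (x , t) (y , s) → mk⇔
        (λ { refl j → trans (label-path W.start (codeword x) _ j)
                        (sym (label-path W.start (codeword x) _ j)) })
        (same-index (x , t) (y , s))
    ; rank           = rank
    ; rank-injective = rank-injective _ _
    ; bound          = proj₁ bound
    ; bounded        = λ (x , t) →
        let entry≤ : ∀ i → lookup x i ≤ length (word (x , t))
            entry≤ i = subst (lookup x i ≤_) (sym (length-path W.start (codeword x) _)) (lookup≤length x i)
        in <-poly bound (length (word (x , t)) ∷ [])
             (s≤s (pair-mono (tuple-mono x entry≤)
               (ℕ.≤-trans (ℕ.<⇒≤ (Fin.toℕ<n t)) (⟦⟧-mono p x entry≤))))
    }

-- Listing subsets of a countable set

record Listing {X : Set} (I : Set) (P : Pred X 0ℓ) : Set where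
  field
    at        : I → X
    injective : Injective _≡_ _≡_ at
    image     : P ≐ (λ x → ∃ λ i → at i ≡ x)

  at-∈ : ∀ i → P (at i)
  at-∈ i = proj₂ image (i , refl)

module Increasing (em : ExcludedMiddle 0ℓ) (P : Pred ℕ 0ℓ)
  (unbounded : ∀ N → ∃ λ x → N ≤ x × P x) where

  Least : ℕ → Pred ℕ 0ℓ
  Least N x = N ≤ x × P x × (∀ y → N ≤ y → P y → x ≤ y)

  least : ∀ N → ∃ (Least N)
  least N = let (x , h) = unbounded N in go x (ℕ.<-wellFounded x) h
    where
    go : ∀ x → Acc _<_ x → N ≤ x × P x → ∃ (Least N)
    go x (acc rs) (N≤x , p) with em {∃ λ y → y < x × N ≤ y × P y}
    ... | yes (y , y<x , h) = go y (rs y<x) h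
    ... | no none           = x , N≤x , p , λ y N≤y q → ℕ.≮⇒≥ (λ y<x → none (y , y<x , N≤y , q))

  at : ℕ → ℕ
  at zero    = proj₁ (least 0)
  at (suc n) = proj₁ (least (suc (at n)))

  at-∈ : ∀ n → P (at n)
  at-∈ zero    = proj₁ (proj₂ (proj₂ (least 0)))
  at-∈ (suc n) = proj₁ (proj₂ (proj₂ (least (suc (at n)))))

  at-< : ∀ n → at n < at (suc n)
  at-< n = proj₁ (proj₂ (least (suc (at n))))

  at-mono : ∀ {m n} → m < n → at m < at n
  at-mono {m} {suc n} (s≤s m≤n) with ℕ.m≤n⇒m<n∨m≡n m≤n
  ... | inj₁ m<n  = ℕ.<-trans (at-mono m<n) (at-< n)
  ... | inj₂ refl = at-< n

  at-injective : Injective _≡_ _≡_ at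
  at-injective {m} {n} eq with ℕ.<-cmp m n
  ... | tri< m<n _ _ = contradiction eq (ℕ.<⇒≢ (at-mono m<n))
  ... | tri≈ _ e _   = e
  ... | tri> _ _ n<m = contradiction (sym eq) (ℕ.<⇒≢ (at-mono n<m))

  -- Gives `find` its starting point: an element x of P is looked for among the values up to `at x`.
  n≤at : ∀ n → n ≤ at n
  n≤at zero    = z≤n
  n≤at (suc n) = ℕ.≤-<-trans (n≤at n) (at-< n)

  find : ∀ n x → P x → x ≤ at n → ∃ λ m → at m ≡ x
  find zero    x p x≤ = 0 , ℕ.≤-antisym (proj₂ (proj₂ (proj₂ (least 0))) x z≤n p) x≤
  find (suc n) x p x≤ with ℕ.<-≤-connex (at n) x
  ... | inj₂ x≤at = find n x p x≤at
  ... | inj₁ at<x = suc n , ℕ.≤-antisym (proj₂ (proj₂ (proj₂ (least (suc (at n))))) x at<x p) x≤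

  listing : Listing ℕ P
  listing = record
    { at = at ; injective = at-injective
    ; image = (λ {x} p → find x x p (n≤at x)) , λ { (n , refl) → at-∈ n } }

module _ (em : ExcludedMiddle 0ℓ) {X : Set} (c : X ↣ ℕ) where

  open Injection c using (to) renaming (injective to to-injective)

  Codes : Pred X 0ℓ → Pred ℕ 0ℓ
  Codes P m = ∃ λ x → P x × to x ≡ m

  pull-back : ∀ {I P} → Listing I (Codes P) → Listing I P
  pull-back {I} {P} L = record
    { at        = λ i → proj₁ (at-∈ i)
    ; injective = λ {i} {j} eq → injective
        (trans (sym (proj₂ (proj₂ (at-∈ i)))) (trans (cong to eq) (proj₂ (proj₂ (at-∈ j)))))
    ; image     = (λ {x} p → let (i , eq) = proj₁ image (x , p , refl) in
                     i , to-injective (trans (proj₂ (proj₂ (at-∈ i))) eq))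
                , λ { (i , refl) → proj₁ (proj₂ (at-∈ i)) }
    }
    where open Listing L

  -- Bounded codes make the set a subset of an initial segment of ℕ, hence finite; unbounded ones
  -- are listed in increasing order.
  list : ∀ P → (∃ λ n → Listing (Fin n) P) ⊎ Listing ℕ P
  list P with em {∃ λ N → ∀ x → P x → to x < N}
  ... | yes (N , below) =
    let (n , E) = enum-⊆ em N {λ m → m < N} {Codes P} (λ { (x , p , refl) → below x p })
          (enum toℕ Fin.toℕ-injective
            ((λ m<N → fromℕ< m<N , Fin.toℕ-fromℕ< m<N) , λ { (i , refl) → Fin.toℕ<n i }))
    in inj₁ (n , pull-back record { Enum E })
  ... | no unbounded = inj₂ (pull-back
    (Increasing.listing em (Codes P) (λ N → above N (em {∃ λ m → N ≤ m × Codes P m}))))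
    where
    above : ∀ N → Dec (∃ λ m → N ≤ m × Codes P m) → ∃ λ m → N ≤ m × Codes P m
    above N (yes h) = h
    above N (no ¬h) = contradiction
      (N , λ x p → ℕ.≰⇒> (λ N≤ → ¬h (to x , N≤ , x , p , refl))) unbounded

  list-infinite : ∀ P → Infinite P → Listing ℕ P
  list-infinite P inf with list P
  ... | inj₂ L       = L
  ... | inj₁ (n , L) = contradiction
    (enum-finite (enum (Listing.at L) (Listing.injective L) (Listing.image L))) inf

module Unbounded (em : ExcludedMiddle 0ℓ) (B : EquivalenceStructure)
  (countable : Countable (Setoid.Carrier B)) (infinite : EveryClassInfinite B) where

  module B = Setoid B
  open Injection countable using () renaming (to to code; injective to code-injective)

  First : Pred B.Carrier 0ℓ
  First z = ∀ y → y B.≈ z → code z ≤ code y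

  first-unique : ∀ {y z} → First y → First z → y B.≈ z → y ≡ z
  first-unique {y} {z} f g y≈z = code-injective (ℕ.≤-antisym (f z (B.sym y≈z)) (g y y≈z))

  first-exists : ∀ y → ∃ λ z → First z × z B.≈ y
  first-exists y = go y (ℕ.<-wellFounded (code y))
    where
    go : ∀ y → Acc _<_ (code y) → ∃ λ z → First z × z B.≈ y
    go y (acc rs) with em {∃ λ z → z B.≈ y × code z < code y}
    ... | no none = y , (λ z z≈y → ℕ.≮⇒≥ (λ lt → none (z , z≈y , lt))) , B.refl
    ... | yes (z , z≈y , lt) = let (x , f , x≈z) = go z (rs lt) in x , f , B.trans x≈z z≈y

  class : ∀ z → Listing ℕ (z B.≈_)
  class z = list-infinite em countable (z B.≈_) (infinite z)

  -- The listing of the representatives numbers the rows, and the listing of each class numbers the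
  -- places within its row.
  ≅-rows : ∀ {I} → Listing I First → B ≅ Rows I
  ≅-rows {I} L = mk↔ₛ′ to from to-from (λ y → proj₂ (proj₂ (position y)))
    , λ x y → mk⇔
        (λ h → same (position x) (position y) h)
        (λ eq → related (position x) (position y) eq)
    where
    open Listing
    from : I × ℕ → B.Carrier
    from (i , j) = at (class (at L i)) j
    from-∈ : ∀ i j → at L i B.≈ from (i , j)
    from-∈ i j = at-∈ (class (at L i)) j
    position : ∀ y → ∃₂ λ i j → from (i , j) ≡ y
    position y with first-exists y
    ... | z , f , z≈y with proj₁ (image L) f
    ...   | i , refl = let (j , eq) = proj₁ (image (class (at L i))) z≈y in i , j , eq
    to : B.Carrier → I × ℕ
    to y = let (i , j , _) = position y in i , j
    same : ∀ {x y} ((i , _) : ∃₂ λ i j → from (i , j) ≡ x) ((i′ , _) : ∃₂ λ i j → from (i , j) ≡ y) →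
      x B.≈ y → i ≡ i′
    same (i , j , refl) (i′ , j′ , refl) h = injective L (first-unique
      (at-∈ L i) (at-∈ L i′) (B.trans (from-∈ i j) (B.trans h (B.sym (from-∈ i′ j′)))))
    related : ∀ {x y} ((i , _) : ∃₂ λ i j → from (i , j) ≡ x) ((i′ , _) : ∃₂ λ i j → from (i , j) ≡ y) →
      i ≡ i′ → x B.≈ y
    related (i , j , refl) (.i , j′ , refl) refl = B.trans (B.sym (from-∈ i j)) (from-∈ i j′)
    from-injective : ∀ {u v} → from u ≡ from v → u ≡ v
    from-injective {i , j} {i′ , j′} eq
      with same (i , j , refl) (i′ , j′ , refl) (B.reflexive eq)
    ... | refl = cong (i ,_) (injective (class (at L i)) eq)
    to-from : ∀ u → to (from u) ≡ u
    to-from u = from-injective (proj₂ (proj₂ (position (from u))))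

  coded-unbounded : Coded B
  coded-unbounded with list em countable First
  ... | inj₁ (n , L) = coded-≅ {B} {Rows (Fin n)} (≅-rows L) (rows-Fin n)
  ... | inj₂ L       = coded-≅ {B} {Rows ℕ} (≅-rows L) rows-ℕ

-- From decompositions to presentations

coded-⨆ : ExcludedMiddle 0ℓ → ∀ {Bs} →
  All (λ B → IsPolynomial𝔈 B ⊎ (Countable (Setoid.Carrier B) × EveryClassInfinite B)) Bs →
  Coded (⨆ Bs)
coded-⨆ em []       = coded-⊥
coded-⨆ em {B ∷ Bs} (h ∷ hs) = DisjointUnion.coded-⊎ (summand h) (coded-⨆ em hs)
  where
  summand : IsPolynomial𝔈 B ⊎ (Countable (Setoid.Carrier B) × EveryClassInfinite B) → Coded B
  summand (inj₁ (n , p , iso)) = let (W , computes) = computable-poly p in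
    coded-≅ {B} {𝔈 ([_] ∘ ⟦ p ⟧)} iso (Paths.coded-𝔈 em p W computes)
  summand (inj₂ (countable , infinite)) = Unbounded.coded-unbounded em B countable infinite

theorem6p3 : ExcludedMiddle 0ℓ →
    (A : EquivalenceStructure) →
    PolyGrowthAutomatic A ⇔
    (Σ[ Bs ∈ List EquivalenceStructure ]
    All (λ B → IsPolynomial𝔈 B ⊎ (Countable (Setoid.Carrier B) × EveryClassInfinite B)) Bs
    × A ≅ ⨆ Bs)
theorem6p3 em A = mk⇔
  (λ (P , growth) → Presented.decomposition em P growth (Presented.cover-universe em P growth))
  (λ (Bs , hs , iso) → Presentation.presentation em (coded-≅ {A} {⨆ Bs} iso (coded-⨆ em hs)))
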